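{- Let $m\ge1$ and $\kappa_m=\sqrt{\ln(4m)/\pi}$. The average number of nodes of the minimal dag of an $m$-labeled unranked tree of size $n$, taken uniformly at random, satisfies $$\bar N^{\mathcal T}_{m,n}=\kappa_m\frac{n}{\sqrt{\ln n}}\left(1+O\!\left(\frac1{\ln n}\right)\right)\quad(n\to\infty).$$
   Context: An $m$-labeled unranked tree is a non-empty finite rooted tree with node labels in $\{1,\dots,m\}$ and linearly ordered children (any finite number); its size is its number of edges. The number of nodes of its minimal dag is the number of distinct subtrees (subtree = a node with all its descendants, compared as ordered labeled trees). $\bar N^{\mathcal T}_{m,n}$ is the average of this quantity over all $m$-labeled unranked trees of size $n$. -}

module Defs where

open import Data.Empty using (⊥-elim)
open import Data.Fin.Base using (Fin; zero; suc)
import Data.Fin.Properties as Fin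
import Data.Integer as ℤ
import Data.Integer.Properties as ℤₚ
open import Data.List.Base as List using (List; []; _∷_; _++_; length; deduplicate; filter; cartesianProductWith; allFin)
open import Data.List.Membership.Propositional using (_∈_)
open import Data.List.Membership.Propositional.Properties
  using (∈-filter⁺; ∈-filter⁻; ∈-allFin; ∈-cartesianProductWith⁺; ∈-deduplicate⁺; ∈-deduplicate⁻)
open import Data.List.Relation.Unary.Any using (here; there)
open import Data.List.Relation.Unary.Unique.Propositional using (Unique)
import Data.List.Relation.Unary.Unique.DecPropositional.Properties as Unique
open import Data.Nat as ℕ using (ℕ; zero; suc; NonZero; NonTrivial; z≤n; s≤s)
import Data.Nat.DivMod as ℕ
open import Data.Nat.ListAction using (sum)
import Data.Nat.Properties as ℕ
open import Data.Product using (Σ; ∃; ∃-syntax; _×_; _,_; proj₁; proj₂)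
open import Data.Rational as ℚ using (ℚ; 0ℚ; 1ℚ)
import Data.Rational.Properties as ℚ
open import Data.Rational.Solver using (module +-*-Solver)
import Data.Rational.Unnormalised as ℚᵘ
import Data.Rational.Unnormalised.Properties as ℚᵘ
open import Data.Sum using (_⊎_; inj₁; inj₂)
open import Function.Base using (_∘_; _$_)
open import Relation.Binary.Definitions using (DecidableEquality)
open import Relation.Binary.PropositionalEquality
open import Relation.Nullary using (¬_; Dec; yes; no)
open import Relation.Unary using (Decidable)

------------------------------------------------------------------------
-- Labelled unranked trees and their minimal dags

data Tree (m : ℕ) : Set where
  node : Fin m → List (Tree m) → Tree m

Forest : ℕ → Set
Forest m = List (Tree m)

-- The size of a tree is its number of edges; for a forest we also count
-- the edge above each root.
mutual
  size : ∀ {m} → Tree m → ℕ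
  size (node _ ts) = forestSize ts

  forestSize : ∀ {m} → Forest m → ℕ
  forestSize []       = 0
  forestSize (t ∷ ts) = suc (size t) ℕ.+ forestSize ts

mutual
  subtrees : ∀ {m} → Tree m → List (Tree m)
  subtrees (node a ts) = node a ts ∷ forestSubtrees ts

  forestSubtrees : ∀ {m} → Forest m → List (Tree m)
  forestSubtrees []       = []
  forestSubtrees (t ∷ ts) = subtrees t ++ forestSubtrees ts

mutual
  _≟ᵀ_ : ∀ {m} → DecidableEquality (Tree m)
  node a ts ≟ᵀ node b us with a Fin.≟ b | ts ≟ᶠ us
  ... | yes refl | yes refl = yes refl
  ... | no a≢b   | _        = no λ { refl → a≢b refl }
  ... | yes _    | no ts≢us = no λ { refl → ts≢us refl }

  _≟ᶠ_ : ∀ {m} → DecidableEquality (Forest m)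
  []       ≟ᶠ []       = yes refl
  []       ≟ᶠ (_ ∷ _)  = no λ ()
  (_ ∷ _)  ≟ᶠ []       = no λ ()
  (t ∷ ts) ≟ᶠ (u ∷ us) with t ≟ᵀ u | ts ≟ᶠ us
  ... | yes refl | yes refl = yes refl
  ... | no t≢u   | _        = no λ { refl → t≢u refl }
  ... | yes _    | no ts≢us = no λ { refl → ts≢us refl }

dagNodes : ∀ {m} → Tree m → ℕ
dagNodes t = length (deduplicate _≟ᵀ_ (subtrees t))

-- A finite list containing, among others, every forest of size at most k.
forests : (m k : ℕ) → List (Forest m)
forests m zero    = [] ∷ []
forests m (suc k) = [] ∷ cartesianProductWith _∷_
  (cartesianProductWith node (allFin m) (forests m k)) (forests m k)

-- All trees of size n, each listed exactly once: see the three lemmas below.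
trees : (m n : ℕ) → List (Tree m)
trees m n = deduplicate _≟ᵀ_ $ filter (λ t → size t ℕ.≟ n) $
  cartesianProductWith node (allFin m) (forests m n)

forests-complete : ∀ {m} k (ts : Forest m) → forestSize ts ℕ.≤ k → ts ∈ forests m k
forests-complete zero    []               _       = here refl
forests-complete (suc k) []               _       = here refl
forests-complete (suc k) (node a us ∷ ts) (s≤s p) = there $ ∈-cartesianProductWith⁺ _∷_
  (∈-cartesianProductWith⁺ node (∈-allFin a)
    (forests-complete k us (ℕ.≤-trans (ℕ.m≤m+n _ _) p)))
  (forests-complete k ts (ℕ.≤-trans (ℕ.m≤n+m _ _) p))

trees-complete : ∀ {m n} {t : Tree m} → size t ≡ n → t ∈ trees m n
trees-complete {m} {n} {node a ts} eq = ∈-deduplicate⁺ _≟ᵀ_ $ ∈-filter⁺ _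
  (∈-cartesianProductWith⁺ node (∈-allFin a) (forests-complete n ts (ℕ.≤-reflexive eq))) eq

trees-sound : ∀ {m n} {t : Tree m} → t ∈ trees m n → size t ≡ n
trees-sound {m} {n} t∈ = proj₂ $ ∈-filter⁻ (λ t → size t ℕ.≟ n)
  {xs = cartesianProductWith node (allFin m) (forests m n)} $ ∈-deduplicate⁻ _≟ᵀ_ _ t∈

trees-unique : ∀ m n → Unique (trees m n)
trees-unique m n = Unique.deduplicate-! _≟ᵀ_ _

path : ∀ {m} .{{_ : NonZero m}} → ℕ → Tree m
path {suc m} zero    = node zero []
path {suc m} (suc n) = node zero (path n ∷ [])

size-path : ∀ {m} .{{_ : NonZero m}} n → size (path {m} n) ≡ n
size-path {suc m} zero    = refl
size-path {suc m} (suc n) = cong suc (trans (ℕ.+-identityʳ _) (size-path n))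

trees-nonEmpty : ∀ m .{{_ : NonZero m}} n → NonZero (length (trees m n))
trees-nonEmpty m n with trees m n | trees-complete {t = path n} (size-path n)
... | _ ∷ _ | _ = _

averageDagNodes : (m : ℕ) .{{_ : NonZero m}} (n : ℕ) → ℚ
averageDagNodes m n =
  (ℤ.+ sum (List.map dagNodes (trees m n)) ℚ./ length (trees m n)) {{trees-nonEmpty m n}}

------------------------------------------------------------------------
-- Bounded maximisation: greatest P? b is the greatest j ≤ b with P j,
-- and 0 if there is none.

greatest : {P : ℕ → Set} → Decidable P → ℕ → ℕ
greatest P? zero    = zero
greatest P? (suc b) with P? (suc b)
... | yes _ = suc b
... | no  _ = greatest P? b

module _ {P : ℕ → Set} (P? : Decidable P) where

  greatest-≤ : ∀ b → greatest P? b ℕ.≤ b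
  greatest-≤ zero    = z≤n
  greatest-≤ (suc b) with P? (suc b)
  ... | yes _ = ℕ.≤-refl
  ... | no  _ = ℕ.m≤n⇒m≤1+n (greatest-≤ b)

  greatest-sat : ∀ b → greatest P? b ≡ 0 ⊎ P (greatest P? b)
  greatest-sat zero    = inj₁ refl
  greatest-sat (suc b) with P? (suc b)
  ... | yes p = inj₂ p
  ... | no  _ = greatest-sat b

  greatest-max : ∀ b {j} → j ℕ.≤ b → P j → j ℕ.≤ greatest P? b
  greatest-max zero    j≤b Pj = j≤b
  greatest-max (suc b) {j} j≤b Pj with P? (suc b)
  ... | yes _ = j≤b
  ... | no ¬P with ℕ.m≤n⇒m<n∨m≡n j≤b
  ...   | inj₁ (s≤s j≤b′) = greatest-max b j≤b′ Pj
  ...   | inj₂ refl       = ⊥-elim (¬P Pj)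

------------------------------------------------------------------------
-- Rational arithmetic

fromℕ : ℕ → ℚ
fromℕ n = ℤ.+ n ℚ./ 1

-- 1/(k+1)
unit : ℕ → ℚ
unit k = ℤ.+ 1 ℚ./ suc k

module ℚ-Lemmas where
  open import Data.Rational
  open import Data.Rational.Properties
  open +-*-Solver

  fromℚᵘ-mono-≤ : ∀ {p q} → p ℚᵘ.≤ q → fromℚᵘ p ≤ fromℚᵘ q
  fromℚᵘ-mono-≤ {p} {q} p≤q = toℚᵘ-cancel-≤ $
    ℚᵘ.≤-trans (ℚᵘ.≤-reflexive (toℚᵘ-fromℚᵘ p)) $
    ℚᵘ.≤-trans p≤q (ℚᵘ.≤-reflexive (ℚᵘ.≃-sym (toℚᵘ-fromℚᵘ q)))

  frac-≤ : ∀ a b c d → a ℕ.* suc d ℕ.≤ c ℕ.* suc b → ℤ.+ a / suc b ≤ ℤ.+ c / suc d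
  frac-≤ a b c d p = fromℚᵘ-mono-≤ {ℚᵘ.mkℚᵘ (ℤ.+ a) b} {ℚᵘ.mkℚᵘ (ℤ.+ c) d} $ ℚᵘ.*≤* $
    subst₂ ℤ._≤_ (ℤₚ.pos-* a (suc d)) (ℤₚ.pos-* c (suc b)) (ℤ.+≤+ p)

  fromℚᵘ-homo-+ : ∀ p q → fromℚᵘ (p ℚᵘ.+ q) ≡ fromℚᵘ p + fromℚᵘ q
  fromℚᵘ-homo-+ p q = toℚᵘ-injective $ ℚᵘ.≃-trans (toℚᵘ-fromℚᵘ (p ℚᵘ.+ q)) $
    ℚᵘ.≃-sym $ ℚᵘ.≃-trans (toℚᵘ-homo-+ (fromℚᵘ p) (fromℚᵘ q)) $
    ℚᵘ.+-cong (toℚᵘ-fromℚᵘ p) (toℚᵘ-fromℚᵘ q)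

  fromℚᵘ-homo-* : ∀ p q → fromℚᵘ (p ℚᵘ.* q) ≡ fromℚᵘ p * fromℚᵘ q
  fromℚᵘ-homo-* p q = toℚᵘ-injective $ ℚᵘ.≃-trans (toℚᵘ-fromℚᵘ (p ℚᵘ.* q)) $
    ℚᵘ.≃-sym $ ℚᵘ.≃-trans (toℚᵘ-homo-* (fromℚᵘ p) (fromℚᵘ q)) $
    ℚᵘ.*-cong (toℚᵘ-fromℚᵘ p) (toℚᵘ-fromℚᵘ q)

  frac-* : ∀ a b c d → (ℤ.+ a / suc b) * (ℤ.+ c / suc d) ≡ ℤ.+ (a ℕ.* c) / (suc b ℕ.* suc d)
  frac-* a b c d = trans (sym (fromℚᵘ-homo-* (ℚᵘ.mkℚᵘ (ℤ.+ a) b) (ℚᵘ.mkℚᵘ (ℤ.+ c) d)))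
    (cong (_/ (suc b ℕ.* suc d)) (sym (ℤₚ.pos-* a c)))

  frac-cong : ∀ a b c d → a ℕ.* suc d ≡ c ℕ.* suc b → ℤ.+ a / suc b ≡ ℤ.+ c / suc d
  frac-cong a b c d p = ≤-antisym (frac-≤ a b c d (ℕ.≤-reflexive p))
                                  (frac-≤ c d a b (ℕ.≤-reflexive (sym p)))

  fromℕ-+ : ∀ a b → fromℕ (a ℕ.+ b) ≡ fromℕ a + fromℕ b
  fromℕ-+ a b = trans
    (cong (_/ 1) (sym (cong₂ ℤ._+_ (ℤₚ.*-identityʳ (ℤ.+ a)) (ℤₚ.*-identityʳ (ℤ.+ b)))))
    (fromℚᵘ-homo-+ (ℚᵘ.mkℚᵘ (ℤ.+ a) 0) (ℚᵘ.mkℚᵘ (ℤ.+ b) 0))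

  fromℕ-* : ∀ a b → fromℕ (a ℕ.* b) ≡ fromℕ a * fromℕ b
  fromℕ-* a b = sym (frac-* a 0 b 0)

  fromℕ-mono : ∀ {a b} → a ℕ.≤ b → fromℕ a ≤ fromℕ b
  fromℕ-mono {a} {b} p = frac-≤ a 0 b 0 (ℕ.*-monoˡ-≤ 1 p)

  0≤fromℕ : ∀ a → 0ℚ ≤ fromℕ a
  0≤fromℕ a = fromℕ-mono {0} {a} z≤n

  frac-split : ∀ a b → ℤ.+ a / suc b ≡ fromℕ a * unit b
  frac-split a b = sym $ trans (frac-* a 0 1 b) $
    frac-cong (a ℕ.* 1) (b ℕ.+ 0) a b
      (cong₂ ℕ._*_ (ℕ.*-identityʳ a) (cong suc (sym (ℕ.+-identityʳ b))))

  unit-inverse : ∀ k → fromℕ (suc k) * unit k ≡ 1ℚ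
  unit-inverse k = trans (sym (frac-split (suc k) k)) $
    frac-cong (suc k) k 1 0 (trans (ℕ.*-identityʳ _) (sym (ℕ.*-identityˡ _)))

  unit-* : ∀ a b → unit (b ℕ.+ a ℕ.* suc b) ≡ unit a * unit b
  unit-* a b = sym (frac-* 1 a 1 b)

  unit-scale : ∀ a b → fromℕ (suc a) * unit (b ℕ.+ a ℕ.* suc b) ≡ unit b
  unit-scale a b = begin
    fromℕ (suc a) * unit (b ℕ.+ a ℕ.* suc b)  ≡⟨ cong (fromℕ (suc a) *_) (unit-* a b) ⟩
    fromℕ (suc a) * (unit a * unit b)         ≡⟨ *-assoc (fromℕ (suc a)) (unit a) (unit b) ⟨
    fromℕ (suc a) * unit a * unit b           ≡⟨ cong (_* unit b) (unit-inverse a) ⟩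
    1ℚ * unit b                               ≡⟨ *-identityˡ (unit b) ⟩
    unit b                                    ∎
    where open ≡-Reasoning

  unit-antitone : ∀ {k l} → k ℕ.≤ l → unit l ≤ unit k
  unit-antitone {k} {l} p = frac-≤ 1 l 1 k (ℕ.*-monoʳ-≤ 1 (s≤s p))

  0<unit : ∀ k → 0ℚ < unit k
  0<unit k = positive⁻¹ (unit k) {{normalize-pos 1 (suc k)}}

  0≤unit : ∀ k → 0ℚ ≤ unit k
  0≤unit k = <⇒≤ (0<unit k)

  archimedean : ∀ ε → 0ℚ < ε → ∃[ N ] unit N ≤ ε
  archimedean ε@(mkℚ ℤ.+[1+ a ] d _) _ =
    d , subst (unit d ≤_) (↥p/↧p≡p ε) (frac-≤ 1 d (suc a) d (ℕ.*-monoˡ-≤ (suc d) {1} {suc a} (s≤s z≤n)))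
  archimedean (mkℚ (ℤ.+ 0) _ _)    (*<* (ℤ.+<+ ()))
  archimedean (mkℚ ℤ.-[1+ _ ] _ _) (*<* ())

  +-mono : ∀ {p q r s} → p ≤ q → r ≤ s → p + r ≤ q + s
  +-mono = +-mono-≤

  *-monoˡ : ∀ {r} → 0ℚ ≤ r → ∀ {p q} → p ≤ q → r * p ≤ r * q
  *-monoˡ {r} 0≤r = *-monoˡ-≤-nonNeg r {{nonNegative 0≤r}}

  *-monoʳ : ∀ {r} → 0ℚ ≤ r → ∀ {p q} → p ≤ q → p * r ≤ q * r
  *-monoʳ {r} 0≤r = *-monoʳ-≤-nonNeg r {{nonNegative 0≤r}}

  *-mono : ∀ {p q r s} → 0ℚ ≤ q → 0ℚ ≤ r → p ≤ q → r ≤ s → p * r ≤ q * s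
  *-mono 0≤q 0≤r p≤q r≤s = ≤-trans (*-monoʳ 0≤r p≤q) (*-monoˡ 0≤q r≤s)

  0≤+ : ∀ {p q} → 0ℚ ≤ p → 0ℚ ≤ q → 0ℚ ≤ p + q
  0≤+ 0≤p 0≤q = +-mono-≤ 0≤p 0≤q

  0≤* : ∀ {p q} → 0ℚ ≤ p → 0ℚ ≤ q → 0ℚ ≤ p * q
  0≤* {p} {q} 0≤p 0≤q = subst (_≤ p * q) (*-zeroʳ p) (*-monoˡ 0≤p 0≤q)

  0<* : ∀ {p q} → 0ℚ < p → 0ℚ < q → 0ℚ < p * q
  0<* {p} {q} 0<p 0<q =
    positive⁻¹ (p * q) {{pos*pos⇒pos p {{positive 0<p}} q {{positive 0<q}}}}

  ≤+ : ∀ p {q} → 0ℚ ≤ q → p ≤ p + q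
  ≤+ p {q} 0≤q = subst (_≤ p + q) (+-identityʳ p) (+-monoʳ-≤ p 0≤q)

  sq-cancel : ∀ {a b} → 0ℚ ≤ b → a * a ≤ b * b → a ≤ b
  sq-cancel {a} {b} 0≤b aa≤bb with a ≤? b
  ... | yes a≤b = a≤b
  ... | no  a≰b = ⊥-elim $ <-irrefl refl $ <-≤-trans bb<aa aa≤bb
    where
    b<a = ≰⇒> a≰b
    0<a = ≤-<-trans 0≤b b<a
    bb<aa : b * b < a * a
    bb<aa = ≤-<-trans (*-monoˡ 0≤b (<⇒≤ b<a)) (*-monoˡ-<-pos a {{positive 0<a}} b<a)

  0<½* : ∀ {ε} → 0ℚ < ε → 0ℚ < ½ * ε
  0<½* {ε} = 0<* {½} {ε} (positive⁻¹ ½)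

  halves : ∀ ε → ½ * ε + ½ * ε ≡ ε
  halves = solve 1 (λ e → con ½ :* e :+ con ½ :* e := e) refl

  p≤∣p∣ : ∀ p → p ≤ ∣ p ∣
  p≤∣p∣ p with ≤-total 0ℚ p
  ... | inj₁ 0≤p = ≤-reflexive (sym (0≤p⇒∣p∣≡p 0≤p))
  ... | inj₂ p≤0 = ≤-trans p≤0 (0≤∣p∣ p)

  ∣-∣-swap : ∀ p q → ∣ p - q ∣ ≡ ∣ q - p ∣
  ∣-∣-swap p q = trans (sym (∣-p∣≡∣p∣ (p - q))) $
    cong ∣_∣ (solve 2 (λ p q → :- (p :- q) := q :- p) refl p q)

  ∣∣-elim : ∀ {p q ε} → ∣ p - q ∣ ≤ ε → p ≤ q + ε
  ∣∣-elim {p} {q} {ε} h = begin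
    p            ≡⟨ solve 2 (λ p q → p := q :+ (p :- q)) refl p q ⟩
    q + (p - q)  ≤⟨ +-monoʳ-≤ q (≤-trans (p≤∣p∣ (p - q)) h) ⟩
    q + ε        ∎
    where open ≤-Reasoning

  move : ∀ {p q ε} → p ≤ q + ε → p - q ≤ ε
  move {p} {q} {ε} h = begin
    p - q        ≤⟨ +-monoˡ-≤ (- q) h ⟩
    q + ε - q    ≡⟨ solve 2 (λ q e → q :+ e :- q := e) refl q ε ⟩
    ε            ∎
    where open ≤-Reasoning

  ∣∣-intro : ∀ {p q ε} → p ≤ q + ε → q ≤ p + ε → ∣ p - q ∣ ≤ ε
  ∣∣-intro {p} {q} {ε} h k with ∣p∣≡p∨∣p∣≡-p (p - q)
  ... | inj₁ eq = subst (_≤ ε) (sym eq) (move h)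
  ... | inj₂ eq = subst (_≤ ε)
    (sym (trans eq (solve 2 (λ p q → :- (p :- q) := q :- p) refl p q))) (move k)

  ∣∣-cong : ∀ p q → ∣ p ∣ ≤ ∣ q ∣ + ∣ p - q ∣
  ∣∣-cong p q = subst (λ r → ∣ r ∣ ≤ ∣ q ∣ + ∣ p - q ∣)
    (solve 2 (λ p q → q :+ (p :- q) := p) refl p q) (∣p+q∣≤∣p∣+∣q∣ q (p - q))

open ℚ-Lemmas

------------------------------------------------------------------------
-- Real numbers as Cauchy sequences of rationals

IsCauchy : (ℕ → ℚ) → Set
IsCauchy x = ∀ ε → 0ℚ ℚ.< ε →
  ∃[ N ] ∀ i j → N ℕ.≤ i → N ℕ.≤ j → ℚ.∣ x i ℚ.- x j ∣ ℚ.≤ ε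

record ℝ : Set where
  no-eta-equality
  field
    seq    : ℕ → ℚ
    cauchy : IsCauchy seq

open ℝ

record Positive (x : ℝ) : Set where
  constructor mkPositive
  field
    bound       : ℚ
    0<bound     : 0ℚ ℚ.< bound
    start       : ℕ
    bound≤      : ∀ i → start ℕ.≤ i → bound ℚ.≤ seq x i

module CauchyLemmas where
  open import Data.Rational
  open import Data.Rational.Properties
  open +-*-Solver

  one-sided : ∀ {x : ℕ → ℚ} →
    (∀ ε → 0ℚ < ε → ∃[ N ] ∀ i j → N ℕ.≤ i → N ℕ.≤ j → x i ≤ x j + ε) → IsCauchy x
  one-sided h ε 0<ε with h ε 0<ε
  ... | N , p = N , λ i j N≤i N≤j → ∣∣-intro (p i j N≤i N≤j) (p j i N≤j N≤i)

  one-sided⁻ : ∀ (x : ℝ) ε → 0ℚ < ε →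
    ∃[ N ] ∀ i j → N ℕ.≤ i → N ℕ.≤ j → seq x i ≤ seq x j + ε
  one-sided⁻ x ε 0<ε with cauchy x ε 0<ε
  ... | N , p = N , λ i j N≤i N≤j → ∣∣-elim (p i j N≤i N≤j)

  rescale : ∀ C u ε v → 0ℚ ≤ C → C * u ≡ 1ℚ → v ≤ u * ε → C * v ≤ ε
  rescale C u ε v 0≤C Cu v≤ = begin
    C * v        ≤⟨ *-monoˡ 0≤C v≤ ⟩
    C * (u * ε)  ≡⟨ *-assoc C u ε ⟨
    C * u * ε    ≡⟨ cong (_* ε) Cu ⟩
    1ℚ * ε       ≡⟨ *-identityˡ ε ⟩
    ε            ∎
    where open ≤-Reasoning

  scaled-archimedean : ∀ c ε → 0ℚ < ε → ∃[ N ] fromℕ (suc c) * unit N ≤ ε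
  scaled-archimedean c ε 0<ε =
    let N , p = archimedean (unit c * ε) (0<* {unit c} {ε} (0<unit c) 0<ε)
    in N , rescale (fromℕ (suc c)) (unit c) ε (unit N) (0≤fromℕ (suc c)) (unit-inverse c) p

  regular : ∀ {x : ℕ → ℚ} c →
    (∀ i j → x i ≤ x j + fromℕ (suc c) * (unit i + unit j)) → IsCauchy x
  regular {x} c h = one-sided λ ε 0<ε →
    let N , p = scaled-archimedean c (½ * ε) (0<½* 0<ε)
    in N , λ i j N≤i N≤j → ≤-trans (h i j) $ +-monoʳ-≤ (x j) $ begin
      fromℕ (suc c) * (unit i + unit j)
        ≤⟨ *-monoˡ (0≤fromℕ (suc c)) (+-mono (unit-antitone N≤i) (unit-antitone N≤j)) ⟩
      fromℕ (suc c) * (unit N + unit N)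
        ≡⟨ *-distribˡ-+ (fromℕ (suc c)) (unit N) (unit N) ⟩
      fromℕ (suc c) * unit N + fromℕ (suc c) * unit N
        ≤⟨ +-mono p p ⟩
      ½ * ε + ½ * ε
        ≡⟨ halves ε ⟩
      ε ∎
    where open ≤-Reasoning

  eventually-bounded : (x : ℝ) →
    ∃[ B ] 0ℚ < B × ∃[ N ] ∀ i → N ℕ.≤ i → ∣ seq x i ∣ ≤ B
  eventually-bounded x with cauchy x 1ℚ (positive⁻¹ 1ℚ)
  ... | N , p = ∣ seq x N ∣ + 1ℚ
    , <-≤-trans (positive⁻¹ 1ℚ) (subst (_≤ ∣ seq x N ∣ + 1ℚ) (+-identityˡ 1ℚ)
                                       (+-monoˡ-≤ 1ℚ (0≤∣p∣ (seq x N))))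
    , N , λ i N≤i → ≤-trans (∣∣-cong (seq x i) (seq x N))
                            (+-monoʳ-≤ ∣ seq x N ∣ (p i N N≤i ℕ.≤-refl))

open CauchyLemmas

-- Inverse of a nonzero rational, extended by 0 ↦ 0.
recip : ℚ → ℚ
recip q with q ℚ.≟ 0ℚ
... | yes _   = 0ℚ
... | no  q≢0 = (ℚ.1/ q) {{ℚ.≢-nonZero q≢0}}

module OperationLemmas where
  open import Data.Rational hiding (Positive)
  open import Data.Rational.Properties
  open +-*-Solver

  recip-inverse : ∀ {q} → 0ℚ < q → q * recip q ≡ 1ℚ
  recip-inverse {q} 0<q with q ≟ 0ℚ
  ... | yes refl = ⊥-elim (<-irrefl refl 0<q)
  ... | no  q≢0  = *-inverseʳ q {{≢-nonZero q≢0}}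

  0≤recip : ∀ {q} → 0ℚ < q → 0ℚ ≤ recip q
  0≤recip {q} 0<q with 0ℚ ≤? recip q
  ... | yes p = p
  ... | no ¬p = ⊥-elim $ <-asym (positive⁻¹ 1ℚ) $
    subst₂ _<_ (recip-inverse 0<q) (*-zeroʳ q) $
    *-monoʳ-<-pos q {{positive 0<q}} (≰⇒> ¬p)

  recip-antitone : ∀ {p q} → 0ℚ < p → p ≤ q → recip q ≤ recip p
  recip-antitone {p} {q} 0<p p≤q = begin
    recip q                  ≡⟨ *-identityʳ (recip q) ⟨
    recip q * 1ℚ             ≡⟨ cong (recip q *_) (recip-inverse 0<p) ⟨
    recip q * (p * recip p)  ≤⟨ *-monoˡ (0≤recip 0<q) (*-monoʳ (0≤recip 0<p) p≤q) ⟩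
    recip q * (q * recip p)  ≡⟨ solve 3 (λ r q s → r :* (q :* s) := (q :* r) :* s) refl
                                  (recip q) q (recip p) ⟩
    (q * recip q) * recip p  ≡⟨ cong (_* recip p) (recip-inverse 0<q) ⟩
    1ℚ * recip p             ≡⟨ *-identityˡ (recip p) ⟩
    recip p                  ∎
    where
    open ≤-Reasoning
    0<q = <-≤-trans 0<p p≤q

  *-close : ∀ a b c d A B r ε → 0ℚ ≤ A → 0ℚ ≤ r * ε → (A + B) * r ≡ 1ℚ →
    ∣ a ∣ ≤ A → ∣ d ∣ ≤ B → ∣ a - c ∣ ≤ r * ε → ∣ b - d ∣ ≤ r * ε → ∣ a * b - c * d ∣ ≤ ε
  *-close a b c d A B r ε 0≤A 0≤η inv a≤ d≤ ac bd = begin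
    ∣ a * b - c * d ∣
      ≡⟨ cong ∣_∣ (solve 4 (λ a b c d → a :* b :- c :* d := a :* (b :- d) :+ (a :- c) :* d)
                     refl a b c d) ⟩
    ∣ a * (b - d) + (a - c) * d ∣
      ≤⟨ ∣p+q∣≤∣p∣+∣q∣ (a * (b - d)) ((a - c) * d) ⟩
    ∣ a * (b - d) ∣ + ∣ (a - c) * d ∣
      ≡⟨ cong₂ _+_ (∣p*q∣≡∣p∣*∣q∣ a (b - d)) (∣p*q∣≡∣p∣*∣q∣ (a - c) d) ⟩
    ∣ a ∣ * ∣ b - d ∣ + ∣ a - c ∣ * ∣ d ∣
      ≤⟨ +-mono (*-mono 0≤A (0≤∣p∣ (b - d)) a≤ bd) (*-mono 0≤η (0≤∣p∣ d) ac d≤) ⟩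
    A * (r * ε) + (r * ε) * B
      ≡⟨ solve 4 (λ a b r e → a :* (r :* e) :+ (r :* e) :* b := ((a :+ b) :* r) :* e)
           refl A B r ε ⟩
    ((A + B) * r) * ε
      ≡⟨ cong (_* ε) inv ⟩
    1ℚ * ε
      ≡⟨ *-identityˡ ε ⟩
    ε ∎
    where open ≤-Reasoning

  inverse-positive : ∀ p → 0ℚ < p → ∃[ r ] p * r ≡ 1ℚ × 0ℚ < r
  inverse-positive p 0<p = 1/ p , *-inverseʳ p , positive⁻¹ (1/ p) {{1/pos⇒pos p}}
    where instance
      p>0 = positive 0<p
      p≢0 = pos⇒nonZero p

  *-cauchy : (x y : ℝ) → IsCauchy (λ k → seq x k * seq y k)
  *-cauchy x y ε 0<ε =
    let A , 0<A , K , a≤ = eventually-bounded x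
        B , 0<B , L , b≤ = eventually-bounded y
        r , inv , 0<r    = inverse-positive (A + B) (+-mono-< 0<A 0<B)
        0<η              = 0<* {r} {ε} 0<r 0<ε
        M , p            = cauchy x (r * ε) 0<η
        N , q            = cauchy y (r * ε) 0<η
    in (K ℕ.+ L) ℕ.+ (M ℕ.+ N) , λ i j hi hj →
      *-close (seq x i) (seq y i) (seq x j) (seq y j) A B r ε (<⇒≤ 0<A) (<⇒≤ 0<η) inv
        (a≤ i (ℕ.m+n≤o⇒m≤o K (ℕ.m+n≤o⇒m≤o (K ℕ.+ L) hi)))
        (b≤ j (ℕ.m+n≤o⇒n≤o K (ℕ.m+n≤o⇒m≤o (K ℕ.+ L) hj)))
        (p i j (ℕ.m+n≤o⇒m≤o M (ℕ.m+n≤o⇒n≤o (K ℕ.+ L) hi))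
               (ℕ.m+n≤o⇒m≤o M (ℕ.m+n≤o⇒n≤o (K ℕ.+ L) hj)))
        (q i j (ℕ.m+n≤o⇒n≤o M (ℕ.m+n≤o⇒n≤o (K ℕ.+ L) hi))
               (ℕ.m+n≤o⇒n≤o M (ℕ.m+n≤o⇒n≤o (K ℕ.+ L) hj)))

  recip-close : ∀ a b u v δ w ε → a * u ≡ 1ℚ → b * v ≡ 1ℚ → δ * w ≡ 1ℚ →
    0ℚ ≤ u → 0ℚ ≤ v → 0ℚ ≤ w → 0ℚ ≤ δ * δ * ε → u ≤ w → v ≤ w → b ≤ a + δ * δ * ε → u ≤ v + ε
  recip-close a b u v δ w ε au bv δw 0≤u 0≤v 0≤w 0≤η u≤w v≤w b≤a = begin
    u
      ≡⟨ trans (cong (u *_) bv) (*-identityʳ u) ⟨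
    u * (b * v)
      ≤⟨ *-monoˡ 0≤u (*-monoʳ 0≤v b≤a) ⟩
    u * ((a + δ * δ * ε) * v)
      ≡⟨ solve 5 (λ u a d e v → u :* ((a :+ d :* d :* e) :* v)
                                := (a :* u) :* v :+ (u :* v) :* (d :* d :* e))
           refl u a δ ε v ⟩
    (a * u) * v + (u * v) * (δ * δ * ε)
      ≤⟨ +-mono (≤-reflexive (trans (cong (_* v) au) (*-identityˡ v)))
                (*-monoʳ 0≤η (*-mono 0≤w 0≤v u≤w v≤w)) ⟩
    v + (w * w) * (δ * δ * ε)
      ≡⟨ cong (v +_) (solve 3 (λ w d e → (w :* w) :* (d :* d :* e) := (d :* w) :* (d :* w) :* e)
                        refl w δ ε) ⟩
    v + (δ * w) * (δ * w) * ε
      ≡⟨ cong (λ t → v + t * t * ε) δw ⟩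
    v + 1ℚ * 1ℚ * ε
      ≡⟨ cong (v +_) (*-identityˡ ε) ⟩
    v + ε ∎
    where open ≤-Reasoning

  recip-cauchy : (x : ℝ) → Positive x → IsCauchy (λ k → recip (seq x k))
  recip-cauchy x (mkPositive δ 0<δ K δ≤) = one-sided λ ε 0<ε →
    let 0<η   = 0<* {δ * δ} {ε} (0<* {δ} {δ} 0<δ 0<δ) 0<ε
        N , p = one-sided⁻ x (δ * δ * ε) 0<η
    in K ℕ.+ N , λ i j Ni Nj →
      let a = seq x i
          b = seq x j
          δ≤a = δ≤ i (ℕ.m+n≤o⇒m≤o K Ni)
          δ≤b = δ≤ j (ℕ.m+n≤o⇒m≤o K Nj)
          0<a = <-≤-trans 0<δ δ≤a
          0<b = <-≤-trans 0<δ δ≤b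
      in recip-close a b (recip a) (recip b) δ (recip δ) ε
           (recip-inverse 0<a) (recip-inverse 0<b) (recip-inverse 0<δ)
           (0≤recip 0<a) (0≤recip 0<b) (0≤recip 0<δ) (<⇒≤ 0<η)
           (recip-antitone 0<δ δ≤a) (recip-antitone 0<δ δ≤b)
           (p j i (ℕ.m+n≤o⇒n≤o K Nj) (ℕ.m+n≤o⇒n≤o K Ni))

-- The greatest multiple of 1/(k+1) whose square is at most q, or 0 if q < 0.
-- The search range is large enough since q ≤ ∣ numerator q ∣ + 1.
SquareBelow : ℕ → ℚ → ℕ → Set
SquareBelow k q j = (ℤ.+ j ℚ./ suc k) ℚ.* (ℤ.+ j ℚ./ suc k) ℚ.≤ q

squareBelow? : ∀ k q → Decidable (SquareBelow k q)
squareBelow? k q j = (ℤ.+ j ℚ./ suc k) ℚ.* (ℤ.+ j ℚ./ suc k) ℚ.≤? q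

sqrtNumerator : ℕ → ℚ → ℕ
sqrtNumerator k q = greatest (squareBelow? k q) (suc ℤ.∣ ℚ.↥ q ∣ ℕ.* suc k)

rationalSqrt : ℕ → ℚ → ℚ
rationalSqrt k q = ℤ.+ sqrtNumerator k q ℚ./ suc k

module SqrtLemmas where
  open import Data.Rational hiding (Positive)
  open import Data.Rational.Properties
  open +-*-Solver

  0≤rationalSqrt : ∀ k q → 0ℚ ≤ rationalSqrt k q
  0≤rationalSqrt k q = frac-≤ 0 0 (sqrtNumerator k q) k z≤n

  grid-zero : ∀ k → ℤ.+ 0 / suc k ≡ 0ℚ
  grid-zero k = 0/n≡0 (suc k)

  zero-or-below : ∀ k q j → j ≡ 0 ⊎ SquareBelow k q j →
    ℤ.+ j / suc k ≡ 0ℚ ⊎ (ℤ.+ j / suc k) * (ℤ.+ j / suc k) ≤ q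
  zero-or-below k q j (inj₁ refl) = inj₁ (grid-zero k)
  zero-or-below k q j (inj₂ p)    = inj₂ p

  rationalSqrt-lower : ∀ k q →
    rationalSqrt k q ≡ 0ℚ ⊎ rationalSqrt k q * rationalSqrt k q ≤ q
  rationalSqrt-lower k q = zero-or-below k q (sqrtNumerator k q)
    (greatest-sat (squareBelow? k q) (suc ℤ.∣ ↥ q ∣ ℕ.* suc k))

  q≤∣num∣ : ∀ q → q ≤ fromℕ (suc ℤ.∣ ↥ q ∣)
  q≤∣num∣ q@(mkℚ (ℤ.+ a) d _) = subst (_≤ fromℕ (suc a)) (↥p/↧p≡p q) $
    frac-≤ a d (suc a) 0 $ ℕ.≤-trans (ℕ.≤-reflexive (ℕ.*-identityʳ a)) $
    ℕ.≤-trans (ℕ.n≤1+n a) (ℕ.m≤m*n (suc a) (suc d))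
  q≤∣num∣ q@(mkℚ ℤ.-[1+ a ] d _) =
    ≤-trans (<⇒≤ (negative⁻¹ q)) (0≤fromℕ (suc ℤ.∣ ↥ q ∣))

  ≤square : ∀ {q t} → q ≤ t → 1ℚ ≤ t → q ≤ t * t
  ≤square {q} {t} q≤t 1≤t = ≤-trans q≤t $
    subst (_≤ t * t) (*-identityˡ t) (*-monoʳ (≤-trans (<⇒≤ (positive⁻¹ 1ℚ)) 1≤t) 1≤t)

  square-mono : ∀ {a b} → 0ℚ ≤ a → a ≤ b → a * a ≤ b * b
  square-mono 0≤a a≤b = *-mono (≤-trans 0≤a a≤b) 0≤a a≤b a≤b

  grid-suc : ∀ k g → ℤ.+ suc g / suc k ≡ ℤ.+ g / suc k + unit k
  grid-suc k g = trans (frac-split (suc g) k) $ trans (cong (_* unit k) (fromℕ-+ 1 g)) $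
    trans (expand (fromℕ g) (unit k)) $ cong (_+ unit k) (sym (frac-split g k))
    where
    expand : ∀ a u → (1ℚ + a) * u ≡ a * u + u
    expand = solve 2 (λ a u → (con 1ℚ :+ a) :* u := a :* u :+ u) refl

  above : ∀ k q g b → b ≡ suc ℤ.∣ ↥ q ∣ ℕ.* suc k → g ℕ.≤ b →
    (∀ {j} → j ℕ.≤ b → SquareBelow k q j → j ℕ.≤ g) →
    q ≤ (ℤ.+ suc g / suc k) * (ℤ.+ suc g / suc k)
  above k q g b b≡ g≤b max with ℕ.m≤n⇒m<n∨m≡n g≤b
  ... | inj₁ g<b with ≤-total q ((ℤ.+ suc g / suc k) * (ℤ.+ suc g / suc k))
  ...   | inj₁ p = p
  ...   | inj₂ p = ⊥-elim (ℕ.<-irrefl refl (max g<b p))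
  above k q g b b≡ g≤b max | inj₂ g≡b = ≤square
    (≤-trans (q≤∣num∣ q) (≤suc (suc ℤ.∣ ↥ q ∣) ℕ.≤-refl))
    (≤suc 1 (s≤s z≤n))
    where
    ≤suc : ∀ a → a ℕ.≤ suc ℤ.∣ ↥ q ∣ → fromℕ a ≤ ℤ.+ suc g / suc k
    ≤suc a a≤ = frac-≤ a 0 (suc g) k $ ℕ.≤-trans (ℕ.*-monoˡ-≤ (suc k) a≤) $
      ℕ.≤-trans (ℕ.≤-reflexive (trans (sym b≡) (sym g≡b))) $
      ℕ.≤-trans (ℕ.n≤1+n g) (ℕ.≤-reflexive (sym (ℕ.*-identityʳ (suc g))))

  rationalSqrt-upper : ∀ k q →
    q ≤ (rationalSqrt k q + unit k) * (rationalSqrt k q + unit k)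
  rationalSqrt-upper k q = subst (λ t → q ≤ t * t) (grid-suc k (sqrtNumerator k q)) $
    above k q (sqrtNumerator k q) (suc ℤ.∣ ↥ q ∣ ℕ.* suc k) refl
      (greatest-≤ (squareBelow? k q) _) (greatest-max (squareBelow? k q) _)

  √-step : ∀ s t u η p q → 0ℚ ≤ t → 0ℚ ≤ u → 0ℚ ≤ η → s ≡ 0ℚ ⊎ s * s ≤ p →
    q ≤ (t + u) * (t + u) → p ≤ q + η * η → s ≤ t + u + η
  √-step s t u η p q 0≤t 0≤u 0≤η (inj₁ refl) q≤ p≤ = 0≤+ (0≤+ 0≤t 0≤u) 0≤η
  √-step s t u η p q 0≤t 0≤u 0≤η (inj₂ ss≤p) q≤ p≤ = sq-cancel (0≤+ (0≤+ 0≤t 0≤u) 0≤η) $ begin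
    s * s
      ≤⟨ ≤-trans ss≤p p≤ ⟩
    q + η * η
      ≤⟨ +-monoˡ-≤ (η * η) q≤ ⟩
    (t + u) * (t + u) + η * η
      ≤⟨ ≤+ _ (0≤+ (0≤* {t + u} {η} (0≤+ 0≤t 0≤u) 0≤η) (0≤* {t + u} {η} (0≤+ 0≤t 0≤u) 0≤η)) ⟩
    (t + u) * (t + u) + η * η + ((t + u) * η + (t + u) * η)
      ≡⟨ solve 2 (λ a e → a :* a :+ e :* e :+ (a :* e :+ a :* e) := (a :+ e) :* (a :+ e))
           refl (t + u) η ⟩
    (t + u + η) * (t + u + η) ∎
    where open ≤-Reasoning

  √-lower : ∀ δ d s u p → 0ℚ ≤ d → d ≤ 1ℚ → d ≤ δ → 0ℚ ≤ s → 0ℚ ≤ u → u ≤ ½ * d →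
    δ ≤ p → p ≤ (s + u) * (s + u) → ½ * d ≤ s
  √-lower δ d s u p 0≤d d≤1 d≤δ 0≤s 0≤u u≤ δ≤p p≤ = begin
    ½ * d                      ≡⟨ solve 1 (λ d → con ½ :* d := d :- con ½ :* d) refl d ⟩
    d - ½ * d                  ≤⟨ move d≤s+½d ⟩
    s                          ∎
    where
    open ≤-Reasoning
    dd≤d : d * d ≤ d
    dd≤d = subst (d * d ≤_) (*-identityʳ d) (*-monoˡ 0≤d d≤1)
    d≤s+½d : d ≤ ½ * d + s
    d≤s+½d = begin
      d          ≤⟨ sq-cancel (0≤+ 0≤s 0≤u) (≤-trans dd≤d (≤-trans d≤δ (≤-trans δ≤p p≤))) ⟩
      s + u      ≤⟨ +-monoʳ-≤ s u≤ ⟩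
      s + ½ * d  ≡⟨ +-comm s (½ * d) ⟩
      ½ * d + s  ∎

  module Limit (r : ℕ → ℚ → ℚ) (0≤r : ∀ k q → 0ℚ ≤ r k q)
    (lower : ∀ k q → r k q ≡ 0ℚ ⊎ r k q * r k q ≤ q)
    (upper : ∀ k q → q ≤ (r k q + unit k) * (r k q + unit k)) where

    √-cauchy : (x : ℝ) → IsCauchy (λ k → r k (seq x k))
    √-cauchy x = one-sided λ ε 0<ε →
      let η     = ½ * ε
          0<η   = 0<½* 0<ε
          M , p = one-sided⁻ x (η * η) (0<* {η} {η} 0<η 0<η)
          N , q = archimedean η 0<η
      in M ℕ.+ N , λ i j hi hj →
        let s = r i (seq x i)
            t = r j (seq x j)
        in ≤-trans
          (√-step s t (unit j) η (seq x i) (seq x j)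
            (0≤r j (seq x j)) (0≤unit j) (<⇒≤ 0<η)
            (lower i (seq x i)) (upper j (seq x j))
            (p i j (ℕ.m+n≤o⇒m≤o M hi) (ℕ.m+n≤o⇒m≤o M hj)))
          (final t (unit j) ε (≤-trans (unit-antitone (ℕ.m+n≤o⇒n≤o M hj)) q))
      where
      final : ∀ t u ε → u ≤ ½ * ε → t + u + ½ * ε ≤ t + ε
      final t u ε u≤ = begin
        t + u + ½ * ε        ≡⟨ +-assoc t u (½ * ε) ⟩
        t + (u + ½ * ε)      ≤⟨ +-monoʳ-≤ t (+-monoˡ-≤ (½ * ε) u≤) ⟩
        t + (½ * ε + ½ * ε)  ≡⟨ cong (t +_) (halves ε) ⟩
        t + ε                ∎
        where open ≤-Reasoning

    √-bound : (x : ℝ) → Positive x → ∃[ d ] 0ℚ < d × ∃[ N ]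
      ∀ i → N ℕ.≤ i → d ≤ r i (seq x i)
    √-bound x (mkPositive δ 0<δ K δ≤) = ½ * d , 0<½* 0<d , K ℕ.+ N , λ i hi →
      √-lower δ d (r i (seq x i)) (unit i) (seq x i) (<⇒≤ 0<d) (p⊓q≤q δ 1ℚ) (p⊓q≤p δ 1ℚ)
        (0≤r i (seq x i)) (0≤unit i)
        (≤-trans (unit-antitone (ℕ.m+n≤o⇒n≤o K hi)) (proj₂ arch))
        (δ≤ i (ℕ.m+n≤o⇒m≤o K hi)) (upper i (seq x i))
      where
      d = δ ⊓ 1ℚ
      0<d : 0ℚ < d
      0<d with ⊓-sel δ 1ℚ
      ... | inj₁ eq = subst (0ℚ <_) (sym eq) 0<δ
      ... | inj₂ eq = subst (0ℚ <_) (sym eq) (positive⁻¹ 1ℚ)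
      arch = archimedean (½ * d) (0<½* 0<d)
      N = proj₁ arch

  open Limit rationalSqrt 0≤rationalSqrt rationalSqrt-lower rationalSqrt-upper public

-- harmonic n = 1 + 1/2 + ⋯ + 1/n
harmonic : ℕ → ℚ
harmonic zero    = 0ℚ
harmonic (suc k) = harmonic k ℚ.+ unit k

-- Right Riemann sum with mesh 1/(k+1) for ∫₁ⁿ dt/t:
-- the sum of 1/j over k+1 < j ≤ n(k+1).
lnSum : ℕ → ℕ → ℚ
lnSum n k = harmonic (n ℕ.* suc k) ℚ.- harmonic (suc k)

module LnLemmas where
  open import Data.Rational hiding (Positive; NonZero)
  open import Data.Rational.Properties
  open +-*-Solver

  monotone : (f : ℕ → ℚ) → (∀ k → f k ≤ f (suc k)) → ∀ {i j} → i ℕ.≤ j → f i ≤ f j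
  monotone f step {i} {j} i≤j with ℕ.m≤n⇒m<n∨m≡n i≤j
  ... | inj₂ refl = ≤-refl
  monotone f step {i} {suc j} _ | inj₁ (s≤s i≤j) = ≤-trans (monotone f step i≤j) (step j)

  harmonic-mono : ∀ {i j} → i ℕ.≤ j → harmonic i ≤ harmonic j
  harmonic-mono = monotone harmonic (λ k → ≤+ (harmonic k) (0≤unit k))

  distrib : ∀ h n u → h + (1ℚ + n) * u ≡ (h + n * u) + u
  distrib = solve 3 (λ h n u → h :+ (con 1ℚ :+ n) :* u := (h :+ n :* u) :+ u) refl

  harmonic-lower : ∀ a b c → b ℕ.+ a ℕ.≤ suc c →
    harmonic a + fromℕ b * unit c ≤ harmonic (b ℕ.+ a)
  harmonic-lower a zero    c _ = ≤-reflexive $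
    trans (cong (harmonic a +_) (*-zeroˡ (unit c))) (+-identityʳ (harmonic a))
  harmonic-lower a (suc b) c (s≤s h) = begin
    harmonic a + fromℕ (suc b) * unit c
      ≡⟨ cong (λ t → harmonic a + t * unit c) (fromℕ-+ 1 b) ⟩
    harmonic a + (1ℚ + fromℕ b) * unit c
      ≡⟨ distrib (harmonic a) (fromℕ b) (unit c) ⟩
    (harmonic a + fromℕ b * unit c) + unit c
      ≤⟨ +-mono (harmonic-lower a b c (ℕ.m≤n⇒m≤1+n h)) (unit-antitone h) ⟩
    harmonic (suc b ℕ.+ a) ∎
    where open ≤-Reasoning

  harmonic-upper : ∀ a b c → c ℕ.≤ a →
    harmonic (b ℕ.+ a) ≤ harmonic a + fromℕ b * unit c
  harmonic-upper a zero    c _ = ≤-reflexive $ sym $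
    trans (cong (harmonic a +_) (*-zeroˡ (unit c))) (+-identityʳ (harmonic a))
  harmonic-upper a (suc b) c h = begin
    harmonic (suc b ℕ.+ a)
      ≤⟨ +-mono (harmonic-upper a b c h) (unit-antitone (ℕ.≤-trans h (ℕ.m≤n+m a b))) ⟩
    (harmonic a + fromℕ b * unit c) + unit c
      ≡⟨ distrib (harmonic a) (fromℕ b) (unit c) ⟨
    harmonic a + (1ℚ + fromℕ b) * unit c
      ≡⟨ cong (λ t → harmonic a + t * unit c) (fromℕ-+ 1 b) ⟨
    harmonic a + fromℕ (suc b) * unit c ∎
    where open ≤-Reasoning

  block-lower : ∀ n k → harmonic (suc n ℕ.* suc k) + unit (suc k) ≤ harmonic (suc n ℕ.* suc (suc k))
  block-lower n k = subst₂ _≤_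
    (cong (harmonic (suc n ℕ.* suc k) +_) (unit-scale n (suc k)))
    (cong harmonic (sym (ℕ.*-suc (suc n) (suc k))))
    (harmonic-lower (suc n ℕ.* suc k) (suc n) (suc k ℕ.+ n ℕ.* suc (suc k))
      (ℕ.≤-reflexive (sym (ℕ.*-suc (suc n) (suc k)))))

  block-upper : ∀ n k → harmonic (suc n ℕ.* suc (suc k)) ≤ harmonic (suc n ℕ.* suc k) + unit k
  block-upper n k = subst₂ _≤_
    (cong harmonic (sym (ℕ.*-suc (suc n) (suc k))))
    (cong (harmonic (suc n ℕ.* suc k) +_) (unit-scale n k))
    (harmonic-upper (suc n ℕ.* suc k) (suc n) (k ℕ.+ n ℕ.* suc k) (ℕ.n≤1+n _))

  lnSum-increasing : ∀ n {i j} → i ℕ.≤ j → lnSum (suc n) i ≤ lnSum (suc n) j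
  lnSum-increasing n = monotone (lnSum (suc n)) λ k →
    step (harmonic (suc n ℕ.* suc k)) (harmonic (suc k)) (unit (suc k)) _ (block-lower n k)
    where
    step : ∀ a h u b → a + u ≤ b → a - h ≤ b - (h + u)
    step a h u b p = subst (_≤ b - (h + u))
      (solve 3 (λ a h u → a :+ u :- (h :+ u) := a :- h) refl a h u)
      (+-monoˡ-≤ (- (h + u)) p)

  lnSum-decreasing : ∀ n {i j} → i ℕ.≤ j →
    lnSum (suc n) j + unit j ≤ lnSum (suc n) i + unit i
  lnSum-decreasing n {i} {j} i≤j = neg-cancel $ monotone (λ k → - (lnSum (suc n) k + unit k))
    (λ k → neg-antimono-≤ $
      step (harmonic (suc n ℕ.* suc k)) (harmonic (suc k)) (unit (suc k)) (unit k) _ (block-upper n k))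
    i≤j
    where
    neg-cancel : ∀ {p q} → - p ≤ - q → q ≤ p
    neg-cancel {p} {q} h = subst₂ _≤_
      (solve 1 (λ q → :- (:- q) := q) refl q) (solve 1 (λ q → :- (:- q) := q) refl p)
      (neg-antimono-≤ h)
    step : ∀ a h u v b → b ≤ a + v → b - (h + u) + u ≤ a - h + v
    step a h u v b p = subst₂ _≤_
      (solve 3 (λ b h u → b :- h := b :- (h :+ u) :+ u) refl b h u)
      (solve 3 (λ a h v → a :+ v :- h := a :- h :+ v) refl a h v)
      (+-monoˡ-≤ (- h) p)

  lnSum-cauchy : ∀ n → IsCauchy (lnSum (suc n))
  lnSum-cauchy n = regular {lnSum (suc n)} 0 λ i j →
    subst (λ t → lnSum (suc n) i ≤ lnSum (suc n) j + t) (sym (*-identityˡ (unit i + unit j))) (bound i j)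
    where
    bound : ∀ i j → lnSum (suc n) i ≤ lnSum (suc n) j + (unit i + unit j)
    bound i j with ℕ.≤-total i j
    ... | inj₁ i≤j = ≤-trans (lnSum-increasing n i≤j)
                             (≤+ (lnSum (suc n) j) (0≤+ (0≤unit i) (0≤unit j)))
    ... | inj₂ j≤i = ≤-trans (≤+ (lnSum (suc n) i) (0≤unit i)) $
      ≤-trans (lnSum-decreasing n j≤i) $
      +-monoʳ-≤ (lnSum (suc n) j) $
      subst (unit j ≤_) (+-comm (unit j) (unit i)) (≤+ (unit j) (0≤unit i))

  lnSum-positive : ∀ n → 1 ℕ.≤ n → ∀ i → unit 1 ≤ lnSum (suc n) i
  lnSum-positive n 1≤n i = ≤-trans start (lnSum-increasing n {0} {i} z≤n)
    where
    start : unit 1 ≤ harmonic (suc n ℕ.* 1) - harmonic 1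
    start = begin
      unit 1                               ≤⟨ ≤-reflexive refl ⟩
      harmonic 2 - harmonic 1              ≤⟨ +-monoˡ-≤ (- harmonic 1) (harmonic-mono 2≤) ⟩
      harmonic (suc n ℕ.* 1) - harmonic 1  ∎
      where
      open ≤-Reasoning
      2≤ : 2 ℕ.≤ suc n ℕ.* 1
      2≤ = subst (2 ℕ.≤_) (sym (ℕ.*-identityʳ (suc n))) (s≤s 1≤n)


------------------------------------------------------------------------
-- The area of the unit disc

-- Σ[1… n ] f = f 1 + ⋯ + f n
Σ[1…_] : ℕ → (ℕ → ℕ) → ℕ
Σ[1… zero  ] f = 0
Σ[1… suc n ] f = Σ[1… n ] f ℕ.+ f (suc n)

InDisc : ℕ → ℕ → ℕ → Set
InDisc r i j = i ℕ.* i ℕ.+ j ℕ.* j ℕ.≤ r ℕ.* r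

inDisc? : ∀ r i → Decidable (InDisc r i)
inDisc? r i j = i ℕ.* i ℕ.+ j ℕ.* j ℕ.≤? r ℕ.* r

column : ℕ → ℕ → ℕ
column r i = greatest (inDisc? r i) r

-- The number of unit squares [i-1,i] × [j-1,j] with i, j ≥ 1 that lie in the disc
-- of radius r about the origin.
quarterDisc : ℕ → ℕ
quarterDisc r = Σ[1… r ] (column r)

-- The area covered in the unit disc by the squares of a mesh of width 1/(k+1).
discArea : ℕ → ℚ
discArea k = ℤ.+ (4 ℕ.* quarterDisc (suc k)) ℚ./ (suc k ℕ.* suc k)

module DiscLemmas where
  open import Data.Nat
  open import Data.Nat.Properties
  open import Data.Nat.DivMod
  import Data.Nat.Solver
  open Data.Nat.Solver.+-*-Solver

  column-max : ∀ r i {j} → j ≤ r → InDisc r i j → j ≤ column r i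
  column-max r i = greatest-max (inDisc? r i) r

  column-bound : ∀ r i c → (∀ j → j ≤ r → InDisc r i j → j ≤ c) → column r i ≤ c
  column-bound r i c h with greatest-sat (inDisc? r i) r
  ... | inj₁ eq = ≤-trans (≤-reflexive eq) z≤n
  ... | inj₂ p  = h (column r i) (greatest-≤ (inDisc? r i) r) p

  column-≤ : ∀ r i → column r i ≤ r
  column-≤ r i = greatest-≤ (inDisc? r i) r

  column-antitone : ∀ r {i i′} → i ≤ i′ → column r i′ ≤ column r i
  column-antitone r {i} {i′} i≤i′ = column-bound r i′ (column r i) λ j j≤r p →
    column-max r i j≤r (≤-trans (+-monoˡ-≤ (j * j) (*-mono-≤ i≤i′ i≤i′)) p)

  scale-disc : ∀ s i j → (i * s) * (i * s) + (j * s) * (j * s) ≡ (i * i + j * j) * (s * s)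
  scale-disc = solve 3 (λ s i j → (i :* s) :* (i :* s) :+ (j :* s) :* (j :* s)
                                  := (i :* i :+ j :* j) :* (s :* s)) refl

  scale-square : ∀ s r → (r * s) * (r * s) ≡ (r * r) * (s * s)
  scale-square = solve 2 (λ s r → (r :* s) :* (r :* s) := (r :* r) :* (s :* s)) refl

  column-scale-lower : ∀ r s i → column r i * s ≤ column (r * s) (i * s)
  column-scale-lower r s i with greatest-sat (inDisc? r i) r
  ... | inj₁ eq = ≤-trans (≤-reflexive (cong (_* s) eq)) z≤n
  ... | inj₂ p  = column-max (r * s) (i * s) (*-monoˡ-≤ s (column-≤ r i)) $
    subst₂ _≤_ (sym (scale-disc s i (column r i))) (sym (scale-square s r)) (*-monoˡ-≤ (s * s) p)

  column-scale-upper : ∀ r s .{{_ : NonZero s}} i → column (r * s) (i * s) ≤ suc (column r i) * s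
  column-scale-upper r s i = column-bound (r * s) (i * s) _ λ j j≤ p →
    let q = j / s
        qs≤j = m/n*n≤m j s
        q≤r = *-cancelʳ-≤ q r s (≤-trans qs≤j j≤)
        inside : InDisc r i q
        inside = *-cancelʳ-≤ _ _ (s * s) {{m*n≢0 s s}} $
          subst₂ _≤_ (scale-disc s i q) (scale-square s r) $
          ≤-trans (+-monoʳ-≤ ((i * s) * (i * s)) (*-mono-≤ qs≤j qs≤j)) p
    in <⇒≤ $ <-≤-trans (below j) (*-monoˡ-≤ s (s≤s (column-max r i q≤r inside)))
    where
    below : ∀ j → j < suc (j / s) * s
    below j = subst (_< suc (j / s) * s) (sym (m≡m%n+[m/n]*n j s)) (+-monoˡ-< (j / s * s) (m%n<n j s))

  sum-lower : ∀ (f : ℕ → ℕ) a c k → (∀ i → i ≤ k → c ≤ f (i + a)) →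
    Σ[1… a ] f + k * c ≤ Σ[1… k + a ] f
  sum-lower f a c zero    h = ≤-reflexive (+-identityʳ _)
  sum-lower f a c (suc k) h = begin
    Σ[1… a ] f + (c + k * c)           ≡⟨ solve 3 (λ s c t → s :+ (c :+ t) := (s :+ t) :+ c) refl
                                            (Σ[1… a ] f) c (k * c) ⟩
    (Σ[1… a ] f + k * c) + c           ≤⟨ +-mono-≤ (sum-lower f a c k (λ i i≤k → h i (m≤n⇒m≤1+n i≤k)))
                                                   (h (suc k) ≤-refl) ⟩
    Σ[1… k + a ] f + f (suc (k + a))   ∎
    where open ≤-Reasoning

  sum-upper : ∀ (f : ℕ → ℕ) a c k → (∀ i → f (i + a) ≤ c) →
    Σ[1… k + a ] f ≤ Σ[1… a ] f + k * c
  sum-upper f a c zero    h = ≤-reflexive (sym (+-identityʳ _))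
  sum-upper f a c (suc k) h = begin
    Σ[1… k + a ] f + f (suc (k + a))   ≤⟨ +-mono-≤ (sum-upper f a c k h) (h (suc k)) ⟩
    (Σ[1… a ] f + k * c) + c           ≡⟨ solve 3 (λ s c t → (s :+ t) :+ c := s :+ (c :+ t)) refl
                                            (Σ[1… a ] f) c (k * c) ⟩
    Σ[1… a ] f + (c + k * c)           ∎
    where open ≤-Reasoning

  refine-lower : ∀ r s n → Σ[1… n ] (column r) * (s * s) ≤ Σ[1… n * s ] (column (r * s))
  refine-lower r s zero    = z≤n
  refine-lower r s (suc n) = begin
    (Σ[1… n ] (column r) + c) * (s * s)
      ≡⟨ solve 3 (λ a c s → (a :+ c) :* (s :* s) := a :* (s :* s) :+ s :* (c :* s)) refl
           (Σ[1… n ] (column r)) c s ⟩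
    Σ[1… n ] (column r) * (s * s) + s * (c * s)
      ≤⟨ +-monoˡ-≤ (s * (c * s)) (refine-lower r s n) ⟩
    Σ[1… n * s ] (column (r * s)) + s * (c * s)
      ≤⟨ sum-lower (column (r * s)) (n * s) (c * s) s (λ i i≤s →
           ≤-trans (column-scale-lower r s (suc n)) (column-antitone (r * s) (+-monoˡ-≤ (n * s) i≤s))) ⟩
    Σ[1… suc n * s ] (column (r * s)) ∎
    where
    open ≤-Reasoning
    c = column r (suc n)

  refine-upper : ∀ r s .{{_ : NonZero s}} n →
    Σ[1… n * s ] (column (r * s)) + column r n * (s * s) ≤ (r + Σ[1… n ] (column r) + n) * (s * s)
  refine-upper r s zero    = *-monoˡ-≤ (s * s) (≤-trans (column-≤ r 0)
    (≤-reflexive (sym (trans (+-identityʳ (r + 0)) (+-identityʳ r)))))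
  refine-upper r s (suc n) = begin
    Σ[1… s + n * s ] f + c′ * (s * s)
      ≤⟨ +-monoˡ-≤ (c′ * (s * s)) (sum-upper f (n * s) (suc c * s) s (λ i →
           ≤-trans (column-antitone (r * s) (m≤n+m (n * s) i)) (column-scale-upper r s n))) ⟩
    Σ[1… n * s ] f + s * (suc c * s) + c′ * (s * s)
      ≡⟨ solve 4 (λ a c d s → a :+ s :* ((con 1 :+ c) :* s) :+ d :* (s :* s)
                              := (a :+ c :* (s :* s)) :+ (con 1 :+ d) :* (s :* s)) refl
           (Σ[1… n * s ] f) c c′ s ⟩
    (Σ[1… n * s ] f + c * (s * s)) + suc c′ * (s * s)
      ≤⟨ +-monoˡ-≤ (suc c′ * (s * s)) (refine-upper r s n) ⟩
    (r + Σ[1… n ] (column r) + n) * (s * s) + suc c′ * (s * s)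
      ≡⟨ solve 5 (λ r a n d s → (r :+ a :+ n) :* (s :* s) :+ (con 1 :+ d) :* (s :* s)
                                := (r :+ (a :+ d) :+ (con 1 :+ n)) :* (s :* s)) refl
           r (Σ[1… n ] (column r)) n c′ s ⟩
    (r + Σ[1… suc n ] (column r) + suc n) * (s * s) ∎
    where
    open ≤-Reasoning
    f = column (r * s)
    c = column r n
    c′ = column r (suc n)

  quarterDisc-compare : ∀ r s .{{_ : NonZero r}} →
    quarterDisc r * (s * s) ≤ (quarterDisc s + 2 * s) * (r * r)
  quarterDisc-compare r s = begin
    quarterDisc r * (s * s)                 ≤⟨ refine-lower r s r ⟩
    quarterDisc (r * s)                     ≡⟨ cong quarterDisc (*-comm r s) ⟩
    quarterDisc (s * r)                     ≤⟨ m≤m+n _ _ ⟩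
    quarterDisc (s * r) + column s s * (r * r)
                                            ≤⟨ refine-upper s r s ⟩
    (s + quarterDisc s + s) * (r * r)       ≡⟨ cong (_* (r * r)) (solve 2 (λ s a →
                                                 s :+ a :+ s := a :+ con 2 :* s) refl s (quarterDisc s)) ⟩
    (quarterDisc s + 2 * s) * (r * r)       ∎
    where open ≤-Reasoning

  times-four : ∀ r s .{{_ : NonZero r}} →
    4 * quarterDisc r * (s * s) ≤ (4 * quarterDisc s + 8 * s) * (r * r)
  times-four r s = subst₂ _≤_
    (sym (*-assoc 4 (quarterDisc r) (s * s)))
    (solve 3 (λ a s r → con 4 :* ((a :+ con 2 :* s) :* (r :* r))
                        := (con 4 :* a :+ con 8 :* s) :* (r :* r)) refl (quarterDisc s) s r)
    (*-monoʳ-≤ 4 (quarterDisc-compare r s))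

module DiscAreaLemmas where
  open import Data.Rational
  open import Data.Rational.Properties
  open DiscLemmas using (times-four)

  discArea-compare : ∀ i j → discArea i ≤ discArea j + fromℕ 8 * unit j
  discArea-compare i j = ≤-trans
    (frac-≤ a (i ℕ.+ i ℕ.* suc i) (b ℕ.+ c) d (times-four (suc i) (suc j)))
    (≤-reflexive (split b c d (fromℕ 8 * unit j) error))
    where
    a = 4 ℕ.* quarterDisc (suc i)
    b = 4 ℕ.* quarterDisc (suc j)
    c = 8 ℕ.* suc j
    d = j ℕ.+ j ℕ.* suc j
    split : ∀ b c d e → fromℕ c * unit d ≡ e → ℤ.+ (b ℕ.+ c) / suc d ≡ ℤ.+ b / suc d + e
    split b c d e eq = begin
      ℤ.+ (b ℕ.+ c) / suc d                ≡⟨ frac-split (b ℕ.+ c) d ⟩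
      fromℕ (b ℕ.+ c) * unit d             ≡⟨ cong (_* unit d) (fromℕ-+ b c) ⟩
      (fromℕ b + fromℕ c) * unit d         ≡⟨ *-distribʳ-+ (unit d) (fromℕ b) (fromℕ c) ⟩
      fromℕ b * unit d + fromℕ c * unit d  ≡⟨ cong₂ _+_ (sym (frac-split b d)) eq ⟩
      ℤ.+ b / suc d + e                    ∎
      where open ≡-Reasoning
    error : fromℕ c * unit d ≡ fromℕ 8 * unit j
    error = trans (cong (_* unit d) (fromℕ-* 8 (suc j))) $
      trans (*-assoc (fromℕ 8) (fromℕ (suc j)) (unit d)) $
      cong (fromℕ 8 *_) (unit-scale j j)

  discArea-cauchy : IsCauchy discArea
  discArea-cauchy = regular {discArea} 7 λ i j → ≤-trans (discArea-compare i j) $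
    +-monoʳ-≤ (discArea j) $ *-monoˡ (0≤fromℕ 8) $
    subst (_≤ unit i + unit j) (+-identityˡ (unit j)) (+-monoˡ-≤ (unit j) (0≤unit i))

  discArea-positive : ∀ i → 15 ℕ.≤ i → ½ ≤ discArea i
  discArea-positive i 15≤i = cancel (discArea i) $ ≤-trans (discArea-compare 1 i) $
    +-monoʳ-≤ (discArea i) (*-monoˡ (0≤fromℕ 8) (unit-antitone 15≤i))
    where
    open +-*-Solver
    cancel : ∀ x → 1ℚ ≤ x + ½ → ½ ≤ x
    cancel x h = subst (½ ≤_) (solve 1 (λ x → x :+ con ½ :- con ½ := x) refl x)
      (+-monoˡ-≤ (- ½) h)

------------------------------------------------------------------------
-- Relations and operations on reals

open OperationLemmas
open SqrtLemmas using (√-cauchy; √-bound)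
open LnLemmas using (lnSum-cauchy; lnSum-positive)
open DiscAreaLemmas using (discArea-cauchy; discArea-positive)

infix 4 _≤_ _≃_

_≤_ : ℝ → ℝ → Set
x ≤ y = ∀ ε → 0ℚ ℚ.< ε → ∃[ N ] ∀ i → N ℕ.≤ i → seq x i ℚ.≤ seq y i ℚ.+ ε

_≃_ : ℝ → ℝ → Set
x ≃ y = ∀ ε → 0ℚ ℚ.< ε → ∃[ N ] ∀ i → N ℕ.≤ i → ℚ.∣ seq x i ℚ.- seq y i ∣ ℚ.≤ ε

infix  8 -_ _⁻¹
infixl 7 _*_ _/_
infixl 6 _+_

fromℚ : ℚ → ℝ
seq    (fromℚ q) _ = q
cauchy (fromℚ q) ε 0<ε = 0 , λ _ _ _ _ →
  subst (ℚ._≤ ε) (cong ℚ.∣_∣ (sym (ℚ.+-inverseʳ q))) (ℚ.<⇒≤ 0<ε)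

_+_ : ℝ → ℝ → ℝ
seq    (x + y) k = seq x k ℚ.+ seq y k
cauchy (x + y) = one-sided λ ε 0<ε →
  let M , p = one-sided⁻ x (ℚ.½ ℚ.* ε) (0<½* 0<ε)
      N , q = one-sided⁻ y (ℚ.½ ℚ.* ε) (0<½* 0<ε)
  in M ℕ.+ N , λ i j Ni Nj → subst (seq x i ℚ.+ seq y i ℚ.≤_) (rearrange ε (seq x j) (seq y j))
       (+-mono (p i j (ℕ.m+n≤o⇒m≤o M Ni) (ℕ.m+n≤o⇒m≤o M Nj))
               (q i j (ℕ.m+n≤o⇒n≤o M Ni) (ℕ.m+n≤o⇒n≤o M Nj)))
  where
  open +-*-Solver
  rearrange : ∀ e a b → (a ℚ.+ ℚ.½ ℚ.* e) ℚ.+ (b ℚ.+ ℚ.½ ℚ.* e) ≡ (a ℚ.+ b) ℚ.+ e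
  rearrange = solve 3 (λ e a b → (a :+ con ℚ.½ :* e) :+ (b :+ con ℚ.½ :* e) := (a :+ b) :+ e) refl

-_ : ℝ → ℝ
seq    (- x) k = ℚ.- seq x k
cauchy (- x) ε 0<ε with cauchy x ε 0<ε
... | N , p = N , λ i j N≤i N≤j → subst (ℚ._≤ ε)
  (trans (∣-∣-swap (seq x i) (seq x j)) (cong ℚ.∣_∣ (swap (seq x i) (seq x j)))) (p i j N≤i N≤j)
  where
  open +-*-Solver
  swap : ∀ a b → b ℚ.- a ≡ ℚ.- a ℚ.- (ℚ.- b)
  swap = solve 2 (λ a b → b :- a := :- a :- (:- b)) refl

∣_∣ : ℝ → ℝ
seq    ∣ x ∣ k = ℚ.∣ seq x k ∣
cauchy ∣ x ∣ = one-sided λ ε 0<ε →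
  let N , p = cauchy x ε 0<ε
  in N , λ i j N≤i N≤j → ℚ.≤-trans (∣∣-cong (seq x i) (seq x j))
                                   (ℚ.+-monoʳ-≤ ℚ.∣ seq x j ∣ (p i j N≤i N≤j))

_*_ : ℝ → ℝ → ℝ
seq    (x * y) k = seq x k ℚ.* seq y k
cauchy (x * y) = *-cauchy x y

_⁻¹ : (x : ℝ) {{_ : Positive x}} → ℝ
seq    (x ⁻¹) k = recip (seq x k)
cauchy ((x ⁻¹) {{x>0}}) = recip-cauchy x x>0

_/_ : (x y : ℝ) {{_ : Positive y}} → ℝ
x / y = x * y ⁻¹

√ : ℝ → ℝ
seq    (√ x) k = rationalSqrt k (seq x k)
cauchy (√ x) = √-cauchy x

-- ln n = ∫₁ⁿ dt/t
ln : (n : ℕ) .{{_ : NonZero n}} → ℝ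
seq    (ln n) = lnSum n
cauchy (ln (suc n)) = lnSum-cauchy n

-- The area of the unit disc.
π : ℝ
seq    π = discArea
cauchy π = discArea-cauchy

instance
  π-positive : Positive π
  π-positive = mkPositive ℚ.½ (ℚ.positive⁻¹ ℚ.½) 15 discArea-positive

  √-positive : {x : ℝ} {{_ : Positive x}} → Positive (√ x)
  √-positive {x} {{x>0}} = let d , 0<d , N , d≤ = √-bound x x>0 in mkPositive d 0<d N d≤

  nonTrivial⇒nonZero : ∀ {n} .{{_ : NonTrivial n}} → NonZero n
  nonTrivial⇒nonZero {n} = ℕ.nonTrivial⇒nonZero n

  ln-positive : ∀ {n} .{{_ : NonTrivial n}} → Positive (ln n)
  ln-positive {suc (suc n)} = mkPositive (unit 1) (0<unit 1) 0 λ i _ →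
    lnSum-positive (suc n) (s≤s z≤n) i

κ : (m : ℕ) .{{_ : NonZero m}} → ℝ
κ m = √ (ln (4 ℕ.* m) {{ℕ.m*n≢0 4 m}} / π)

-- f = O(g) as n → ∞, for sequences indexed by n ≥ 2
-- (so that ln n is positive).
_=O_ : (f g : (n : ℕ) .{{_ : NonTrivial n}} → ℝ) → Set
f =O g = ∃[ C ] ∃[ n₀ ] ∀ n .{{_ : NonTrivial n}} → n₀ ℕ.≤ n → ∣ f n ∣ ≤ C * ∣ g n ∣

{-# OPTIONS --safe #-}

-- Write b k = binom(2k,k)/4^k and c k = b k/(k+1). Splitting forests at the first root gives
-- the Catalan recursion, so there are m (4m)^n c n m-labelled trees of size n. For a fixed
-- tree u of size p, the same splitting gives exact formulas for
-- the total number of occurrences of u, and of pairs of occurrences of u, in all trees of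
-- size n; they depend on p only. Choose P with (4m)^(P-1) ≤ n < (4m)^P. Counting all
-- trees of size < P and all nodes with a subtree of size ≥ P bounds the average dag size
-- from above; counting only the latter, minus the pairs of equal ones (Bonferroni), bounds
-- it from below. The sum over p ≥ P of c p b (n-p) has a closed form, and both bounds are
-- n b P (1 + O(1/P)). Finally P² b P² π lies between P - 1 and P + 1 (Wästlund's proof of
-- the Wallis product, which packs rectangles into quarter discs), and P - 1 ≤ ln n / ln 4m ≤ P.

module Submission where

open import Defs using
  ( Tree; node; Forest; size; forestSize; subtrees; forestSubtrees; _≟ᵀ_; _≟ᶠ_; dagNodes
  ; trees; trees-complete; trees-sound; trees-unique; trees-nonEmpty; averageDagNodes
  ; fromℕ; unit; harmonic; lnSum; column; quarterDisc; discArea; Σ[1…_]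
  ; module ℚ-Lemmas; module CauchyLemmas; module OperationLemmas; module SqrtLemmas
  ; module LnLemmas; module DiscLemmas; module DiscAreaLemmas )
open import Data.Bool.Base using (if_then_else_)
open import Data.Empty using (⊥-elim)
import Data.Fin.Properties as Fin
import Data.Integer as ℤ
open import Data.List.Base as List using (List; []; _∷_; _++_; length; allFin; deduplicate)
open import Data.List.Membership.DecPropositional using () renaming (_∈?_ to member?)
open import Data.List.Membership.Propositional using (_∈_; _∉_)
open import Data.List.Membership.Propositional.Properties using (∈-allFin; ∈-++⁻; ∈-deduplicate⁺; ∈-deduplicate⁻)
open import Data.List.Properties using (length-tabulate)
import Data.List.Relation.Unary.All as All
open import Data.List.Relation.Unary.AllPairs using (_∷_)
open import Data.List.Relation.Unary.Any using (here; there)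
open import Data.List.Relation.Unary.Unique.DecPropositional.Properties using (deduplicate-!)
open import Data.List.Relation.Unary.Unique.Propositional using (Unique)
open import Data.List.Relation.Unary.Unique.Propositional.Properties using (allFin⁺)
open import Data.Nat as ℕ using (ℕ; zero; suc; z≤n; s≤s; NonZero; NonTrivial)
open import Data.Nat.ListAction using (sum)
import Data.Nat.Properties as ℕ
open import Data.Product using (Σ; ∃-syntax; _×_; _,_; proj₁; proj₂)
open import Data.Rational as ℚ using (ℚ; 0ℚ; 1ℚ)
import Data.Rational.Properties as ℚ
open import Data.Rational.Solver using (module +-*-Solver)
open import Data.Sum using (_⊎_; inj₁; inj₂)
open import Function.Base using (_$_; flip; _∘_)
open import Relation.Binary.Definitions using (DecidableEquality)
open import Relation.Binary.PropositionalEquality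
open import Relation.Nullary using (¬_; Dec; yes; no; does)
open +-*-Solver using (solve; _:=_; _:+_; _:*_; _:-_; :-_; con)

-- There are about (4m)^p trees of size p, up to a power of p, and a given one accounts for about
-- n/(4m)^p of the nodes of a tree of size n. These orders cross at P: smaller trees can be granted
-- to occur always, larger ones rarely occur twice. Both corrections are O(n c P), and c P = b
-- P/(P+1) puts them a factor of order P, hence of order ln n, below the main term n b P. This is
-- the source of the error O(1/ln n).
--
-- No generating functions are needed. After division by 4^k the series of b and c are (1-x)^(-1/2)
-- and 2(1-(1-x)^(1/2))/x, so every required count reduces to a finite convolution identity between
-- powers of 1-x, and these follow from the recurrence of b.
--
-- All estimates for a fixed n are rational inequalities. The error ε is defined as the average
-- divided by the main term, minus 1; the claimed equation then holds by construction, and the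
-- content lies in the bound on ε. That bound is obtained by comparing squares, which removes κ and
-- √(ln n) and leaves only π, ln n and ln 4m.

-- Finite convolutions and linear-combination proofs over the rationals.

module DiagonalSums where

  open import Data.Rational hiding (NonZero)
  open import Data.Rational.Properties
  open ℚ-Lemmas

  2ℚ : ℚ
  2ℚ = 1ℚ + 1ℚ

  4ℚ : ℚ
  4ℚ = 2ℚ * 2ℚ

  *-cancel : ∀ {r p q} → 0ℚ < r → r * p ≡ r * q → p ≡ q
  *-cancel {r} 0<r eq = ≤-antisym
    (*-cancelˡ-≤-pos r (≤-reflexive eq)) (*-cancelˡ-≤-pos r (≤-reflexive (sym eq)))
    where instance r>0 = positive 0<r

  difference-zero : ∀ {p q} → p - q ≡ 0ℚ → p ≡ q
  difference-zero {p} {q} eq = begin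
    p            ≡⟨ solve 2 (λ p q → p := (p :- q) :+ q) refl p q ⟩
    (p - q) + q  ≡⟨ cong (_+ q) eq ⟩
    0ℚ + q       ≡⟨ +-identityˡ q ⟩
    q            ∎
    where open ≡-Reasoning

  -- To show p ≡ q, exhibit p - q as a combination of known equations.
  combine : ∀ {p q l r} k → l ≡ r → p - q ≡ k * (l - r) → p ≡ q
  combine {l = l} k refl eq = difference-zero $ trans eq $
    solve 2 (λ k l → k :* (l :- l) := con 0ℚ) refl k l

  combine₂ : ∀ {p q l r l′ r′} k k′ → l ≡ r → l′ ≡ r′ →
    p - q ≡ k * (l - r) + k′ * (l′ - r′) → p ≡ q
  combine₂ {l = l} {l′ = l′} k k′ refl refl eq = difference-zero $ trans eq $
    solve 4 (λ k l k′ l′ → k :* (l :- l) :+ k′ :* (l′ :- l′) := con 0ℚ) refl k l k′ l′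

  combine₃ : ∀ {p q l r l′ r′ l″ r″} k k′ k″ → l ≡ r → l′ ≡ r′ → l″ ≡ r″ →
    p - q ≡ k * (l - r) + k′ * (l′ - r′) + k″ * (l″ - r″) → p ≡ q
  combine₃ {l = l} {l′ = l′} {l″ = l″} k k′ k″ refl refl refl eq = difference-zero $ trans eq $
    solve 6 (λ k l k′ l′ k″ l″ → k :* (l :- l) :+ k′ :* (l′ :- l′) :+ k″ :* (l″ :- l″) := con 0ℚ)
      refl k l k′ l′ k″ l″

  combine₄ : ∀ {p q l r l′ r′ l″ r″ l‴ r‴} k k′ k″ k‴ → l ≡ r → l′ ≡ r′ → l″ ≡ r″ → l‴ ≡ r‴ →
    p - q ≡ k * (l - r) + k′ * (l′ - r′) + k″ * (l″ - r″) + k‴ * (l‴ - r‴) → p ≡ q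
  combine₄ {l = l} {l′ = l′} {l″ = l″} {l‴ = l‴} k k′ k″ k‴ refl refl refl refl eq =
    difference-zero $ trans eq $
    solve 8 (λ k l k′ l′ k″ l″ k‴ l‴ →
        k :* (l :- l) :+ k′ :* (l′ :- l′) :+ k″ :* (l″ :- l″) :+ k‴ :* (l‴ :- l‴) := con 0ℚ)
      refl k l k′ l′ k″ l″ k‴ l‴

  -- diag φ n = Σ φ i j over all i + j = n
  diag : (ℕ → ℕ → ℚ) → ℕ → ℚ
  diag φ zero    = φ 0 0
  diag φ (suc n) = φ 0 (suc n) + diag (λ i j → φ (suc i) j) n

  diag-cong : ∀ {φ ψ} n → (∀ i j → i ℕ.+ j ≡ n → φ i j ≡ ψ i j) → diag φ n ≡ diag ψ n
  diag-cong zero    h = h 0 0 refl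
  diag-cong (suc n) h = cong₂ _+_ (h 0 (suc n) refl) (diag-cong n λ i j eq → h (suc i) j (cong suc eq))

  diag-mono : ∀ {φ ψ} n → (∀ i j → i ℕ.+ j ≡ n → φ i j ≤ ψ i j) → diag φ n ≤ diag ψ n
  diag-mono zero    h = h 0 0 refl
  diag-mono (suc n) h = +-mono (h 0 (suc n) refl) (diag-mono n λ i j eq → h (suc i) j (cong suc eq))

  diag-+ : ∀ φ ψ n → diag (λ i j → φ i j + ψ i j) n ≡ diag φ n + diag ψ n
  diag-+ φ ψ zero    = refl
  diag-+ φ ψ (suc n) = trans (cong (φ 0 (suc n) + ψ 0 (suc n) +_) (diag-+ _ _ n)) $
    solve 4 (λ a b c d → a :+ b :+ (c :+ d) := a :+ c :+ (b :+ d)) refl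
      (φ 0 (suc n)) (ψ 0 (suc n)) (diag (λ i j → φ (suc i) j) n) (diag (λ i j → ψ (suc i) j) n)

  diag-* : ∀ k φ n → diag (λ i j → k * φ i j) n ≡ k * diag φ n
  diag-* k φ zero    = refl
  diag-* k φ (suc n) = trans (cong (k * φ 0 (suc n) +_) (diag-* k _ n)) $
    sym (*-distribˡ-+ k (φ 0 (suc n)) (diag (λ i j → φ (suc i) j) n))

  diag-0 : ∀ n → diag (λ _ _ → 0ℚ) n ≡ 0ℚ
  diag-0 zero    = refl
  diag-0 (suc n) = trans (+-identityˡ _) (diag-0 n)

  diag-nonNegative : ∀ {φ} n → (∀ i j → 0ℚ ≤ φ i j) → 0ℚ ≤ diag φ n
  diag-nonNegative zero    h = h 0 0
  diag-nonNegative (suc n) h = 0≤+ (h 0 (suc n)) (diag-nonNegative n λ i j → h (suc i) j)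

  diag-last : ∀ φ n → diag φ (suc n) ≡ diag (λ i j → φ i (suc j)) n + φ (suc n) 0
  diag-last φ zero    = refl
  diag-last φ (suc n) = trans (cong (φ 0 (2 ℕ.+ n) +_) (diag-last (λ i j → φ (suc i) j) n)) $
    sym (+-assoc (φ 0 (2 ℕ.+ n)) _ _)

  diag-flip : ∀ φ n → diag φ n ≡ diag (flip φ) n
  diag-flip φ zero    = refl
  diag-flip φ (suc n) = begin
    φ 0 (suc n) + diag (λ i j → φ (suc i) j) n        ≡⟨ cong (φ 0 (suc n) +_) (diag-flip (λ i j → φ (suc i) j) n) ⟩
    φ 0 (suc n) + diag (λ i j → φ (suc j) i) n        ≡⟨ +-comm (φ 0 (suc n)) _ ⟩
    diag (λ i j → φ (suc j) i) n + φ 0 (suc n)        ≡⟨ diag-last (flip φ) n ⟨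
    diag (flip φ) (suc n)                             ∎
    where open ≡-Reasoning

  conv : (f g : ℕ → ℚ) → ℕ → ℚ
  conv f g = diag (λ i j → f i * g j)

  conv-comm : ∀ f g n → conv f g n ≡ conv g f n
  conv-comm f g n = trans (diag-flip _ n) (diag-cong n λ i j _ → *-comm (f j) (g i))

  -- On generating functions this is multiplication by x^q. The size of a fixed subtree enters the
  -- counts only through it.
  shift : ℕ → (ℕ → ℚ) → ℕ → ℚ
  shift zero    g n       = g n
  shift (suc q) g zero    = 0ℚ
  shift (suc q) g (suc n) = shift q g n

  shift-cong : ∀ q {f g} n → (∀ i → i ℕ.≤ n → f i ≡ g i) → shift q f n ≡ shift q g n
  shift-cong zero    n       h = h n ℕ.≤-refl
  shift-cong (suc q) zero    h = refl
  shift-cong (suc q) (suc n) h = shift-cong q n λ i i≤n → h i (ℕ.m≤n⇒m≤1+n i≤n)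

  shift-+ : ∀ q f g n → shift q (λ i → f i + g i) n ≡ shift q f n + shift q g n
  shift-+ zero    f g n       = refl
  shift-+ (suc q) f g zero    = refl
  shift-+ (suc q) f g (suc n) = shift-+ q f g n

  shift-* : ∀ q k f n → shift q (λ i → k * f i) n ≡ k * shift q f n
  shift-* zero    k f n       = refl
  shift-* (suc q) k f zero    = sym (*-zeroʳ k)
  shift-* (suc q) k f (suc n) = shift-* q k f n

  shift-shift : ∀ p q f n → shift p (shift q f) n ≡ shift (p ℕ.+ q) f n
  shift-shift zero    q f n       = refl
  shift-shift (suc p) q f zero    = refl
  shift-shift (suc p) q f (suc n) = shift-shift p q f n

  shift-comm : ∀ p q f n → shift p (shift q f) n ≡ shift q (shift p f) n
  shift-comm p q f n = trans (shift-shift p q f n) $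
    trans (cong (λ r → shift r f n) (ℕ.+-comm p q)) (sym (shift-shift q p f n))

  shift-offset : ∀ q f n → shift q f (q ℕ.+ n) ≡ f n
  shift-offset zero    f n = refl
  shift-offset (suc q) f n = shift-offset q f n

  shift-conv : ∀ q f g n → conv (shift q f) g n ≡ shift q (conv f g) n
  shift-conv zero    f g n       = refl
  shift-conv (suc q) f g zero    = *-zeroˡ (g 0)
  shift-conv (suc q) f g (suc n) = trans (cong₂ _+_ (*-zeroˡ (g (suc n))) (shift-conv q f g n)) (+-identityˡ _)

  conv-shift : ∀ q f g n → conv f (shift q g) n ≡ shift q (conv f g) n
  conv-shift q f g n = trans (conv-comm f (shift q g) n) $
    trans (shift-conv q g f n) (shift-cong q n λ i _ → conv-comm g f i)

  partialSum : (ℕ → ℚ) → ℕ → ℚ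
  partialSum t zero    = 0ℚ
  partialSum t (suc p) = partialSum t p + t p

  -- Cuts a sum over all subtree sizes at P: the sizes below the cut get the crude bound `t`, the
  -- others are kept and renumbered from 0.
  diag-offset-≤ : ∀ φ t P K → (∀ i j → φ i j ≤ t i) →
    diag φ (P ℕ.+ K) ≤ partialSum t P + diag (λ i j → φ (P ℕ.+ i) j) K
  diag-offset-≤ φ t zero    K h = ≤-reflexive (sym (+-identityˡ _))
  diag-offset-≤ φ t (suc P) K h = begin
    diag φ (suc P ℕ.+ K)
      ≡⟨ cong (diag φ) (ℕ.+-suc P K) ⟨
    diag φ (P ℕ.+ suc K)
      ≤⟨ diag-offset-≤ φ t P (suc K) h ⟩
    partialSum t P + (φ (P ℕ.+ 0) (suc K) + diag (λ i j → φ (P ℕ.+ suc i) j) K)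
      ≡⟨ +-assoc (partialSum t P) _ _ ⟨
    partialSum t P + φ (P ℕ.+ 0) (suc K) + diag (λ i j → φ (P ℕ.+ suc i) j) K
      ≤⟨ +-mono (+-monoʳ-≤ (partialSum t P) (subst (λ Q → φ Q (suc K) ≤ t P) (sym (ℕ.+-identityʳ P)) (h P (suc K))))
           (≤-reflexive (diag-cong K λ i j _ → cong (λ Q → φ Q j) (ℕ.+-suc P i))) ⟩
    partialSum t P + t P + diag (λ i j → φ (suc P ℕ.+ i) j) K ∎
    where open ≤-Reasoning

  diag-offset-≥ : ∀ φ P K → (∀ i j → 0ℚ ≤ φ i j) →
    diag (λ i j → φ (P ℕ.+ i) j) K ≤ diag φ (P ℕ.+ K)
  diag-offset-≥ φ zero    K h = ≤-refl
  diag-offset-≥ φ (suc P) K h = ≤-trans (diag-offset-≥ (λ i j → φ (suc i) j) P K λ i j → h (suc i) j) $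
    subst (_≤ φ 0 (suc P ℕ.+ K) + diag (λ i j → φ (suc i) j) (P ℕ.+ K)) (+-identityˡ _) $
    +-monoˡ-≤ _ (h 0 (suc P ℕ.+ K))

-- Central binomial and Catalan numbers: recurrences and convolution identities.

module CentralBinomials where

  open import Data.Rational hiding (NonZero)
  open import Data.Rational.Properties
  open ℚ-Lemmas
  open LnLemmas using (monotone)
  open DiagonalSums

  fromℕ-suc : ∀ k → fromℕ (suc k) ≡ 1ℚ + fromℕ k
  fromℕ-suc k = fromℕ-+ 1 k

  0<1+fromℕ : ∀ k → 0ℚ < 1ℚ + fromℕ k
  0<1+fromℕ k = <-≤-trans (positive⁻¹ 1ℚ) (≤+ 1ℚ (0≤fromℕ k))

  -- b k = binom(2k,k) / 4^k
  b : ℕ → ℚ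
  b zero    = 1ℚ
  b (suc k) = b k * (fromℕ (suc (k ℕ.+ k)) * unit (suc (k ℕ.+ k)))

  -- Stated without denominators, so that it can serve as one of the known equations in `combine`.
  b-step : ∀ k → (2ℚ + (fromℕ k + fromℕ k)) * b (suc k) ≡ (1ℚ + (fromℕ k + fromℕ k)) * b k
  b-step k = begin
    (2ℚ + (x + x)) * (b k * (fromℕ (suc (k ℕ.+ k)) * unit (suc (k ℕ.+ k))))
      ≡⟨ cong (λ s → (2ℚ + (x + x)) * (b k * (s * unit (suc (k ℕ.+ k))))) odd ⟩
    (2ℚ + (x + x)) * (b k * ((1ℚ + (x + x)) * unit (suc (k ℕ.+ k))))
      ≡⟨ combine ((1ℚ + (x + x)) * b k)
           (trans (cong (_* unit (suc (k ℕ.+ k))) (sym even)) (unit-inverse (suc (k ℕ.+ k))))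
           (solve 3 (λ x b u → (con 2ℚ :+ (x :+ x)) :* (b :* ((con 1ℚ :+ (x :+ x)) :* u)) :- (con 1ℚ :+ (x :+ x)) :* b
                    := ((con 1ℚ :+ (x :+ x)) :* b) :* ((con 1ℚ :+ (con 1ℚ :+ (x :+ x))) :* u :- con 1ℚ))
             refl x (b k) (unit (suc (k ℕ.+ k)))) ⟩
    (1ℚ + (x + x)) * b k ∎
    where
    open ≡-Reasoning
    x = fromℕ k
    odd : fromℕ (suc (k ℕ.+ k)) ≡ 1ℚ + (x + x)
    odd = trans (fromℕ-suc (k ℕ.+ k)) (cong (1ℚ +_) (fromℕ-+ k k))
    even : fromℕ (suc (suc (k ℕ.+ k))) ≡ 1ℚ + (1ℚ + (x + x))
    even = trans (fromℕ-suc (suc (k ℕ.+ k))) (cong (1ℚ +_) odd)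

  0<b : ∀ k → 0ℚ < b k
  0<b zero    = positive⁻¹ 1ℚ
  0<b (suc k) = 0<* {b k} (0<b k) $ 0<* {fromℕ (suc (k ℕ.+ k))}
    (subst (0ℚ <_) (sym (fromℕ-suc (k ℕ.+ k))) (0<1+fromℕ (k ℕ.+ k))) (0<unit (suc (k ℕ.+ k)))

  0≤b : ∀ k → 0ℚ ≤ b k
  0≤b k = <⇒≤ (0<b k)

  -- c k is the k-th Catalan number divided by 4^k
  c : ℕ → ℚ
  c k = b k * unit k

  c-b : ∀ k → (1ℚ + fromℕ k) * c k ≡ b k
  c-b k = combine (b k) (trans (cong (_* unit k) (sym (fromℕ-suc k))) (unit-inverse k))
    (solve 3 (λ x b u → (con 1ℚ :+ x) :* (b :* u) :- b := b :* ((con 1ℚ :+ x) :* u :- con 1ℚ))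
      refl (fromℕ k) (b k) (unit k))

  0<c : ∀ k → 0ℚ < c k
  0<c k = 0<* {b k} (0<b k) (0<unit k)

  0≤c : ∀ k → 0ℚ ≤ c k
  0≤c k = <⇒≤ (0<c k)

  c-step : ∀ k → (4ℚ + (fromℕ k + fromℕ k)) * c (suc k) ≡ (1ℚ + (fromℕ k + fromℕ k)) * c k
  c-step k = *-cancel (0<1+fromℕ k) $
    combine₃ (2ℚ * (1ℚ + x)) (1ℚ + (x + x)) 1ℚ
      (trans (cong (λ y → (1ℚ + y) * c (suc k)) (sym (fromℕ-suc k))) (c-b (suc k)))
      (sym (c-b k)) (b-step k)
      (solve 5 (λ x c c′ b b′ →
          (con 1ℚ :+ x) :* ((con 4ℚ :+ (x :+ x)) :* c′) :- (con 1ℚ :+ x) :* ((con 1ℚ :+ (x :+ x)) :* c)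
          := con 2ℚ :* (con 1ℚ :+ x) :* ((con 1ℚ :+ (con 1ℚ :+ x)) :* c′ :- b′)
          :+ (con 1ℚ :+ (x :+ x)) :* (b :- (con 1ℚ :+ x) :* c)
          :+ con 1ℚ :* ((con 2ℚ :+ (x :+ x)) :* b′ :- (con 1ℚ :+ (x :+ x)) :* b))
        refl x (c k) (c (suc k)) (b k) (b (suc k)))
    where x = fromℕ k

  -- The coefficients of (1 - x)^(-3/2).
  d : ℕ → ℚ
  d k = (1ℚ + (fromℕ k + fromℕ k)) * b k

  d-b : ∀ k → (2ℚ + (fromℕ k + fromℕ k)) * b (suc k) ≡ d k
  d-b = b-step

  d-step : ∀ k → d (suc k) ≡ d k + b (suc k)
  d-step k = combine₂ (2ℚ * b (suc k)) 1ℚ (fromℕ-suc k) (b-step k)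
    (solve 4 (λ x x′ b b′ → (con 1ℚ :+ (x′ :+ x′)) :* b′ :- ((con 1ℚ :+ (x :+ x)) :* b :+ b′)
      := con 2ℚ :* b′ :* (x′ :- (con 1ℚ :+ x))
      :+ con 1ℚ :* ((con 2ℚ :+ (x :+ x)) :* b′ :- (con 1ℚ :+ (x :+ x)) :* b))
      refl (fromℕ k) (fromℕ (suc k)) (b k) (b (suc k)))

  d-mono : ∀ {i j} → i ℕ.≤ j → d i ≤ d j
  d-mono = monotone d λ k → subst (d k ≤_) (sym (d-step k)) (≤+ (d k) (0≤b (suc k)))

  1≤d : ∀ k → 1ℚ ≤ d k
  1≤d k = d-mono {0} {k} z≤n

  ≤-by-ratio : ∀ {p q s t} → 0ℚ < s → 0ℚ ≤ q → t ≤ s → s * p ≡ t * q → p ≤ q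
  ≤-by-ratio {p} {q} {s} {t} 0<s 0≤q t≤s eq = *-cancelˡ-≤-pos s {{positive 0<s}} $
    ≤-trans (≤-reflexive eq) (*-monoʳ 0≤q t≤s)

  antitone : (f : ℕ → ℚ) → (∀ k → f (suc k) ≤ f k) → ∀ {i j} → i ℕ.≤ j → f j ≤ f i
  antitone f step {i} {zero}  z≤n = ≤-refl
  antitone f step {i} {suc j} i≤j with ℕ.m≤n⇒m<n∨m≡n i≤j
  ... | inj₂ refl       = ≤-refl
  ... | inj₁ (s≤s i≤j′) = ≤-trans (step j) (antitone f step i≤j′)

  0≤2x : ∀ k → 0ℚ ≤ fromℕ k + fromℕ k
  0≤2x k = 0≤+ (0≤fromℕ k) (0≤fromℕ k)

  b-antitone : ∀ {i j} → i ℕ.≤ j → b j ≤ b i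
  b-antitone = antitone b λ k → ≤-by-ratio
    (<-≤-trans (positive⁻¹ 2ℚ) (≤+ 2ℚ (0≤2x k))) (0≤b k)
    (+-monoˡ-≤ (fromℕ k + fromℕ k) {1ℚ} {2ℚ} (≤ᵇ⇒≤ _)) (b-step k)

  c-antitone : ∀ {i j} → i ℕ.≤ j → c j ≤ c i
  c-antitone = antitone c λ k → ≤-by-ratio
    (<-≤-trans (positive⁻¹ 4ℚ) (≤+ 4ℚ (0≤2x k))) (0≤c k)
    (+-monoˡ-≤ (fromℕ k + fromℕ k) {1ℚ} {4ℚ} (≤ᵇ⇒≤ _)) (c-step k)

  -- Both sides are Σ (i + j) f i f j, by symmetry.
  conv-weighted : ∀ f n → 2ℚ * conv (λ i → fromℕ i * f i) f n ≡ fromℕ n * conv f f n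
  conv-weighted f n = begin
    2ℚ * e
      ≡⟨ solve 1 (λ e → con 2ℚ :* e := e :+ e) refl e ⟩
    e + e
      ≡⟨ cong (e +_) (diag-flip _ n) ⟩
    e + diag (λ i j → fromℕ j * f j * f i) n
      ≡⟨ diag-+ _ _ n ⟨
    diag (λ i j → fromℕ i * f i * f j + fromℕ j * f j * f i) n
      ≡⟨ diag-cong n (λ i j eq → trans
           (solve 4 (λ x y p q → x :* p :* q :+ y :* q :* p := (x :+ y) :* (p :* q)) refl
             (fromℕ i) (fromℕ j) (f i) (f j))
           (cong (_* (f i * f j)) (trans (sym (fromℕ-+ i j)) (cong fromℕ eq)))) ⟩
    diag (λ i j → fromℕ n * (f i * f j)) n
      ≡⟨ diag-* (fromℕ n) _ n ⟩
    fromℕ n * conv f f n ∎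
    where
    open ≡-Reasoning
    e = conv (λ i → fromℕ i * f i) f n

  -- The square of (1-x)^(-1/2) is 1/(1-x). By symmetry the convolution may be weighted by i, and
  -- the recurrence of `b` then shows that it does not depend on n.
  conv-b-b : ∀ n → conv b b n ≡ 1ℚ
  conv-b-b zero    = refl
  conv-b-b (suc n) = trans (*-cancel (0<1+fromℕ n) recurrence) (conv-b-b n)
    where
    open ≡-Reasoning
    x = fromℕ n
    e = conv (λ i → fromℕ i * b i) b
    term : ∀ i j → 2ℚ * (fromℕ (suc i) * b (suc i) * b j) ≡ 2ℚ * (fromℕ i * b i * b j) + b i * b j
    term i j = combine₂ (2ℚ * b (suc i) * b j) (b j) (fromℕ-suc i) (b-step i)
      (solve 5 (λ x x′ p p′ q → con 2ℚ :* (x′ :* p′ :* q) :- (con 2ℚ :* (x :* p :* q) :+ p :* q)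
        := con 2ℚ :* p′ :* q :* (x′ :- (con 1ℚ :+ x))
        :+ q :* ((con 2ℚ :+ (x :+ x)) :* p′ :- (con 1ℚ :+ (x :+ x)) :* p))
        refl (fromℕ i) (fromℕ (suc i)) (b i) (b (suc i)) (b j))
    tail : ℚ
    tail = diag (λ i j → fromℕ (suc i) * b (suc i) * b j) n
    recurrence : (1ℚ + x) * conv b b (suc n) ≡ (1ℚ + x) * conv b b n
    recurrence = begin
      (1ℚ + x) * conv b b (suc n)
        ≡⟨ cong (_* conv b b (suc n)) (fromℕ-suc n) ⟨
      fromℕ (suc n) * conv b b (suc n)
        ≡⟨ conv-weighted b (suc n) ⟨
      2ℚ * (fromℕ 0 * b 0 * b (suc n) + tail)
        -- The weight i removes the term i = 0, so all remaining terms have an index to which the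
        -- recurrence applies.
        ≡⟨ solve 2 (λ p t → con 2ℚ :* (con 0ℚ :* con 1ℚ :* p :+ t) := con 2ℚ :* t) refl (b (suc n)) tail ⟩
      2ℚ * tail
        ≡⟨ diag-* 2ℚ _ n ⟨
      diag (λ i j → 2ℚ * (fromℕ (suc i) * b (suc i) * b j)) n
        ≡⟨ diag-cong n (λ i j _ → term i j) ⟩
      diag (λ i j → 2ℚ * (fromℕ i * b i * b j) + b i * b j) n
        ≡⟨ diag-+ _ _ n ⟩
      diag (λ i j → 2ℚ * (fromℕ i * b i * b j)) n + conv b b n
        ≡⟨ cong (_+ conv b b n) (diag-* 2ℚ _ n) ⟩
      2ℚ * e n + conv b b n
        ≡⟨ cong (_+ conv b b n) (conv-weighted b n) ⟩
      x * conv b b n + conv b b n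
        ≡⟨ solve 2 (λ x v → x :* v :+ v := (con 1ℚ :+ x) :* v) refl x (conv b b n) ⟩
      (1ℚ + x) * conv b b n ∎

  -- A closed form for the tails of Σ c i b j, found by Gosper's algorithm.
  tail-c-b : ∀ K P → (1ℚ + fromℕ P + fromℕ K) * diag (λ i j → c (P ℕ.+ i) * b j) K ≡ b P * d K
  tail-c-b zero P = trans (cong (λ Q → (1ℚ + fromℕ P + 0ℚ) * (c Q * 1ℚ)) (ℕ.+-identityʳ P)) $
    combine 1ℚ (c-b P) (solve 3 (λ x c b →
      (con 1ℚ :+ x :+ con 0ℚ) :* (c :* con 1ℚ) :- b :* ((con 1ℚ :+ (con 0ℚ :+ con 0ℚ)) :* con 1ℚ)
      := con 1ℚ :* ((con 1ℚ :+ x) :* c :- b)) refl (fromℕ P) (c P) (b P))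
  tail-c-b (suc K) P = *-cancel (0<1+fromℕ P) $ begin
    (1ℚ + x) * ((1ℚ + x + fromℕ (suc K)) * (c (P ℕ.+ 0) * e′ + diag (λ i j → c (P ℕ.+ suc i) * b j) K))
      ≡⟨ cong₂ (λ y s → (1ℚ + x) * ((1ℚ + x + y) * s)) (fromℕ-suc K)
           (cong₂ (λ Q t → c Q * e′ + t) (ℕ.+-identityʳ P)
             (diag-cong K λ i j _ → cong (λ Q → c Q * b j) (ℕ.+-suc P i))) ⟩
    (1ℚ + x) * ((1ℚ + x + (1ℚ + y)) * (γ * e′ + D))
      ≡⟨ combine₄ (1ℚ + x) ((2ℚ + (x + y)) * e′) ((1ℚ + y) * e′) (- ((1ℚ + x) * β′))
           IH (c-b P) (b-step P) (b-step K)
           (solve 8 (λ x y γ D β β′ e e′ →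
             (con 1ℚ :+ x) :* ((con 1ℚ :+ x :+ (con 1ℚ :+ y)) :* (γ :* e′ :+ D))
               :- (con 1ℚ :+ x) :* (β :* ((con 1ℚ :+ ((con 1ℚ :+ y) :+ (con 1ℚ :+ y))) :* e′))
             := (con 1ℚ :+ x) :* ((con 1ℚ :+ (con 1ℚ :+ x) :+ y) :* D :- β′ :* ((con 1ℚ :+ (y :+ y)) :* e))
             :+ (con 2ℚ :+ (x :+ y)) :* e′ :* ((con 1ℚ :+ x) :* γ :- β)
             :+ (con 1ℚ :+ y) :* e′ :* ((con 2ℚ :+ (x :+ x)) :* β′ :- (con 1ℚ :+ (x :+ x)) :* β)
             :+ :- ((con 1ℚ :+ x) :* β′) :* ((con 2ℚ :+ (y :+ y)) :* e′ :- (con 1ℚ :+ (y :+ y)) :* e))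
             refl x y γ D β β′ e e′) ⟩
    (1ℚ + x) * (β * ((1ℚ + ((1ℚ + y) + (1ℚ + y))) * e′))
      ≡⟨ cong (λ y → (1ℚ + x) * (β * ((1ℚ + (y + y)) * e′))) (fromℕ-suc K) ⟨
    (1ℚ + x) * (b P * d (suc K)) ∎
    where
    open ≡-Reasoning
    x = fromℕ P
    y = fromℕ K
    γ = c P
    β = b P
    β′ = b (suc P)
    e = b K
    e′ = b (suc K)
    D = diag (λ i j → c (suc P ℕ.+ i) * b j) K
    -- Without its first term the sum is the same tail started at `suc P`, so the induction on K
    -- must leave P free.
    IH : (1ℚ + (1ℚ + x) + y) * D ≡ β′ * ((1ℚ + (y + y)) * e)
    IH = trans (cong (λ x → (1ℚ + x + y) * D) (sym (fromℕ-suc P))) (tail-c-b K (suc P))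

  -- The full sum is the tail with P = 0.
  conv-c-b : ∀ K → conv c b K ≡ 2ℚ * b (suc K)
  conv-c-b K = *-cancel (0<1+fromℕ K) $
    combine₂ 1ℚ (- 1ℚ) (tail-c-b K 0) (b-step K)
    (solve 4 (λ y v e e′ → (con 1ℚ :+ y) :* v :- (con 1ℚ :+ y) :* (con 2ℚ :* e′)
      := con 1ℚ :* ((con 1ℚ :+ con 0ℚ :+ y) :* v :- con 1ℚ :* ((con 1ℚ :+ (y :+ y)) :* e))
      :+ :- con 1ℚ :* ((con 2ℚ :+ (y :+ y)) :* e′ :- (con 1ℚ :+ (y :+ y)) :* e))
      refl (fromℕ K) (conv c b K) (b K) (b (suc K)))

  -- The Catalan recursion, divided by 4^n. The factor i + 1 turns `c i` into `b i`, which reduces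
  -- it to `conv-c-b`; the weight i alone is evaluated by symmetry.
  conv-c-c : ∀ n → conv c c n ≡ 4ℚ * c (suc n)
  conv-c-c n = *-cancel (<-≤-trans (positive⁻¹ 2ℚ) (≤+ 2ℚ (0≤fromℕ n))) $
    combine₄ 1ℚ 2ℚ 2ℚ (- 4ℚ) weighted sum-b (conv-c-b n)
      (trans (cong (λ y → (1ℚ + y) * c (suc n)) (sym (fromℕ-suc n))) (c-b (suc n)))
    (solve 6 (λ x v e w c′ b′ → (con 2ℚ :+ x) :* v :- (con 2ℚ :+ x) :* (con 4ℚ :* c′)
      := con 1ℚ :* (x :* v :- con 2ℚ :* e)
      :+ con 2ℚ :* (e :+ v :- w)
      :+ con 2ℚ :* (w :- con 2ℚ :* b′)
      :+ :- con 4ℚ :* ((con 1ℚ :+ (con 1ℚ :+ x)) :* c′ :- b′))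
      refl (fromℕ n) (conv c c n) e (conv c b n) (c (suc n)) (b (suc n)))
    where
    e = conv (λ i → fromℕ i * c i) c n
    weighted : fromℕ n * conv c c n ≡ 2ℚ * e
    weighted = sym (conv-weighted c n)
    sum-b : e + conv c c n ≡ conv c b n
    sum-b = trans (sym (diag-+ _ _ n)) $ trans
      (diag-cong n λ i j _ → combine (c j) (c-b i)
        (solve 4 (λ x p b q → x :* p :* q :+ p :* q :- b :* q := q :* ((con 1ℚ :+ x) :* p :- b))
          refl (fromℕ i) (c i) (b i) (c j)))
      (conv-comm b c n)

  -- On generating functions, 2(1-(1-x)^(1/2))/x times (1-x)^(-3/2) is 2((1-x)^(-3/2) - 1/(1-x))/x.
  -- Since `d` is the sequence of partial sums of `b`, it follows by summing `conv-c-b`.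
  conv-c-d : ∀ k → conv c d k ≡ 2ℚ * (d (suc k) - 1ℚ)
  conv-c-d zero    = refl
  conv-c-d (suc k) = begin
    conv c d (suc k)
      ≡⟨ diag-last (λ i j → c i * d j) k ⟩
    diag (λ i j → c i * d (suc j)) k + c (suc k) * d 0
      ≡⟨ cong (_+ c (suc k) * d 0) (trans
           (diag-cong k λ i j _ → trans (cong (c i *_) (d-step j)) (*-distribˡ-+ (c i) (d j) (b (suc j))))
           (diag-+ _ _ k)) ⟩
    conv c d k + diag (λ i j → c i * b (suc j)) k + c (suc k) * 1ℚ
      ≡⟨ +-assoc (conv c d k) _ _ ⟩
    conv c d k + (diag (λ i j → c i * b (suc j)) k + c (suc k) * b 0)
      ≡⟨ cong₂ _+_ (conv-c-d k) (trans (sym (diag-last (λ i j → c i * b j) k)) (conv-c-b (suc k))) ⟩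
    2ℚ * (d (suc k) - 1ℚ) + 2ℚ * b (suc (suc k))
      ≡⟨ combine (- 2ℚ) (d-step (suc k)) (solve 3 (λ d d′ b →
           con 2ℚ :* (d :- con 1ℚ) :+ con 2ℚ :* b :- con 2ℚ :* (d′ :- con 1ℚ) := :- con 2ℚ :* (d′ :- (d :+ b)))
           refl (d (suc k)) (d (suc (suc k))) (b (suc (suc k)))) ⟩
    2ℚ * (d (suc (suc k)) - 1ℚ) ∎
    where open ≡-Reasoning

  conv-c-b₊ : ∀ k → conv c (b ∘ suc) k + c (suc k) ≡ 2ℚ * b (suc (suc k))
  conv-c-b₊ k = trans (cong (conv c (b ∘ suc) k +_) (sym (*-identityʳ (c (suc k))))) $
    trans (sym (diag-last (λ i j → c i * b j) k)) (conv-c-b (suc k))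

  conv-b₊-b₊ : ∀ k → conv (b ∘ suc) (b ∘ suc) k + 2ℚ * b (suc (suc k)) ≡ 1ℚ
  conv-b₊-b₊ k = combine₂ 1ℚ (- 1ℚ) (conv-b-b (suc (suc k)))
    (diag-last (λ i j → b (suc i) * b j) k)
    (solve 3 (λ v p t → v :+ con 2ℚ :* p :- con 1ℚ
      := con 1ℚ :* ((con 1ℚ :* p :+ t) :- con 1ℚ) :+ :- con 1ℚ :* (t :- (v :+ p :* con 1ℚ)))
      refl (conv (b ∘ suc) (b ∘ suc) k) (b (suc (suc k))) (diag (λ i j → b (suc i) * b j) (suc k)))

-- Sums over all labelled forests and trees of a given size.

module ForestSums where

  open import Data.Rational hiding (NonZero)
  open import Data.Rational.Properties
  open ℚ-Lemmas
  open DiagonalSums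
  open CentralBinomials

  ∑ : ∀ {A : Set} → List A → (A → ℚ) → ℚ
  ∑ []       φ = 0ℚ
  ∑ (x ∷ xs) φ = φ x + ∑ xs φ

  module _ {A : Set} where

    ∑-cong : ∀ {φ ψ : A → ℚ} xs → (∀ x → x ∈ xs → φ x ≡ ψ x) → ∑ xs φ ≡ ∑ xs ψ
    ∑-cong []       h = refl
    ∑-cong (x ∷ xs) h = cong₂ _+_ (h x (here refl)) (∑-cong xs λ y y∈ → h y (there y∈))

    ∑-mono : ∀ {φ ψ : A → ℚ} xs → (∀ x → x ∈ xs → φ x ≤ ψ x) → ∑ xs φ ≤ ∑ xs ψ
    ∑-mono []       h = ≤-refl
    ∑-mono (x ∷ xs) h = +-mono (h x (here refl)) (∑-mono xs λ y y∈ → h y (there y∈))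

    ∑-+ : ∀ (φ ψ : A → ℚ) xs → ∑ xs (λ x → φ x + ψ x) ≡ ∑ xs φ + ∑ xs ψ
    ∑-+ φ ψ []       = refl
    ∑-+ φ ψ (x ∷ xs) = trans (cong (φ x + ψ x +_) (∑-+ φ ψ xs)) $
      solve 4 (λ a b c d → a :+ b :+ (c :+ d) := a :+ c :+ (b :+ d)) refl (φ x) (ψ x) (∑ xs φ) (∑ xs ψ)

    ∑-* : ∀ k (φ : A → ℚ) xs → ∑ xs (λ x → k * φ x) ≡ k * ∑ xs φ
    ∑-* k φ []       = sym (*-zeroʳ k)
    ∑-* k φ (x ∷ xs) = trans (cong (k * φ x +_) (∑-* k φ xs)) (sym (*-distribˡ-+ k (φ x) (∑ xs φ)))

    ∑-0 : ∀ xs → ∑ xs (λ (_ : A) → 0ℚ) ≡ 0ℚ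
    ∑-0 []       = refl
    ∑-0 (x ∷ xs) = trans (+-identityˡ _) (∑-0 xs)

    ∑-1 : ∀ xs → ∑ xs (λ (_ : A) → 1ℚ) ≡ fromℕ (length xs)
    ∑-1 []       = refl
    ∑-1 (x ∷ xs) = trans (cong (1ℚ +_) (∑-1 xs)) (sym (fromℕ-suc (length xs)))

    ∑-const : ∀ k xs → ∑ xs (λ (_ : A) → k) ≡ fromℕ (length xs) * k
    ∑-const k xs = begin
      ∑ xs (λ _ → k)        ≡⟨ ∑-cong xs (λ _ _ → sym (*-identityʳ k)) ⟩
      ∑ xs (λ _ → k * 1ℚ)   ≡⟨ ∑-* k (λ _ → 1ℚ) xs ⟩
      k * ∑ xs (λ _ → 1ℚ)   ≡⟨ cong (k *_) (∑-1 xs) ⟩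
      k * fromℕ (length xs) ≡⟨ *-comm k _ ⟩
      fromℕ (length xs) * k ∎
      where open ≡-Reasoning

    ∑-nonNegative : ∀ {φ : A → ℚ} xs → (∀ x → 0ℚ ≤ φ x) → 0ℚ ≤ ∑ xs φ
    ∑-nonNegative []       h = ≤-refl
    ∑-nonNegative (x ∷ xs) h = 0≤+ (h x) (∑-nonNegative xs h)

    ∑-++ : ∀ (φ : A → ℚ) xs ys → ∑ (xs ++ ys) φ ≡ ∑ xs φ + ∑ ys φ
    ∑-++ φ []       ys = sym (+-identityˡ _)
    ∑-++ φ (x ∷ xs) ys = trans (cong (φ x +_) (∑-++ φ xs ys)) (sym (+-assoc (φ x) _ _))

    ∑-diag : ∀ (φ : A → ℕ → ℕ → ℚ) xs n → ∑ xs (λ x → diag (φ x) n) ≡ diag (λ i j → ∑ xs λ x → φ x i j) n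
    ∑-diag φ xs zero    = refl
    ∑-diag φ xs (suc n) = trans (∑-+ (λ x → φ x 0 (suc n)) (λ x → diag (λ i j → φ x (suc i) j) n) xs) $
      cong (∑ xs (λ x → φ x 0 (suc n)) +_) (∑-diag (λ x i j → φ x (suc i) j) xs n)

  ∑-comm : ∀ {A B : Set} (φ : A → B → ℚ) xs ys →
    ∑ xs (λ x → ∑ ys (φ x)) ≡ ∑ ys (λ y → ∑ xs (λ x → φ x y))
  ∑-comm φ []       ys = sym (∑-0 ys)
  ∑-comm φ (x ∷ xs) ys = trans (cong (∑ ys (φ x) +_) (∑-comm φ xs ys)) (sym (∑-+ (φ x) _ ys))

  ⟦_⟧ : ∀ {P : Set} → Dec P → ℚ
  ⟦ P? ⟧ = if does P? then 1ℚ else 0ℚ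

  ⟦⟧-true : ∀ {P : Set} (P? : Dec P) → P → ⟦ P? ⟧ ≡ 1ℚ
  ⟦⟧-true (yes _) p = refl
  ⟦⟧-true (no ¬p) p = ⊥-elim (¬p p)

  ⟦⟧-false : ∀ {P : Set} (P? : Dec P) → ¬ P → ⟦ P? ⟧ ≡ 0ℚ
  ⟦⟧-false (yes p) ¬p = ⊥-elim (¬p p)
  ⟦⟧-false (no _)  ¬p = refl

  0≤⟦⟧ : ∀ {P : Set} (P? : Dec P) → 0ℚ ≤ ⟦ P? ⟧
  0≤⟦⟧ (yes _) = <⇒≤ (positive⁻¹ 1ℚ)
  0≤⟦⟧ (no _)  = ≤-refl

  ⟦⟧-idem : ∀ {P : Set} (P? : Dec P) → ⟦ P? ⟧ * ⟦ P? ⟧ ≡ ⟦ P? ⟧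
  ⟦⟧-idem (yes _) = refl
  ⟦⟧-idem (no _)  = refl

  ⟦⟧-subst : ∀ {A : Set} {x y : A} (eq? : Dec (x ≡ y)) (φ : A → ℚ) → ⟦ eq? ⟧ * φ y ≡ ⟦ eq? ⟧ * φ x
  ⟦⟧-subst (yes refl) φ = refl
  ⟦⟧-subst {x = x} {y} (no _) φ = trans (*-zeroˡ (φ y)) (sym (*-zeroˡ (φ x)))

  module _ {A : Set} (_≟_ : DecidableEquality A) where

    ∑-∉ : ∀ {x} xs → x ∉ xs → ∑ xs (λ y → ⟦ x ≟ y ⟧) ≡ 0ℚ
    ∑-∉ {x} xs x∉ = trans (∑-cong xs λ y y∈ → ⟦⟧-false (x ≟ y) λ { refl → x∉ y∈ }) (∑-0 xs)

    ∑-unique : ∀ {x xs} → Unique xs → x ∈ xs → ∑ xs (λ y → ⟦ x ≟ y ⟧) ≡ 1ℚ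
    ∑-unique {x} {y ∷ ys} (y∉ ∷ _) (here refl) =
      cong₂ _+_ (⟦⟧-true (x ≟ x) refl) (∑-∉ ys λ x∈ → All.lookup y∉ x∈ refl)
    ∑-unique {x} {y ∷ ys} (y∉ ∷ u) (there x∈) =
      cong₂ _+_ (⟦⟧-false (x ≟ y) λ { refl → All.lookup y∉ x∈ refl }) (∑-unique u x∈)

  diag-⟦⟧ : ∀ p g n → diag (λ i j → ⟦ p ℕ.≟ i ⟧ * g j) n ≡ shift p g n
  diag-⟦⟧ zero    g zero    = *-identityˡ (g 0)
  diag-⟦⟧ zero    g (suc n) = trans (cong₂ _+_ (*-identityˡ (g (suc n)))
    (trans (diag-cong n λ i j _ → *-zeroˡ (g j)) (diag-0 n))) (+-identityʳ _)
  diag-⟦⟧ (suc p) g zero    = *-zeroˡ (g 0)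
  diag-⟦⟧ (suc p) g (suc n) = trans (cong₂ _+_ (*-zeroˡ (g (suc n))) (diag-⟦⟧ p g n)) (+-identityˡ _)

  shift-⟦⟧ : ∀ p q n → shift p (λ j → ⟦ q ℕ.≟ j ⟧) n ≡ ⟦ p ℕ.+ q ℕ.≟ n ⟧
  shift-⟦⟧ zero    q n       = refl
  shift-⟦⟧ (suc p) q zero    = refl
  shift-⟦⟧ (suc p) q (suc n) = shift-⟦⟧ p q n

  occurrences : ∀ {m} → Tree m → Tree m → ℚ
  occurrences u t = ∑ (subtrees t) λ v → ⟦ u ≟ᵀ v ⟧

  occurrencesᶠ : ∀ {m} → Tree m → Forest m → ℚ
  occurrencesᶠ u ts = ∑ (forestSubtrees ts) λ v → ⟦ u ≟ᵀ v ⟧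

  module _ {m : ℕ} where

    ⟦⟧-node : ∀ a b (ts us : Forest m) → ⟦ node a ts ≟ᵀ node b us ⟧ ≡ ⟦ a Fin.≟ b ⟧ * ⟦ ts ≟ᶠ us ⟧
    ⟦⟧-node a b ts us with a Fin.≟ b | ts ≟ᶠ us
    ... | yes refl | yes refl = refl
    ... | no a≢b   | yes _    = refl
    ... | no a≢b   | no _     = refl
    ... | yes refl | no ts≢us = refl

    ⟦⟧-∷ : ∀ (t u : Tree m) ts us → ⟦ (t ∷ ts) ≟ᶠ (u ∷ us) ⟧ ≡ ⟦ t ≟ᵀ u ⟧ * ⟦ ts ≟ᶠ us ⟧
    ⟦⟧-∷ t u ts us with t ≟ᵀ u | ts ≟ᶠ us
    ... | yes refl | yes refl = refl
    ... | no _     | yes _    = refl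
    ... | no _     | no _     = refl
    ... | yes refl | no _     = refl

    -- The sum over all forests of size n, provided that n ≤ k.
    ∑ᶠ : ℕ → ℕ → (Forest m → ℚ) → ℚ
    ∑ᶠ k       zero    φ = φ []
    ∑ᶠ zero    (suc n) φ = 0ℚ
    ∑ᶠ (suc k) (suc n) φ = diag (λ i j →
      ∑ (allFin m) λ a → ∑ᶠ k i λ us → ∑ᶠ k j λ ts → φ (node a us ∷ ts)) n

    ∑ᶠ-cong : ∀ k n {φ ψ} → (∀ ts → forestSize ts ≡ n → φ ts ≡ ψ ts) → ∑ᶠ k n φ ≡ ∑ᶠ k n ψ
    ∑ᶠ-cong k       zero    h = h [] refl
    ∑ᶠ-cong zero    (suc n) h = refl
    ∑ᶠ-cong (suc k) (suc n) h = diag-cong n λ i j eq → ∑-cong (allFin m) λ a _ →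
      ∑ᶠ-cong k i λ us us≡ → ∑ᶠ-cong k j λ ts ts≡ →
        h (node a us ∷ ts) (cong suc (trans (cong₂ ℕ._+_ us≡ ts≡) eq))

    ∑ᶠ-+ : ∀ k n φ ψ → ∑ᶠ k n (λ ts → φ ts + ψ ts) ≡ ∑ᶠ k n φ + ∑ᶠ k n ψ
    ∑ᶠ-+ k       zero    φ ψ = refl
    ∑ᶠ-+ zero    (suc n) φ ψ = refl
    ∑ᶠ-+ (suc k) (suc n) φ ψ = trans
      (diag-cong n λ i j _ → trans
        (∑-cong (allFin m) λ a _ → trans
          (∑ᶠ-cong k i λ us _ → ∑ᶠ-+ k j (λ ts → φ (node a us ∷ ts)) (λ ts → ψ (node a us ∷ ts)))
          (∑ᶠ-+ k i _ _))
        (∑-+ _ _ (allFin m)))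
      (diag-+ _ _ n)

    ∑ᶠ-* : ∀ k n x φ → ∑ᶠ k n (λ ts → x * φ ts) ≡ x * ∑ᶠ k n φ
    ∑ᶠ-* k       zero    x φ = refl
    ∑ᶠ-* zero    (suc n) x φ = sym (*-zeroʳ x)
    ∑ᶠ-* (suc k) (suc n) x φ = trans
      (diag-cong n λ i j _ → trans
        (∑-cong (allFin m) λ a _ → trans
          (∑ᶠ-cong k i λ us _ → ∑ᶠ-* k j x (λ ts → φ (node a us ∷ ts)))
          (∑ᶠ-* k i x _))
        (∑-* x _ (allFin m)))
      (diag-* x _ n)

    ∑ᶠ-0 : ∀ k n → ∑ᶠ k n (λ _ → 0ℚ) ≡ 0ℚ
    ∑ᶠ-0 k n = trans (∑ᶠ-cong k n {ψ = λ _ → 0ℚ * 1ℚ} λ _ _ → refl) $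
      trans (∑ᶠ-* k n 0ℚ (λ _ → 1ℚ)) (*-zeroˡ (∑ᶠ k n λ _ → 1ℚ))

    ∑ᶠ-*ʳ : ∀ k n x φ → ∑ᶠ k n (λ ts → φ ts * x) ≡ ∑ᶠ k n φ * x
    ∑ᶠ-*ʳ k n x φ = trans (∑ᶠ-cong k n λ ts _ → *-comm (φ ts) x) $
      trans (∑ᶠ-* k n x φ) (*-comm x _)

    ∑ᵗ : ℕ → ℕ → (Tree m → ℚ) → ℚ
    ∑ᵗ k n φ = ∑ (allFin m) λ a → ∑ᶠ k n λ us → φ (node a us)

    ∑ᵗ-cong : ∀ k n {φ ψ} → (∀ t → size t ≡ n → φ t ≡ ψ t) → ∑ᵗ k n φ ≡ ∑ᵗ k n ψ
    ∑ᵗ-cong k n h = ∑-cong (allFin m) λ a _ → ∑ᶠ-cong k n λ us eq → h (node a us) eq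

    ∑ᵗ-+ : ∀ k n φ ψ → ∑ᵗ k n (λ t → φ t + ψ t) ≡ ∑ᵗ k n φ + ∑ᵗ k n ψ
    ∑ᵗ-+ k n φ ψ = trans (∑-cong (allFin m) λ a _ → ∑ᶠ-+ k n _ _) (∑-+ _ _ (allFin m))

    ∑ᵗ-*ʳ : ∀ k n x φ → ∑ᵗ k n (λ t → φ t * x) ≡ ∑ᵗ k n φ * x
    ∑ᵗ-*ʳ k n x φ = trans (∑-cong (allFin m) λ a _ → trans (∑ᶠ-*ʳ k n x _) (*-comm _ x)) $
      trans (∑-* x _ (allFin m)) (*-comm x _)

    μ : ℚ
    μ = fromℕ m

    ∑-labels : ∀ x → ∑ (allFin m) (λ _ → x) ≡ μ * x
    ∑-labels x = trans (∑-const x (allFin m)) $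
      cong (λ l → fromℕ l * x) (length-tabulate {n = m} (λ a → a))

    -- Splitting at the first root: a weight that factors into one for the first tree and one for
    -- the rest becomes a convolution. The edge above that root accounts for the drop from `suc n`
    -- to `n`.
    ∑ᶠ-∷ : ∀ k n (χ : Forest m → ℚ) φ ψ → (∀ t ts → χ (t ∷ ts) ≡ φ t * ψ ts) →
      ∑ᶠ (suc k) (suc n) χ ≡ diag (λ i j → ∑ᵗ k i φ * ∑ᶠ k j ψ) n
    ∑ᶠ-∷ k n χ φ ψ h = diag-cong n λ i j _ → trans
      (∑-cong (allFin m) λ a _ → ∑ᶠ-cong k i λ us _ →
        trans (∑ᶠ-cong k j λ ts _ → h (node a us) ts) (∑ᶠ-* k j (φ (node a us)) ψ))
      (∑ᵗ-*ʳ k i (∑ᶠ k j ψ) φ)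

    -- Only used on nonempty forests; the value at [] is arbitrary.
    _⊗_ : (Tree m → ℚ) → (Forest m → ℚ) → Forest m → ℚ
    (φ ⊗ ψ) []       = 0ℚ
    (φ ⊗ ψ) (t ∷ ts) = φ t * ψ ts

    ∑ᶠ-⊗ : ∀ k n φ ψ → ∑ᶠ (suc k) (suc n) (φ ⊗ ψ) ≡ diag (λ i j → ∑ᵗ k i φ * ∑ᶠ k j ψ) n
    ∑ᶠ-⊗ k n φ ψ = ∑ᶠ-∷ k n (φ ⊗ ψ) φ ψ λ _ _ → refl

    -- Certifies that the recursive sum visits each forest of size n exactly once, as long as the
    -- recursion depth k suffices.
    ∑ᶠ-⟦⟧ : ∀ k n (ts : Forest m) → n ℕ.≤ k → ∑ᶠ k n (λ us → ⟦ ts ≟ᶠ us ⟧) ≡ ⟦ forestSize ts ℕ.≟ n ⟧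
    ∑ᵗ-⟦⟧ : ∀ k n (t : Tree m) → n ℕ.≤ k → ∑ᵗ k n (λ u → ⟦ t ≟ᵀ u ⟧) ≡ ⟦ size t ℕ.≟ n ⟧

    ∑ᶠ-⟦⟧ k       zero    []       _ = refl
    ∑ᶠ-⟦⟧ k       zero    (t ∷ ts) _ = refl
    ∑ᶠ-⟦⟧ (suc k) (suc n) []       _ = ∑ᶠ-0 (suc k) (suc n)
    ∑ᶠ-⟦⟧ (suc k) (suc n) (t ∷ ts) (s≤s n≤k) = begin
      ∑ᶠ (suc k) (suc n) (λ us → ⟦ (t ∷ ts) ≟ᶠ us ⟧)
        ≡⟨ ∑ᶠ-∷ k n (λ us → ⟦ (t ∷ ts) ≟ᶠ us ⟧) (λ u → ⟦ t ≟ᵀ u ⟧) (λ us → ⟦ ts ≟ᶠ us ⟧) (λ u us → ⟦⟧-∷ t u ts us) ⟩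
      diag (λ i j → ∑ᵗ k i (λ u → ⟦ t ≟ᵀ u ⟧) * ∑ᶠ k j (λ us → ⟦ ts ≟ᶠ us ⟧)) n
        ≡⟨ diag-cong n (λ i j eq → cong₂ _*_
             (∑ᵗ-⟦⟧ k i t (ℕ.≤-trans (ℕ.m+n≤o⇒m≤o i (ℕ.≤-reflexive eq)) n≤k))
             (∑ᶠ-⟦⟧ k j ts (ℕ.≤-trans (ℕ.m+n≤o⇒n≤o i (ℕ.≤-reflexive eq)) n≤k))) ⟩
      diag (λ i j → ⟦ size t ℕ.≟ i ⟧ * ⟦ forestSize ts ℕ.≟ j ⟧) n
        ≡⟨ diag-⟦⟧ (size t) _ n ⟩
      shift (size t) (λ j → ⟦ forestSize ts ℕ.≟ j ⟧) n
        ≡⟨ shift-⟦⟧ (size t) (forestSize ts) n ⟩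
      ⟦ size t ℕ.+ forestSize ts ℕ.≟ n ⟧ ∎
      where open ≡-Reasoning

    ∑ᵗ-⟦⟧ k n (node a ts) n≤k = begin
      ∑ (allFin m) (λ b → ∑ᶠ k n λ us → ⟦ node a ts ≟ᵀ node b us ⟧)
        ≡⟨ ∑-cong (allFin m) (λ b _ → trans (∑ᶠ-cong k n λ us _ → ⟦⟧-node a b ts us) (∑ᶠ-* k n ⟦ a Fin.≟ b ⟧ _)) ⟩
      ∑ (allFin m) (λ b → ⟦ a Fin.≟ b ⟧ * ∑ᶠ k n (λ us → ⟦ ts ≟ᶠ us ⟧))
        ≡⟨ ∑-cong (allFin m) (λ b _ → trans (cong (⟦ a Fin.≟ b ⟧ *_) (∑ᶠ-⟦⟧ k n ts n≤k)) (*-comm ⟦ a Fin.≟ b ⟧ _)) ⟩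
      ∑ (allFin m) (λ b → ⟦ forestSize ts ℕ.≟ n ⟧ * ⟦ a Fin.≟ b ⟧)
        ≡⟨ ∑-* ⟦ forestSize ts ℕ.≟ n ⟧ _ (allFin m) ⟩
      ⟦ forestSize ts ℕ.≟ n ⟧ * ∑ (allFin m) (λ b → ⟦ a Fin.≟ b ⟧)
        ≡⟨ cong (⟦ forestSize ts ℕ.≟ n ⟧ *_) (∑-unique Fin._≟_ (allFin⁺ m) (∈-allFin a)) ⟩
      ⟦ forestSize ts ℕ.≟ n ⟧ * 1ℚ
        ≡⟨ *-identityʳ _ ⟩
      ⟦ forestSize ts ℕ.≟ n ⟧ ∎
      where open ≡-Reasoning

-- Exact counts of forests, of occurrences of a subtree, and of pairs of occurrences.

module Counting where

  open import Data.Rational hiding (NonZero)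
  open import Data.Rational.Properties
  open ℚ-Lemmas
  open DiagonalSums
  open CentralBinomials
  open ForestSums

  pow : ℚ → ℕ → ℚ
  pow x zero    = 1ℚ
  pow x (suc n) = x * pow x n

  pow-+ : ∀ x i j → pow x (i ℕ.+ j) ≡ pow x i * pow x j
  pow-+ x zero    j = sym (*-identityˡ _)
  pow-+ x (suc i) j = trans (cong (x *_) (pow-+ x i j)) (sym (*-assoc x _ _))

  conv-pow : ∀ x α β n → conv (λ i → pow x i * α i) (λ j → pow x j * β j) n ≡ pow x n * conv α β n
  conv-pow x α β n = trans
    (diag-cong n λ i j eq → trans
      (solve 4 (λ p a q b → p :* a :* (q :* b) := p :* q :* (a :* b)) refl (pow x i) (α i) (pow x j) (β j))
      (cong (_* (α i * β j)) (trans (sym (pow-+ x i j)) (cong (pow x) eq))))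
    (diag-* (pow x n) _ n)

  conv-*ʳ : ∀ k f g n → conv f (λ j → k * g j) n ≡ k * conv f g n
  conv-*ʳ k f g n = trans
    (diag-cong n λ i j _ → solve 3 (λ f k g → f :* (k :* g) := k :* (f :* g)) refl (f i) k (g j))
    (diag-* k _ n)

  conv-*ˡ : ∀ k f g n → conv (λ i → k * f i) g n ≡ k * conv f g n
  conv-*ˡ k f g n = trans (diag-cong n λ i j _ → *-assoc k (f i) (g j)) (diag-* k _ n)

  module _ {m : ℕ} where

    private
      x = fromℕ m
      M = 4ℚ * x

    forestCount : ℕ → ℚ
    forestCount n = pow M n * c n

    -- A forest of size n has 2n+1 slots into which a further edge with a tree below it can be
    -- inserted, and (2n+1) c n = 2 b (n+1). This is the number of forests with a chosen slot.
    markedCount : ℕ → ℚ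
    markedCount n = pow M n * (2ℚ * b (suc n))

    -- Forests with an unordered choice of two slots, possibly equal: (2n+1)(n+1) c n = d n.
    pairCount : ℕ → ℚ
    pairCount n = pow M n * d n

    forestCount-step : ∀ n → forestCount (suc n) ≡ x * conv forestCount forestCount n
    forestCount-step n = sym $ begin
      x * conv forestCount forestCount n   ≡⟨ cong (x *_) (trans (conv-pow M c c n) (cong (pow M n *_) (conv-c-c n))) ⟩
      x * (pow M n * (4ℚ * c (suc n)))     ≡⟨ solve 3 (λ x p c → x :* (p :* (con 4ℚ :* c)) := con 4ℚ :* x :* p :* c)
                                                refl x (pow M n) (c (suc n)) ⟩
      M * pow M n * c (suc n)              ∎
      where open ≡-Reasoning

    -- The inserted tree is the first one, or it lies below the first root, or it lies in the
    -- remaining forest; the last two cases are mirror images.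
    markedCount-step : ∀ n → markedCount n ≡
      forestCount n + (x * shift 1 (conv forestCount markedCount) n + x * shift 1 (conv forestCount markedCount) n)
    markedCount-step zero    = solve 1 (λ x → con 1ℚ := con 1ℚ :+ (x :* con 0ℚ :+ x :* con 0ℚ)) refl x
    markedCount-step (suc n) = begin
      M * pow M n * (2ℚ * b (suc (suc n)))
        ≡⟨ combine (- (M * pow M n)) (conv-c-b₊ n)
             (solve 5 (λ x p b v c → con 4ℚ :* x :* p :* (con 2ℚ :* b)
                 :- (con 4ℚ :* x :* p :* c :+ (x :* (p :* (con 2ℚ :* v)) :+ x :* (p :* (con 2ℚ :* v))))
               := :- (con 4ℚ :* x :* p) :* (v :+ c :- con 2ℚ :* b))
               refl x (pow M n) (b (suc (suc n))) v (c (suc n))) ⟩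
      M * pow M n * c (suc n) + (x * (pow M n * (2ℚ * v)) + x * (pow M n * (2ℚ * v)))
        ≡⟨ cong (λ s → M * pow M n * c (suc n) + (x * s + x * s))
             (trans (conv-pow M c (λ j → 2ℚ * b (suc j)) n) (cong (pow M n *_) (conv-*ʳ 2ℚ c (b ∘ suc) n))) ⟨
      forestCount (suc n) + (x * conv forestCount markedCount n + x * conv forestCount markedCount n) ∎
      where
      open ≡-Reasoning
      v = conv c (b ∘ suc) n

    -- The first summand has one inserted tree in front. Otherwise both lie below the first root,
    -- both lie in the remaining forest, or there is one in each.
    pairCount-step : ∀ n → pairCount n ≡ markedCount n +
      ((x * shift 1 (conv forestCount pairCount) n + x * shift 1 (conv forestCount pairCount) n)
        + x * shift 1 (conv markedCount markedCount) n)
    pairCount-step zero    = solve 1 (λ x → con 1ℚ := con 1ℚ :+ ((x :* con 0ℚ :+ x :* con 0ℚ) :+ x :* con 0ℚ)) refl x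
    pairCount-step (suc n) = begin
      M * pow M n * d (suc n)
        ≡⟨ combine₂ (- (2ℚ * x * pow M n)) (- (4ℚ * x * pow M n)) (conv-c-d n) (conv-b₊-b₊ n)
             (solve 6 (λ x p d b v w → con 4ℚ :* x :* p :* d
                 :- (con 4ℚ :* x :* p :* (con 2ℚ :* b) :+
                     ((x :* (p :* v) :+ x :* (p :* v)) :+ x :* (p :* (con 2ℚ :* (con 2ℚ :* w)))))
               := :- (con 2ℚ :* x :* p) :* (v :- con 2ℚ :* (d :- con 1ℚ))
               :+ :- (con 4ℚ :* x :* p) :* (w :+ con 2ℚ :* b :- con 1ℚ))
               refl x (pow M n) (d (suc n)) (b (suc (suc n))) v w) ⟩
      M * pow M n * (2ℚ * b (suc (suc n))) +
        ((x * (pow M n * v) + x * (pow M n * v)) + x * (pow M n * (2ℚ * (2ℚ * w))))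
        ≡⟨ cong₂ (λ s t → M * pow M n * (2ℚ * b (suc (suc n))) + ((x * s + x * s) + x * t))
             (conv-pow M c d n)
             (trans (conv-pow M (λ j → 2ℚ * b (suc j)) (λ j → 2ℚ * b (suc j)) n) $ cong (pow M n *_) $
               trans (conv-*ʳ 2ℚ (λ j → 2ℚ * b (suc j)) (b ∘ suc) n) (cong (2ℚ *_) (conv-*ˡ 2ℚ (b ∘ suc) (b ∘ suc) n))) ⟨
      markedCount (suc n) +
        ((x * conv forestCount pairCount n + x * conv forestCount pairCount n) + x * conv markedCount markedCount n) ∎
      where
      open ≡-Reasoning
      v = conv c d n
      w = conv (b ∘ suc) (b ∘ suc) n

    ∑ᵗ-1 : ∀ k n → ∑ᵗ {m} k n (λ _ → 1ℚ) ≡ x * ∑ᶠ k n (λ _ → 1ℚ)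
    ∑ᵗ-1 k n = ∑-labels {m} _

    ∑ᶠ-1 : ∀ k n → n ℕ.≤ k → ∑ᶠ {m} k n (λ _ → 1ℚ) ≡ forestCount n
    ∑ᶠ-1 k       zero    _         = refl
    ∑ᶠ-1 (suc k) (suc n) (s≤s n≤k) = begin
      ∑ᶠ {m} (suc k) (suc n) (λ _ → 1ℚ)
        ≡⟨ ∑ᶠ-∷ {m} k n (λ _ → 1ℚ) (λ _ → 1ℚ) (λ _ → 1ℚ) (λ _ _ → refl) ⟩
      diag (λ i j → ∑ᵗ {m} k i (λ _ → 1ℚ) * ∑ᶠ k j (λ _ → 1ℚ)) n
        ≡⟨ diag-cong n (λ i j eq → cong₂ _*_
             (trans (∑ᵗ-1 k i) (cong (x *_) (∑ᶠ-1 k i (ℕ.≤-trans (ℕ.m+n≤o⇒m≤o i (ℕ.≤-reflexive eq)) n≤k))))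
             (∑ᶠ-1 k j (ℕ.≤-trans (ℕ.m+n≤o⇒n≤o i (ℕ.≤-reflexive eq)) n≤k))) ⟩
      diag (λ i j → x * forestCount i * forestCount j) n
        ≡⟨ conv-*ˡ x forestCount forestCount n ⟩
      x * conv forestCount forestCount n
        ≡⟨ forestCount-step n ⟨
      forestCount (suc n) ∎
      where open ≡-Reasoning

    ∑ᶠ-nonempty : ∀ k n (φ ψ : Forest m → ℚ) → (∀ t ts → φ (t ∷ ts) ≡ ψ (t ∷ ts)) →
      ∑ᶠ k (suc n) φ ≡ ∑ᶠ k (suc n) ψ
    ∑ᶠ-nonempty k n φ ψ h = ∑ᶠ-cong k (suc n) λ { [] () ; (t ∷ ts) _ → h t ts }

    onChildren : (Forest m → ℚ) → Tree m → ℚ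
    onChildren φ (node _ us) = φ us

    one : ∀ {A : Set} → A → ℚ
    one _ = 1ℚ

    module _ (u : Tree m) where

      private
        p = size u
        occ = occurrencesᶠ u
        δ : Tree m → ℚ
        δ t = ⟦ u ≟ᵀ t ⟧

      occᶠ-∷ : ∀ t ts → occ (t ∷ ts) ≡ occurrences u t + occ ts
      occᶠ-∷ t ts = ∑-++ δ (subtrees t) (forestSubtrees ts)

      δ-≢ : ∀ t → size t ℕ.< p → δ t ≡ 0ℚ
      δ-≢ t t<u = ⟦⟧-false (u ≟ᵀ t) λ { refl → ℕ.<-irrefl refl t<u }

      occurrences-small : ∀ t → size t ℕ.< p → occurrences u t ≡ 0ℚ
      occᶠ-small : ∀ ts → forestSize ts ℕ.≤ p → occ ts ≡ 0ℚ
      occurrences-small t@(node a ts) t<u = cong₂ _+_ (δ-≢ t t<u) (occᶠ-small ts (ℕ.<⇒≤ t<u))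
      occᶠ-small []       _ = refl
      occᶠ-small (t ∷ ts) h = trans (occᶠ-∷ t ts) $ cong₂ _+_
        (occurrences-small t (ℕ.m+n≤o⇒m≤o (suc (size t)) h))
        (occᶠ-small ts (ℕ.m+n≤o⇒n≤o (suc (size t)) h))

      -- A tree does not occur properly inside itself, for reasons of size. Hence two occurrences of
      -- u are never nested.
      δ-*-occ : ∀ a ts → δ (node a ts) * occ ts ≡ 0ℚ
      δ-*-occ a ts with u ≟ᵀ node a ts
      ... | yes refl = trans (*-identityˡ (occ ts)) (occᶠ-small ts ℕ.≤-refl)
      ... | no _     = *-zeroˡ (occ ts)

      -- The binomial coefficient of `occ ts` over 2, written as a polynomial so that it splits by
      -- algebra.
      pairsᶠ : Forest m → ℚ
      pairsᶠ ts = ½ * (occ ts * occ ts - occ ts)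

      pairs : Tree m → ℚ
      pairs t = ½ * (occurrences u t * occurrences u t - occurrences u t)

      -- If the root is an occurrence it is the only one, so no pair involves the root.
      pairs-node : ∀ a ts → pairs (node a ts) ≡ pairsᶠ ts
      pairs-node a ts = combine₂ ½ 1ℚ (⟦⟧-idem (u ≟ᵀ node a ts)) (δ-*-occ a ts)
        (solve 2 (λ δ o → con ½ :* ((δ :+ o) :* (δ :+ o) :- (δ :+ o)) :- con ½ :* (o :* o :- o)
          := con ½ :* (δ :* δ :- δ) :+ con 1ℚ :* (δ :* o :- con 0ℚ)) refl (δ (node a ts)) (occ ts))

      occ-split : ∀ t ts → occ (t ∷ ts) ≡ δ t * 1ℚ + (onChildren occ t * 1ℚ + 1ℚ * occ ts)
      occ-split t@(node a us) ts = trans (occᶠ-∷ t ts) $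
        solve 3 (λ d o q → d :+ o :+ q := d :* con 1ℚ :+ (o :* con 1ℚ :+ con 1ℚ :* q)) refl (δ t) (occ us) (occ ts)

      -- Expanding the square, d² = d for the indicator d of u at the first root, and its product
      -- with the occurrences below that root vanishes. The factors `1ℚ` match the shape of `_⊗_`.
      pairs-split : ∀ t ts → pairsᶠ (t ∷ ts) ≡
        δ t * occ ts + ((onChildren pairsᶠ t * 1ℚ + 1ℚ * pairsᶠ ts) + onChildren occ t * occ ts)
      pairs-split t@(node a us) ts = trans (cong (λ o → ½ * (o * o - o)) (occᶠ-∷ t ts)) $
        combine₂ ½ 1ℚ (⟦⟧-idem (u ≟ᵀ node a us)) (δ-*-occ a us)
        (solve 3 (λ d o q → con ½ :* ((d :+ o :+ q) :* (d :+ o :+ q) :- (d :+ o :+ q))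
            :- (d :* q :+ ((con ½ :* (o :* o :- o) :* con 1ℚ :+ con 1ℚ :* (con ½ :* (q :* q :- q))) :+ o :* q))
          := con ½ :* (d :* d :- d) :+ con 1ℚ :* (d :* o :- con 0ℚ)) refl (δ t) (occ us) (occ ts))

      module _ {k n} (n≤k : n ℕ.≤ k) where

        sum-δ : ∀ ψ χ → (∀ j → j ℕ.≤ n → ∑ᶠ k j ψ ≡ χ j) → ∑ᶠ (suc k) (suc n) (δ ⊗ ψ) ≡ shift p χ n
        sum-δ ψ χ h = trans (∑ᶠ-⊗ k n δ ψ) $ trans
          (diag-cong n λ i j eq → cong₂ _*_
            (∑ᵗ-⟦⟧ k i u (ℕ.≤-trans (ℕ.m+n≤o⇒m≤o i (ℕ.≤-reflexive eq)) n≤k))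
            (h j (ℕ.m+n≤o⇒n≤o i (ℕ.≤-reflexive eq))))
          (diag-⟦⟧ p χ n)

        sum-product : ∀ φ φ′ ψ ψ′ → (∀ i → i ℕ.≤ n → ∑ᶠ k i φ ≡ φ′ i) → (∀ j → j ℕ.≤ n → ∑ᶠ k j ψ ≡ ψ′ j) →
          ∑ᶠ (suc k) (suc n) (onChildren φ ⊗ ψ) ≡ x * conv φ′ ψ′ n
        sum-product φ φ′ ψ ψ′ hφ hψ = trans (∑ᶠ-⊗ k n (onChildren φ) ψ) $ trans
          (diag-cong n λ i j eq → cong₂ _*_
            (trans (∑-labels {m} (∑ᶠ k i φ)) (cong (x *_) (hφ i (ℕ.m+n≤o⇒m≤o i (ℕ.≤-reflexive eq)))))
            (hψ j (ℕ.m+n≤o⇒n≤o i (ℕ.≤-reflexive eq))))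
          (conv-*ˡ x φ′ ψ′ n)

        count : ∀ j → j ℕ.≤ n → ∑ᶠ k j one ≡ forestCount j
        count j j≤n = ∑ᶠ-1 k j (ℕ.≤-trans j≤n n≤k)

      -- Brings the constant weight into the form that `sum-product` expects, a weight on the
      -- children of the first root.
      ⊗-one : ∀ k n (ψ : Forest m → ℚ) → ∑ᶠ k (suc n) (one ⊗ ψ) ≡ ∑ᶠ k (suc n) (onChildren one ⊗ ψ)
      ⊗-one k n ψ = ∑ᶠ-nonempty k n (one ⊗ ψ) (onChildren one ⊗ ψ) λ { (node _ _) _ → refl }

      occurrenceSum : ℕ → ℚ
      occurrenceSum = shift (suc p) markedCount

      -- Removing a marked copy of u together with the edge above it takes away `suc p` edges and
      -- leaves a forest with a marked slot; only the size of u matters. The proof compares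
      -- recursions instead of building this bijection.
      ∑ᶠ-occ : ∀ k n → n ℕ.≤ k → ∑ᶠ k n occ ≡ occurrenceSum n
      ∑ᶠ-occ k       zero    _         = refl
      ∑ᶠ-occ (suc k) (suc n) (s≤s n≤k) = begin
        ∑ᶠ (suc k) (suc n) occ
          ≡⟨ ∑ᶠ-nonempty (suc k) n occ (λ ts → (δ ⊗ one) ts + ((onChildren occ ⊗ one) ts + (one ⊗ occ) ts)) occ-split ⟩
        ∑ᶠ (suc k) (suc n) (λ ts → (δ ⊗ one) ts + ((onChildren occ ⊗ one) ts + (one ⊗ occ) ts))
          ≡⟨ trans (∑ᶠ-+ (suc k) (suc n) (δ ⊗ one) (λ ts → (onChildren occ ⊗ one) ts + (one ⊗ occ) ts))
               (cong (∑ᶠ (suc k) (suc n) (δ ⊗ one) +_) (∑ᶠ-+ (suc k) (suc n) (onChildren occ ⊗ one) (one ⊗ occ))) ⟩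
        ∑ᶠ (suc k) (suc n) (δ ⊗ one) +
          (∑ᶠ (suc k) (suc n) (onChildren occ ⊗ one) + ∑ᶠ (suc k) (suc n) (one ⊗ occ))
          ≡⟨ cong₂ _+_ (sum-δ n≤k one forestCount (count n≤k))
               (cong₂ _+_ (sum-product n≤k occ occurrenceSum one forestCount IH (count n≤k))
                 (trans (⊗-one (suc k) n occ) (sum-product n≤k one forestCount occ occurrenceSum (count n≤k) IH))) ⟩
        shift p forestCount n + (x * conv occurrenceSum forestCount n + x * conv forestCount occurrenceSum n)
          ≡⟨ cong (shift p forestCount n +_) (cong₂ _+_
               (cong (x *_) (trans (conv-comm occurrenceSum forestCount n) shifted)) (cong (x *_) shifted)) ⟩
        shift p forestCount n + (x * shift p (shift 1 G) n + x * shift p (shift 1 G) n)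
          ≡⟨ trans (shift-+ p _ _ n) (cong (shift p forestCount n +_)
               (trans (shift-+ p _ _ n) (cong₂ _+_ (shift-* p x _ n) (shift-* p x _ n)))) ⟨
        shift p (λ i → forestCount i + (x * shift 1 G i + x * shift 1 G i)) n
          ≡⟨ shift-cong p n (λ i _ → sym (markedCount-step i)) ⟩
        shift p markedCount n ∎
        where
        open ≡-Reasoning
        G = conv forestCount markedCount
        IH : ∀ j → j ℕ.≤ n → ∑ᶠ k j occ ≡ occurrenceSum j
        IH j j≤n = ∑ᶠ-occ k j (ℕ.≤-trans j≤n n≤k)
        -- The shift by p is moved to the outside, so that `markedCount-step` can be applied
        -- underneath it.
        shifted : conv forestCount occurrenceSum n ≡ shift p (shift 1 G) n
        shifted = trans (conv-shift (suc p) forestCount markedCount n) $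
          trans (sym (shift-shift 1 p G n)) (shift-comm 1 p G n)

      pairSum : ℕ → ℚ
      pairSum = shift (suc p) (shift (suc p) pairCount)

      -- Two disjoint copies are removed, hence two shifts by `suc p`, and two slots remain marked.
      ∑ᶠ-pairs : ∀ k n → n ℕ.≤ k → ∑ᶠ k n pairsᶠ ≡ pairSum n
      ∑ᶠ-pairs k       zero    _         = refl
      ∑ᶠ-pairs (suc k) (suc n) (s≤s n≤k) = begin
        ∑ᶠ (suc k) (suc n) pairsᶠ
          ≡⟨ ∑ᶠ-nonempty (suc k) n pairsᶠ (λ ts → (δ ⊗ occ) ts +
               (((onChildren pairsᶠ ⊗ one) ts + (one ⊗ pairsᶠ) ts) + (onChildren occ ⊗ occ) ts)) pairs-split ⟩
        ∑ᶠ (suc k) (suc n) (λ ts → (δ ⊗ occ) ts +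
          (((onChildren pairsᶠ ⊗ one) ts + (one ⊗ pairsᶠ) ts) + (onChildren occ ⊗ occ) ts))
          ≡⟨ trans (∑ᶠ-+ (suc k) (suc n) (δ ⊗ occ)
                 (λ ts → ((onChildren pairsᶠ ⊗ one) ts + (one ⊗ pairsᶠ) ts) + (onChildren occ ⊗ occ) ts))
               (cong (∑ᶠ (suc k) (suc n) (δ ⊗ occ) +_)
                 (trans (∑ᶠ-+ (suc k) (suc n) (λ ts → (onChildren pairsᶠ ⊗ one) ts + (one ⊗ pairsᶠ) ts) (onChildren occ ⊗ occ))
                   (cong (_+ ∑ᶠ (suc k) (suc n) (onChildren occ ⊗ occ))
                     (∑ᶠ-+ (suc k) (suc n) (onChildren pairsᶠ ⊗ one) (one ⊗ pairsᶠ))))) ⟩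
        ∑ᶠ (suc k) (suc n) (δ ⊗ occ) + ((∑ᶠ (suc k) (suc n) (onChildren pairsᶠ ⊗ one)
          + ∑ᶠ (suc k) (suc n) (one ⊗ pairsᶠ)) + ∑ᶠ (suc k) (suc n) (onChildren occ ⊗ occ))
          ≡⟨ cong₂ _+_ (sum-δ n≤k occ occurrenceSum IHo)
               (cong₂ _+_ (cong₂ _+_
                 (sum-product n≤k pairsᶠ pairSum one forestCount IH (count n≤k))
                 (trans (⊗-one (suc k) n pairsᶠ) (sum-product n≤k one forestCount pairsᶠ pairSum (count n≤k) IH)))
                 (sum-product n≤k occ occurrenceSum occ occurrenceSum IHo IHo)) ⟩
        shift p occurrenceSum n +
          ((x * conv pairSum forestCount n + x * conv forestCount pairSum n) + x * conv occurrenceSum occurrenceSum n)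
          ≡⟨ cong₂ _+_ (shift-cong p n λ _ _ → refl) (cong₂ _+_ (cong₂ _+_
               (cong (x *_) (trans (conv-comm pairSum forestCount n) shifted)) (cong (x *_) shifted))
               (cong (x *_) shifted′)) ⟩
        shift p (shift (suc p) markedCount) n +
          ((x * shift p (shift (suc p) (shift 1 G)) n + x * shift p (shift (suc p) (shift 1 G)) n)
            + x * shift p (shift (suc p) (shift 1 H)) n)
          ≡⟨ trans (shift-+ p _ _ n) (cong (shift p (shift (suc p) markedCount) n +_)
               (trans (shift-+ p _ _ n) (cong₂ _+_
                 (trans (shift-+ p _ _ n) (cong₂ _+_ (shift-* p x _ n) (shift-* p x _ n)))
                 (shift-* p x _ n)))) ⟨
        shift p (λ i → shift (suc p) markedCount i + ((x * shift (suc p) (shift 1 G) i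
          + x * shift (suc p) (shift 1 G) i) + x * shift (suc p) (shift 1 H) i)) n
          ≡⟨ shift-cong p n (λ i _ → trans (shift-+ (suc p) _ _ i) (cong (shift (suc p) markedCount i +_)
               (trans (shift-+ (suc p) _ _ i) (cong₂ _+_
                 (trans (shift-+ (suc p) _ _ i) (cong₂ _+_ (shift-* (suc p) x _ i) (shift-* (suc p) x _ i)))
                 (shift-* (suc p) x _ i))))) ⟨
        shift p (shift (suc p) (λ i → markedCount i + ((x * shift 1 G i + x * shift 1 G i) + x * shift 1 H i))) n
          ≡⟨ shift-cong p n (λ i _ → shift-cong (suc p) i (λ j _ → sym (pairCount-step j))) ⟩
        shift p (shift (suc p) pairCount) n ∎
        where
        open ≡-Reasoning
        G = conv forestCount pairCount
        H = conv markedCount markedCount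
        IH : ∀ j → j ℕ.≤ n → ∑ᶠ k j pairsᶠ ≡ pairSum j
        IH j j≤n = ∑ᶠ-pairs k j (ℕ.≤-trans j≤n n≤k)
        IHo : ∀ j → j ℕ.≤ n → ∑ᶠ k j occ ≡ occurrenceSum j
        IHo j j≤n = ∑ᶠ-occ k j (ℕ.≤-trans j≤n n≤k)
        reorder : ∀ (F : ℕ → ℚ) → shift (suc p) (shift (suc p) F) n ≡ shift p (shift (suc p) (shift 1 F)) n
        reorder F = trans (sym (shift-shift 1 p (shift (suc p) F) n)) $
          trans (shift-comm 1 p (shift (suc p) F) n) $
          shift-cong p n λ i _ → shift-comm 1 (suc p) F i
        shifted : conv forestCount pairSum n ≡ shift p (shift (suc p) (shift 1 G)) n
        shifted = trans (conv-shift (suc p) forestCount (shift (suc p) pairCount) n) $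
          trans (shift-cong (suc p) n λ i _ → conv-shift (suc p) forestCount pairCount i) (reorder G)
        shifted′ : conv occurrenceSum occurrenceSum n ≡ shift p (shift (suc p) (shift 1 H)) n
        shifted′ = trans (shift-conv (suc p) markedCount occurrenceSum n) $
          trans (shift-cong (suc p) n λ i _ → conv-shift (suc p) markedCount markedCount i) (reorder H)

      -- The indicator is the occurrence at the root, possible only for the tree u itself; all
      -- others lie in the forest of children.
      ∑ᵗ-occurrences : ∀ n → ∑ᵗ n n (occurrences u) ≡ ⟦ p ℕ.≟ n ⟧ + x * occurrenceSum n
      ∑ᵗ-occurrences n = begin
        ∑ᵗ n n (occurrences u)
          ≡⟨ ∑ᵗ-cong n n {occurrences u} {λ t → δ t + onChildren occ t} (λ { (node _ _) _ → refl }) ⟩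
        ∑ᵗ n n (λ t → δ t + onChildren occ t)
          ≡⟨ ∑ᵗ-+ n n δ (onChildren occ) ⟩
        ∑ᵗ n n δ + ∑ᵗ n n (onChildren occ)
          ≡⟨ cong₂ _+_ (∑ᵗ-⟦⟧ n n u ℕ.≤-refl)
               (trans (∑-labels {m} (∑ᶠ n n occ)) (cong (x *_) (∑ᶠ-occ n n ℕ.≤-refl))) ⟩
        ⟦ p ℕ.≟ n ⟧ + x * occurrenceSum n ∎
        where open ≡-Reasoning

      ∑ᵗ-pairs : ∀ n → ∑ᵗ n n pairs ≡ x * pairSum n
      ∑ᵗ-pairs n = trans (∑ᵗ-cong n n {pairs} {onChildren pairsᶠ} λ { (node a ts) _ → pairs-node a ts }) $
        trans (∑-labels {m} (∑ᶠ n n pairsᶠ)) (cong (x *_) (∑ᶠ-pairs n n ℕ.≤-refl))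

-- From occurrences to distinct subtrees.

module Dags where

  open import Data.Rational hiding (NonZero)
  open import Data.Rational.Properties
  open ℚ-Lemmas
  open DiagonalSums
  open CentralBinomials
  open ForestSums
  open Counting

  ⟦⟧-sym : ∀ {A : Set} (_≟_ : DecidableEquality A) x y → ⟦ x ≟ y ⟧ ≡ ⟦ y ≟ x ⟧
  ⟦⟧-sym _≟_ x y with x ≟ y
  ... | yes refl = sym (⟦⟧-true (x ≟ x) refl)
  ... | no x≢y   = sym (⟦⟧-false (y ≟ x) (x≢y ∘ sym))

  module _ {m : ℕ} where

    ∑-∑ᵗ-comm : ∀ {A : Set} (φ : A → Tree m → ℚ) xs k n →
      ∑ xs (λ x → ∑ᵗ k n (φ x)) ≡ ∑ᵗ k n (λ u → ∑ xs (λ x → φ x u))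
    ∑-∑ᵗ-comm φ []       k n = sym $ trans (∑-cong (allFin m) λ a _ → ∑ᶠ-0 k n) (∑-0 (allFin m))
    ∑-∑ᵗ-comm φ (x ∷ xs) k n = trans (cong (∑ᵗ k n (φ x) +_) (∑-∑ᵗ-comm φ xs k n)) $
      sym (∑ᵗ-+ k n (φ x) λ u → ∑ xs λ x → φ x u)

    ∑-trees-⟦⟧ : ∀ n (t : Tree m) → ∑ (trees m n) (λ u → ⟦ t ≟ᵀ u ⟧) ≡ ⟦ size t ℕ.≟ n ⟧
    ∑-trees-⟦⟧ n t = by-size (size t ℕ.≟ n)
      where
      by-size : Dec (size t ≡ n) → ∑ (trees m n) (λ u → ⟦ t ≟ᵀ u ⟧) ≡ ⟦ size t ℕ.≟ n ⟧
      by-size (yes eq) = trans (∑-unique _≟ᵀ_ {t} (trees-unique m n) (trees-complete {t = t} eq))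
        (sym (⟦⟧-true (size t ℕ.≟ n) eq))
      by-size (no ≢)   = trans (∑-∉ _≟ᵀ_ {t} (trees m n) (≢ ∘ trees-sound)) (sym (⟦⟧-false (size t ℕ.≟ n) ≢))

    -- Transfers the counts from the recursive sum to the list `trees`. Both visit each tree of size
    -- n once, so inserting the indicator of equality and exchanging the two sums suffices.
    ∑-trees : ∀ n (φ : Tree m → ℚ) → ∑ (trees m n) φ ≡ ∑ᵗ n n φ
    ∑-trees n φ = begin
      ∑ (trees m n) φ
        ≡⟨ ∑-cong (trees m n) (λ t t∈ → sym (select t (trees-sound t∈))) ⟩
      ∑ (trees m n) (λ t → ∑ᵗ n n (λ u → ⟦ t ≟ᵀ u ⟧ * φ u))
        ≡⟨ ∑-∑ᵗ-comm (λ t u → ⟦ t ≟ᵀ u ⟧ * φ u) (trees m n) n n ⟩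
      ∑ᵗ n n (λ u → ∑ (trees m n) (λ t → ⟦ t ≟ᵀ u ⟧ * φ u))
        ≡⟨ ∑ᵗ-cong n n (λ u u≡ → unselect u u≡) ⟩
      ∑ᵗ n n φ ∎
      where
      open ≡-Reasoning
      select : ∀ t → size t ≡ n → ∑ᵗ n n (λ u → ⟦ t ≟ᵀ u ⟧ * φ u) ≡ φ t
      select t eq = begin
        ∑ᵗ n n (λ u → ⟦ t ≟ᵀ u ⟧ * φ u)
          ≡⟨ ∑ᵗ-cong n n {λ u → ⟦ t ≟ᵀ u ⟧ * φ u} {λ u → ⟦ t ≟ᵀ u ⟧ * φ t} (λ u _ → ⟦⟧-subst (t ≟ᵀ u) φ) ⟩
        ∑ᵗ n n (λ u → ⟦ t ≟ᵀ u ⟧ * φ t)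
          ≡⟨ ∑ᵗ-*ʳ n n (φ t) (λ u → ⟦ t ≟ᵀ u ⟧) ⟩
        ∑ᵗ n n (λ u → ⟦ t ≟ᵀ u ⟧) * φ t
          ≡⟨ cong (_* φ t) (trans (∑ᵗ-⟦⟧ n n t ℕ.≤-refl) (⟦⟧-true (size t ℕ.≟ n) eq)) ⟩
        1ℚ * φ t
          ≡⟨ *-identityˡ (φ t) ⟩
        φ t ∎
      unselect : ∀ u → size u ≡ n → ∑ (trees m n) (λ t → ⟦ t ≟ᵀ u ⟧ * φ u) ≡ φ u
      unselect u eq = begin
        ∑ (trees m n) (λ t → ⟦ t ≟ᵀ u ⟧ * φ u)
          ≡⟨ ∑-cong (trees m n) (λ t _ → trans (cong (_* φ u) (⟦⟧-sym _≟ᵀ_ t u)) (*-comm ⟦ u ≟ᵀ t ⟧ (φ u))) ⟩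
        ∑ (trees m n) (λ t → φ u * ⟦ u ≟ᵀ t ⟧)
          ≡⟨ ∑-* (φ u) _ (trees m n) ⟩
        φ u * ∑ (trees m n) (λ t → ⟦ u ≟ᵀ t ⟧)
          ≡⟨ cong (φ u *_) (trans (∑-trees-⟦⟧ n u) (⟦⟧-true (size u ℕ.≟ n) eq)) ⟩
        φ u * 1ℚ
          ≡⟨ *-identityʳ (φ u) ⟩
        φ u ∎

    subtrees-size : ∀ {u} (t : Tree m) → u ∈ subtrees t → size u ℕ.≤ size t
    forestSubtrees-size : ∀ {u} (ts : Forest m) → u ∈ forestSubtrees ts → size u ℕ.< forestSize ts
    subtrees-size (node a ts) (here refl) = ℕ.≤-refl
    subtrees-size (node a ts) (there u∈)  = ℕ.<⇒≤ (forestSubtrees-size ts u∈)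
    forestSubtrees-size (t ∷ ts) u∈ with ∈-++⁻ (subtrees t) u∈
    ... | inj₁ u∈t  = s≤s (ℕ.≤-trans (subtrees-size t u∈t) (ℕ.m≤m+n (size t) (forestSize ts)))
    ... | inj₂ u∈ts = ℕ.<-≤-trans (forestSubtrees-size ts u∈ts) (ℕ.m≤n+m (forestSize ts) (suc (size t)))

    -- The 0-1 version of `occurrences`: deduplication leaves at most one copy of u.
    occurs : Tree m → Tree m → ℚ
    occurs u t = ∑ (deduplicate _≟ᵀ_ (subtrees t)) λ v → ⟦ u ≟ᵀ v ⟧

    ∑-⟦⟧-ℕ : ∀ (u : Tree m) xs → ∃[ k ] ∑ xs (λ v → ⟦ u ≟ᵀ v ⟧) ≡ fromℕ k
    ∑-⟦⟧-ℕ u []       = 0 , refl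
    ∑-⟦⟧-ℕ u (x ∷ xs) with u ≟ᵀ x | ∑-⟦⟧-ℕ u xs
    ... | yes _ | k , eq = suc k , trans (cong (1ℚ +_) eq) (sym (fromℕ-suc k))
    ... | no  _ | k , eq = k , trans (+-identityˡ _) eq

    ∑-⟦⟧-∈ : ∀ {u : Tree m} {xs} → u ∈ xs → ∃[ k ] ∑ xs (λ v → ⟦ u ≟ᵀ v ⟧) ≡ 1ℚ + fromℕ k
    ∑-⟦⟧-∈ {u} {x ∷ xs} (here refl) with ∑-⟦⟧-ℕ u xs
    ... | k , eq = k , cong₂ _+_ (⟦⟧-true (u ≟ᵀ u) refl) eq
    ∑-⟦⟧-∈ {u} {x ∷ xs} (there u∈) with u ≟ᵀ x | ∑-⟦⟧-∈ {u} {xs} u∈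
    ... | yes _ | k , eq = suc k , cong (1ℚ +_) (trans eq (sym (fromℕ-suc k)))
    ... | no  _ | k , eq = k , trans (+-identityˡ _) eq

    -- The integrality of the number of occurrences is recorded because the Bonferroni inequality o
    -- ≤ 1 + o(o-1)/2 fails for o strictly between 1 and 2.
    occurs-cases : ∀ u t → (occurs u t ≡ 0ℚ × occurrences u t ≡ 0ℚ)
      ⊎ (occurs u t ≡ 1ℚ × ∃[ k ] occurrences u t ≡ 1ℚ + fromℕ k)
    occurs-cases u t with member? _≟ᵀ_ u (subtrees t)
    ... | yes u∈ = inj₂
      ( ∑-unique _≟ᵀ_ {u} (deduplicate-! _≟ᵀ_ (subtrees t)) (∈-deduplicate⁺ _≟ᵀ_ u∈)
      , ∑-⟦⟧-∈ {u} {subtrees t} u∈ )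
    ... | no  u∉ = inj₁
      ( ∑-∉ _≟ᵀ_ {u} (deduplicate _≟ᵀ_ (subtrees t)) (u∉ ∘ ∈-deduplicate⁻ _≟ᵀ_ (subtrees t))
      , ∑-∉ _≟ᵀ_ {u} (subtrees t) u∉ )

    0≤occurs : ∀ u t → 0ℚ ≤ occurs u t
    0≤occurs u t = ∑-nonNegative (deduplicate _≟ᵀ_ (subtrees t)) λ v → 0≤⟦⟧ (u ≟ᵀ v)

    occurs≤1 : ∀ u t → occurs u t ≤ 1ℚ
    occurs≤1 u t with occurs-cases u t
    ... | inj₁ (eq , _) = ≤-trans (≤-reflexive eq) (<⇒≤ (positive⁻¹ 1ℚ))
    ... | inj₂ (eq , _) = ≤-reflexive eq

    occurs≤occurrences : ∀ u t → occurs u t ≤ occurrences u t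
    occurs≤occurrences u t with occurs-cases u t
    ... | inj₁ (eq , eq′)     = ≤-reflexive (trans eq (sym eq′))
    ... | inj₂ (eq , k , eq′) = subst₂ _≤_ (sym eq) (sym eq′) (≤+ 1ℚ (0≤fromℕ k))

    -- For k + 1 occurrences the difference is k(k-1)/2.
    bonferroni : ∀ u t → occurrences u t ≤ occurs u t + pairs u t
    bonferroni u t with occurs-cases u t
    ... | inj₁ (eq , eq′)     = ≤-reflexive $ trans eq′ $ sym $
      cong₂ _+_ eq (cong (λ o → ½ * (o * o - o)) eq′)
    ... | inj₂ (eq , k , eq′) = subst₂ _≤_ (sym eq′) (sym (cong₂ _+_ eq (cong (λ o → ½ * (o * o - o)) eq′)))
      (excess k)
      where
      excess : ∀ k → 1ℚ + fromℕ k ≤ 1ℚ + ½ * ((1ℚ + fromℕ k) * (1ℚ + fromℕ k) - (1ℚ + fromℕ k))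
      excess zero    = ≤-refl
      excess (suc k) rewrite fromℕ-suc k = subst (1ℚ + (1ℚ + y) ≤_)
        (solve 1 (λ y → con 1ℚ :+ (con 1ℚ :+ y) :+ con ½ :* (y :* y :+ y)
          := con 1ℚ :+ con ½ :* ((con 1ℚ :+ (con 1ℚ :+ y)) :* (con 1ℚ :+ (con 1ℚ :+ y)) :- (con 1ℚ :+ (con 1ℚ :+ y))))
          refl y)
        (≤+ _ (0≤* {½} (<⇒≤ (positive⁻¹ ½)) (0≤+ (0≤* (0≤fromℕ k) (0≤fromℕ k)) (0≤fromℕ k))))
        where y = fromℕ k

    -- Sorts the distinct subtrees by size: each matches exactly one entry of exactly one list
    -- `trees m p` with p at most n.
    dagNodes-occurs : ∀ n (t : Tree m) → size t ≡ n →
      fromℕ (dagNodes t) ≡ diag (λ p _ → ∑ (trees m p) λ u → occurs u t) n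
    dagNodes-occurs n t refl = begin
      fromℕ (length D)
        ≡⟨ ∑-1 D ⟨
      ∑ D (λ _ → 1ℚ)
        ≡⟨ ∑-cong D (λ v v∈ → sym (one-size v (subtrees-size t (∈-deduplicate⁻ _≟ᵀ_ (subtrees t) v∈)))) ⟩
      ∑ D (λ v → diag (λ p _ → ∑ (trees m p) λ u → ⟦ u ≟ᵀ v ⟧) n)
        ≡⟨ ∑-diag (λ v p _ → ∑ (trees m p) λ u → ⟦ u ≟ᵀ v ⟧) D n ⟩
      diag (λ p _ → ∑ D λ v → ∑ (trees m p) λ u → ⟦ u ≟ᵀ v ⟧) n
        ≡⟨ diag-cong n (λ p _ _ → ∑-comm (λ v u → ⟦ u ≟ᵀ v ⟧) D (trees m p)) ⟩
      diag (λ p _ → ∑ (trees m p) λ u → occurs u t) n ∎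
      where
      open ≡-Reasoning
      D = deduplicate _≟ᵀ_ (subtrees t)
      one-size : ∀ v → size v ℕ.≤ n → diag (λ p _ → ∑ (trees m p) λ u → ⟦ u ≟ᵀ v ⟧) n ≡ 1ℚ
      one-size v v≤n = begin
        diag (λ p _ → ∑ (trees m p) λ u → ⟦ u ≟ᵀ v ⟧) n
          ≡⟨ diag-cong n (λ p _ _ → trans (∑-cong (trees m p) λ u _ → ⟦⟧-sym _≟ᵀ_ u v)
               (trans (∑-trees-⟦⟧ p v) (sym (*-identityʳ _)))) ⟩
        diag (λ p _ → ⟦ size v ℕ.≟ p ⟧ * 1ℚ) n
          ≡⟨ diag-⟦⟧ (size v) (λ _ → 1ℚ) n ⟩
        shift (size v) (λ _ → 1ℚ) n
          ≡⟨ cong (shift (size v) (λ _ → 1ℚ)) (ℕ.m+[n∸m]≡n v≤n) ⟨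
        shift (size v) (λ _ → 1ℚ) (size v ℕ.+ (n ℕ.∸ size v))
          ≡⟨ shift-offset (size v) (λ _ → 1ℚ) (n ℕ.∸ size v) ⟩
        1ℚ ∎

    treeCount : ℕ → ℚ
    treeCount n = fromℕ m * forestCount {m} n

    ∑-trees-const : ∀ n x → ∑ (trees m n) (λ _ → x) ≡ treeCount n * x
    ∑-trees-const n x = begin
      ∑ (trees m n) (λ _ → x)        ≡⟨ ∑-cong (trees m n) (λ _ _ → sym (*-identityʳ x)) ⟩
      ∑ (trees m n) (λ _ → x * 1ℚ)   ≡⟨ ∑-* x (λ _ → 1ℚ) (trees m n) ⟩
      x * ∑ (trees m n) (λ _ → 1ℚ)   ≡⟨ cong (x *_) (trans (∑-trees n (λ _ → 1ℚ)) (∑-labels {m} (∑ᶠ n n λ _ → 1ℚ))) ⟩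
      x * (fromℕ m * ∑ᶠ n n (λ _ → 1ℚ)) ≡⟨ cong (λ s → x * (fromℕ m * s)) (∑ᶠ-1 n n ℕ.≤-refl) ⟩
      x * treeCount n                ≡⟨ *-comm x _ ⟩
      treeCount n * x                ∎
      where open ≡-Reasoning

    length-trees : ∀ n → fromℕ (length (trees m n)) ≡ treeCount n
    length-trees n = trans (sym (∑-1 (trees m n))) $
      trans (∑-trees-const n 1ℚ) (*-identityʳ (treeCount n))

    -- The number of trees of size n with a subtree u, summed over all u of size p.
    hits : ℕ → ℕ → ℚ
    hits n p = ∑ (trees m p) λ u → ∑ (trees m n) λ t → occurs u t

    ∑-dagNodes : ∀ n → ∑ (trees m n) (fromℕ ∘ dagNodes) ≡ diag (λ p _ → hits n p) n
    ∑-dagNodes n = begin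
      ∑ (trees m n) (fromℕ ∘ dagNodes)
        ≡⟨ ∑-cong (trees m n) (λ t t∈ → dagNodes-occurs n t (trees-sound t∈)) ⟩
      ∑ (trees m n) (λ t → diag (λ p _ → ∑ (trees m p) λ u → occurs u t) n)
        ≡⟨ ∑-diag (λ t p _ → ∑ (trees m p) λ u → occurs u t) (trees m n) n ⟩
      diag (λ p _ → ∑ (trees m n) λ t → ∑ (trees m p) λ u → occurs u t) n
        ≡⟨ diag-cong n (λ p _ _ → ∑-comm (λ t u → occurs u t) (trees m n) (trees m p)) ⟩
      diag (λ p _ → hits n p) n ∎
      where open ≡-Reasoning

    occurrenceTotal : ℕ → ℕ → ℚ
    occurrenceTotal p n = ⟦ p ℕ.≟ n ⟧ + fromℕ m * shift (suc p) (markedCount {m}) n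

    pairTotal : ℕ → ℕ → ℚ
    pairTotal p n = fromℕ m * shift (suc p) (shift (suc p) (pairCount {m})) n

    0≤hits : ∀ n p → 0ℚ ≤ hits n p
    0≤hits n p = ∑-nonNegative (trees m p) λ u → ∑-nonNegative (trees m n) λ t → 0≤occurs u t

    hits-≤-all : ∀ n p → hits n p ≤ treeCount p * treeCount n
    hits-≤-all n p = begin
      hits n p
        ≤⟨ ∑-mono (trees m p) (λ u _ → ∑-mono (trees m n) λ t _ → occurs≤1 u t) ⟩
      ∑ (trees m p) (λ _ → ∑ (trees m n) λ _ → 1ℚ)
        ≡⟨ ∑-trees-const p _ ⟩
      treeCount p * ∑ (trees m n) (λ _ → 1ℚ)
        ≡⟨ cong (treeCount p *_) (trans (∑-trees-const n 1ℚ) (*-identityʳ (treeCount n))) ⟩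
      treeCount p * treeCount n ∎
      where open ≤-Reasoning

    hits-≤-occurrences : ∀ n p → hits n p ≤ treeCount p * occurrenceTotal p n
    hits-≤-occurrences n p = begin
      hits n p
        ≤⟨ ∑-mono (trees m p) (λ u _ → ∑-mono (trees m n) λ t _ → occurs≤occurrences u t) ⟩
      ∑ (trees m p) (λ u → ∑ (trees m n) (occurrences u))
        ≡⟨ ∑-cong (trees m p) (λ u u∈ → trans (∑-trees n (occurrences u)) (trans (∑ᵗ-occurrences u n)
             (cong (λ q → occurrenceTotal q n) (trees-sound u∈)))) ⟩
      ∑ (trees m p) (λ _ → occurrenceTotal p n)
        ≡⟨ ∑-trees-const p _ ⟩
      treeCount p * occurrenceTotal p n ∎
      where open ≤-Reasoning

    occurrences-≤-hits : ∀ n p → treeCount p * occurrenceTotal p n ≤ hits n p + treeCount p * pairTotal p n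
    occurrences-≤-hits n p = begin
      treeCount p * occurrenceTotal p n
        ≡⟨ ∑-trees-const p _ ⟨
      ∑ (trees m p) (λ _ → occurrenceTotal p n)
        ≡⟨ ∑-cong (trees m p) (λ u u∈ → sym (trans (∑-trees n (occurrences u)) (trans (∑ᵗ-occurrences u n)
             (cong (λ q → occurrenceTotal q n) (trees-sound u∈))))) ⟩
      ∑ (trees m p) (λ u → ∑ (trees m n) (occurrences u))
        ≤⟨ ∑-mono (trees m p) (λ u _ → ∑-mono (trees m n) λ t _ → bonferroni u t) ⟩
      ∑ (trees m p) (λ u → ∑ (trees m n) (λ t → occurs u t + pairs u t))
        ≡⟨ trans (∑-cong (trees m p) λ u _ → ∑-+ (occurs u) (pairs u) (trees m n)) (∑-+ _ _ (trees m p)) ⟩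
      hits n p + ∑ (trees m p) (λ u → ∑ (trees m n) (pairs u))
        ≡⟨ cong (hits n p +_) (trans
             (∑-cong (trees m p) λ u u∈ → trans (∑-trees n (pairs u)) (trans (∑ᵗ-pairs u n)
               (cong (λ q → pairTotal q n) (trees-sound u∈))))
             (∑-trees-const p _)) ⟩
      hits n p + treeCount p * pairTotal p n ∎
      where open ≤-Reasoning

  ∑-fromℕ : ∀ {A : Set} (φ : A → ℕ) xs → fromℕ (sum (List.map φ xs)) ≡ ∑ xs (fromℕ ∘ φ)
  ∑-fromℕ φ []       = refl
  ∑-fromℕ φ (x ∷ xs) = trans (fromℕ-+ (φ x) _) (cong (fromℕ (φ x) +_) (∑-fromℕ φ xs))

  quotient-* : ∀ a l .{{_ : NonZero l}} → (ℤ.+ a / l) * fromℕ l ≡ fromℕ a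
  quotient-* a (suc l) = begin
    (ℤ.+ a / suc l) * fromℕ (suc l)      ≡⟨ cong (_* fromℕ (suc l)) (frac-split a l) ⟩
    fromℕ a * unit l * fromℕ (suc l)     ≡⟨ combine (fromℕ a) (unit-inverse l)
                                              (solve 3 (λ a u l → a :* u :* l :- a := a :* (l :* u :- con 1ℚ)) refl
                                                (fromℕ a) (unit l) (fromℕ (suc l))) ⟩
    fromℕ a                              ∎
    where open ≡-Reasoning

  averageDagNodes-* : ∀ m .{{_ : NonZero m}} n →
    averageDagNodes m n * treeCount {m} n ≡ diag (λ p _ → hits {m} n p) n
  averageDagNodes-* m n = begin
    averageDagNodes m n * treeCount {m} n
      ≡⟨ cong (averageDagNodes m n *_) (sym (length-trees {m} n)) ⟩
    averageDagNodes m n * fromℕ (length (trees m n))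
      ≡⟨ quotient-* (sum (List.map dagNodes (trees m n))) (length (trees m n)) {{trees-nonEmpty m n}} ⟩
    fromℕ (sum (List.map dagNodes (trees m n)))
      ≡⟨ ∑-fromℕ dagNodes (trees m n) ⟩
    ∑ (trees m n) (fromℕ ∘ dagNodes)
      ≡⟨ ∑-dagNodes {m} n ⟩
    diag (λ p _ → hits {m} n p) n ∎
    where open ≡-Reasoning

-- Bounds for the average dag size in terms of the cut P.

module AverageBounds where

  open import Data.Rational hiding (NonZero)
  open import Data.Rational.Properties
  open ℚ-Lemmas
  open OperationLemmas using (inverse-positive)
  open DiagonalSums
  open CentralBinomials
  open ForestSums
  open Counting
  open Dags

  shift-below : ∀ p g → shift (suc p) g p ≡ 0ℚ
  shift-below zero    g = refl
  shift-below (suc p) g = shift-below p g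

  -- The counterpart of `combine` for inequalities: exhibit the difference as an expression that is
  -- visibly nonnegative.
  by-difference : ∀ {p q} r → 0ℚ ≤ r → q - p ≡ r → p ≤ q
  by-difference {p} {q} r 0≤r eq = subst (p ≤_)
    (trans (cong (p +_) (sym eq)) (solve 2 (λ p q → p :+ (q :- p) := q) refl p q)) (≤+ p 0≤r)

  0≤1 : 0ℚ ≤ 1ℚ
  0≤1 = <⇒≤ (positive⁻¹ 1ℚ)

  0≤½ : 0ℚ ≤ ½
  0≤½ = <⇒≤ (positive⁻¹ ½)

  0≤2 : 0ℚ ≤ 2ℚ
  0≤2 = <⇒≤ (positive⁻¹ 2ℚ)

  0≤4 : 0ℚ ≤ 4ℚ
  0≤4 = <⇒≤ (positive⁻¹ 4ℚ)

  cancelʳ-≤ : ∀ {r p q} → 0ℚ < r → p * r ≤ q * r → p ≤ q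
  cancelʳ-≤ {r} 0<r = *-cancelʳ-≤-pos r {{positive 0<r}}

  cancelˡ-≤ : ∀ {r p q} → 0ℚ < r → r * p ≤ r * q → p ≤ q
  cancelˡ-≤ {r} 0<r = *-cancelˡ-≤-pos r {{positive 0<r}}

  pow-nonNegative : ∀ {x} → 0ℚ ≤ x → ∀ n → 0ℚ ≤ pow x n
  pow-nonNegative 0≤x zero    = 0≤1
  pow-nonNegative 0≤x (suc n) = 0≤* 0≤x (pow-nonNegative 0≤x n)

  pow-positive : ∀ {x} → 0ℚ < x → ∀ n → 0ℚ < pow x n
  pow-positive 0<x zero    = positive⁻¹ 1ℚ
  pow-positive {x} 0<x (suc n) = 0<* {x} 0<x (pow-positive 0<x n)

  pow-inverse : ∀ {x y} → x * y ≡ 1ℚ → ∀ n → pow x n * pow y n ≡ 1ℚ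
  pow-inverse         xy zero    = refl
  pow-inverse {x} {y} xy (suc n) = combine₂ (pow x n * pow y n) 1ℚ xy (pow-inverse xy n)
    (solve 4 (λ x y p q → x :* p :* (y :* q) :- con 1ℚ := p :* q :* (x :* y :- con 1ℚ) :+ con 1ℚ :* (p :* q :- con 1ℚ))
      refl x y (pow x n) (pow y n))

  geometric : ∀ {w} → 0ℚ ≤ w → w ≤ ½ → ∀ n → diag (λ i _ → pow w i) n ≤ 2ℚ
  geometric         0≤w w≤½ zero    = ≤ᵇ⇒≤ _
  geometric {w} 0≤w w≤½ (suc n) = begin
    1ℚ + diag (λ i _ → w * pow w i) n   ≡⟨ cong (1ℚ +_) (diag-* w _ n) ⟩
    1ℚ + w * diag (λ i _ → pow w i) n   ≤⟨ +-monoʳ-≤ 1ℚ (*-mono 0≤½ (diag-nonNegative n λ i _ → pow-nonNegative 0≤w i)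
                                              w≤½ (geometric 0≤w w≤½ n)) ⟩
    1ℚ + ½ * 2ℚ                         ≡⟨ refl ⟩
    2ℚ                                  ∎
    where open ≤-Reasoning

  -- For growth rate x a shift by q costs a factor x^q; it stands on the left to avoid a division.
  -- The remaining factor D absorbs the subexponential growth.
  shift-bound : ∀ {x D} → 0ℚ ≤ x → 0ℚ ≤ D → ∀ q (F : ℕ → ℚ) n → (∀ i → i ℕ.≤ n → F i ≤ pow x i * D) →
    pow x q * shift q F n ≤ pow x n * D
  shift-bound {x} {D} 0≤x 0≤D zero    F n       h = ≤-trans (≤-reflexive (*-identityˡ (F n))) (h n ℕ.≤-refl)
  shift-bound {x} {D} 0≤x 0≤D (suc q) F zero    h = ≤-trans (≤-reflexive (*-zeroʳ (x * pow x q))) (0≤* 0≤1 0≤D)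
  shift-bound {x} {D} 0≤x 0≤D (suc q) F (suc n) h = begin
    x * pow x q * shift q F n     ≡⟨ *-assoc x (pow x q) _ ⟩
    x * (pow x q * shift q F n)   ≤⟨ *-monoˡ 0≤x (shift-bound 0≤x 0≤D q F n λ i i≤n → h i (ℕ.m≤n⇒m≤1+n i≤n)) ⟩
    x * (pow x n * D)             ≡⟨ *-assoc x (pow x n) D ⟨
    x * pow x n * D               ∎
    where open ≤-Reasoning

  partialSum-* : ∀ (t : ℕ → ℚ) y P → partialSum (λ p → t p * y) P ≡ partialSum t P * y
  partialSum-* t y zero    = sym (*-zeroˡ y)
  partialSum-* t y (suc P) = trans (cong (_+ t P * y) (partialSum-* t y P)) (sym (*-distribʳ-+ y (partialSum t P) (t P)))

  module _ (m : ℕ) .{{_ : NonZero m}} where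

    private
      x M : ℚ
      x = fromℕ m
      M = 4ℚ * x
      T : ℕ → ℚ
      T = treeCount {m}

    1≤x : 1ℚ ≤ x
    1≤x = fromℕ-mono (ℕ.>-nonZero⁻¹ m)

    0<x : 0ℚ < x
    0<x = <-≤-trans (positive⁻¹ 1ℚ) 1≤x

    0≤x : 0ℚ ≤ x
    0≤x = <⇒≤ 0<x

    0<M : 0ℚ < M
    0<M = 0<* {4ℚ} (positive⁻¹ 4ℚ) 0<x

    0≤M : 0ℚ ≤ M
    0≤M = <⇒≤ 0<M

    4≤M : 4ℚ ≤ M
    4≤M = subst (_≤ M) (*-identityʳ 4ℚ) (*-monoˡ 0≤4 1≤x)

    0<treeCount : ∀ n → 0ℚ < T n
    0<treeCount n = 0<* {x} 0<x (0<* {pow M n} (pow-positive 0<M n) (0<c n))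

    0≤treeCount : ∀ n → 0ℚ ≤ T n
    0≤treeCount n = <⇒≤ (0<treeCount n)

    -- The power of M depends on p + j only, so the sum over p reduces to a convolution of `c` and
    -- `b`. Since b 0 = 1, the convolution term yields half of the root occurrence at j = 0; the
    -- indicator term adds the other half.
    occurrenceTotal-eq : ∀ p j →
      T p * occurrenceTotal {m} p (p ℕ.+ j) ≡ ½ * (x * pow M (p ℕ.+ j)) * (c p * b j + ⟦ 0 ℕ.≟ j ⟧ * c p)
    occurrenceTotal-eq p zero rewrite ℕ.+-identityʳ p | shift-below p (markedCount {m}) =
      trans (cong (λ s → T p * (s + x * 0ℚ)) (⟦⟧-true (p ℕ.≟ p) refl))
      (solve 3 (λ x q c → x :* (q :* c) :* (con 1ℚ :+ x :* con 0ℚ)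
        := con ½ :* (x :* q) :* (c :* con 1ℚ :+ con 1ℚ :* c)) refl x (pow M p) (c p))
    occurrenceTotal-eq p (suc r) = begin
      T p * (⟦ p ℕ.≟ p ℕ.+ suc r ⟧ + x * shift (suc p) (markedCount {m}) (p ℕ.+ suc r))
        ≡⟨ cong₂ (λ s t → T p * (s + x * t)) (⟦⟧-false (p ℕ.≟ p ℕ.+ suc r) p≢)
             (trans (cong (shift (suc p) (markedCount {m})) (ℕ.+-suc p r)) (shift-offset (suc p) (markedCount {m}) r)) ⟩
      x * (pow M p * c p) * (0ℚ + x * (pow M r * (2ℚ * b (suc r))))
        ≡⟨ solve 5 (λ x q c s b → x :* (q :* c) :* (con 0ℚ :+ x :* (s :* (con 2ℚ :* b)))
             := con ½ :* (x :* (q :* (con 4ℚ :* x :* s))) :* (c :* b :+ con 0ℚ :* c))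
             refl x (pow M p) (c p) (pow M r) (b (suc r)) ⟩
      ½ * (x * (pow M p * pow M (suc r))) * (c p * b (suc r) + 0ℚ * c p)
        ≡⟨ cong (λ s → ½ * (x * s) * (c p * b (suc r) + 0ℚ * c p)) (pow-+ M p (suc r)) ⟨
      ½ * (x * pow M (p ℕ.+ suc r)) * (c p * b (suc r) + 0ℚ * c p) ∎
      where
      open ≡-Reasoning
      p≢ : p ≢ p ℕ.+ suc r
      p≢ eq = ℕ.m≢1+m+n p (trans eq (ℕ.+-suc p r))

    module _ (P K : ℕ) where

      private
        n : ℕ
        n = P ℕ.+ K
        N D : ℚ
        N = fromℕ n
        D = diag (λ i j → c (P ℕ.+ i) * b j) K

      offset-sum : ∀ i j → i ℕ.+ j ≡ K → n ≡ (P ℕ.+ i) ℕ.+ j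
      offset-sum i j eq = trans (cong (P ℕ.+_) (sym eq)) (sym (ℕ.+-assoc P i j))

      occurrenceTotal-tail : diag (λ i j → T (P ℕ.+ i) * occurrenceTotal {m} (P ℕ.+ i) n) K
        ≡ ½ * (x * pow M n) * (D + c n)
      occurrenceTotal-tail = begin
        diag (λ i j → T (P ℕ.+ i) * occurrenceTotal {m} (P ℕ.+ i) n) K
          ≡⟨ diag-cong K (λ i j eq → trans (cong (λ l → T (P ℕ.+ i) * occurrenceTotal {m} (P ℕ.+ i) l) (offset-sum i j eq))
               (trans (occurrenceTotal-eq (P ℕ.+ i) j)
                 (cong (λ l → ½ * (x * pow M l) * (c (P ℕ.+ i) * b j + ⟦ 0 ℕ.≟ j ⟧ * c (P ℕ.+ i))) (sym (offset-sum i j eq))))) ⟩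
        diag (λ i j → ½ * (x * pow M n) * (c (P ℕ.+ i) * b j + ⟦ 0 ℕ.≟ j ⟧ * c (P ℕ.+ i))) K
          ≡⟨ diag-* (½ * (x * pow M n)) _ K ⟩
        ½ * (x * pow M n) * diag (λ i j → c (P ℕ.+ i) * b j + ⟦ 0 ℕ.≟ j ⟧ * c (P ℕ.+ i)) K
          ≡⟨ cong (½ * (x * pow M n) *_) (diag-+ _ _ K) ⟩
        ½ * (x * pow M n) * (D + diag (λ i j → ⟦ 0 ℕ.≟ j ⟧ * c (P ℕ.+ i)) K)
          ≡⟨ cong (λ s → ½ * (x * pow M n) * (D + s))
               (trans (diag-flip _ K) (diag-⟦⟧ 0 (λ i → c (P ℕ.+ i)) K)) ⟩
        ½ * (x * pow M n) * (D + c n) ∎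
        where open ≡-Reasoning

      D-eq : (1ℚ + N) * D ≡ b P * d K
      D-eq = trans (cong (_* D) (trans (cong (1ℚ +_) (fromℕ-+ P K)) (sym (+-assoc 1ℚ (fromℕ P) (fromℕ K)))))
        (tail-c-b K P)

      -- The closed form together with b n = (1+n) c n. Trading `d K` for `d n` makes the result a
      -- multiple of `c n`, hence of the number of trees of size n.
      D-upper : D ≤ (1ℚ + (N + N)) * b P * c n
      D-upper = cancelˡ-≤ (0<1+fromℕ n) $ begin
        (1ℚ + N) * D                         ≡⟨ D-eq ⟩
        b P * d K                            ≤⟨ *-monoˡ (0≤b P) (d-mono (ℕ.m≤n+m K P)) ⟩
        b P * ((1ℚ + (N + N)) * b n)         ≡⟨ cong (λ s → b P * ((1ℚ + (N + N)) * s)) (c-b n) ⟨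
        b P * ((1ℚ + (N + N)) * ((1ℚ + N) * c n))
          ≡⟨ solve 4 (λ b s n c → b :* (s :* (n :* c)) := n :* (s :* b :* c)) refl (b P) (1ℚ + (N + N)) (1ℚ + N) (c n) ⟩
        (1ℚ + N) * ((1ℚ + (N + N)) * b P * c n) ∎
        where open ≤-Reasoning

      D-lower : (1ℚ + (fromℕ K + fromℕ K)) * b P * c n ≤ D
      D-lower = cancelˡ-≤ (0<1+fromℕ n) $ begin
        (1ℚ + N) * (s * b P * c n)  ≡⟨ solve 4 (λ b s n c → n :* (s :* b :* c) := b :* (s :* (n :* c))) refl (b P) s (1ℚ + N) (c n) ⟩
        b P * (s * ((1ℚ + N) * c n)) ≡⟨ cong (λ t → b P * (s * t)) (c-b n) ⟩
        b P * (s * b n)             ≤⟨ *-monoˡ (0≤b P) (*-monoˡ (0≤+ 0≤1 (0≤2x K)) (b-antitone (ℕ.m≤n+m K P))) ⟩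
        b P * (s * b K)             ≡⟨ D-eq ⟨
        (1ℚ + N) * D                ∎
        where
        open ≤-Reasoning
        s = 1ℚ + (fromℕ K + fromℕ K)

      average-upper : averageDagNodes m n ≤ partialSum T P + ½ * ((1ℚ + (N + N)) * b P + 1ℚ)
      average-upper = cancelʳ-≤ (0<treeCount n) $ begin
        averageDagNodes m n * T n
          ≡⟨ averageDagNodes-* m n ⟩
        diag (λ p _ → hits {m} n p) n
          ≤⟨ diag-offset-≤ (λ p _ → hits {m} n p) (λ p → T p * T n) P K (λ p _ → hits-≤-all {m} n p) ⟩
        partialSum (λ p → T p * T n) P + diag (λ i _ → hits {m} n (P ℕ.+ i)) K
          ≤⟨ +-mono (≤-reflexive (partialSum-* T (T n) P)) (diag-mono K λ i _ _ → hits-≤-occurrences {m} n (P ℕ.+ i)) ⟩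
        partialSum T P * T n + diag (λ i j → T (P ℕ.+ i) * occurrenceTotal {m} (P ℕ.+ i) n) K
          ≡⟨ cong (partialSum T P * T n +_) occurrenceTotal-tail ⟩
        partialSum T P * T n + ½ * (x * pow M n) * (D + c n)
          ≤⟨ +-monoʳ-≤ (partialSum T P * T n) (*-monoˡ (0≤* 0≤½ (0≤* 0≤x (pow-nonNegative 0≤M n))) (+-monoˡ-≤ (c n) D-upper)) ⟩
        partialSum T P * T n + ½ * (x * pow M n) * ((1ℚ + (N + N)) * b P * c n + c n)
          ≡⟨ solve 5 (λ s x p e c → s :* (x :* (p :* c)) :+ con ½ :* (x :* p) :* (e :* c :+ c)
               := (s :+ con ½ :* (e :+ con 1ℚ)) :* (x :* (p :* c)))
               refl (partialSum T P) x (pow M n) ((1ℚ + (N + N)) * b P) (c n) ⟩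
        (partialSum T P + ½ * ((1ℚ + (N + N)) * b P + 1ℚ)) * T n ∎
        where open ≤-Reasoning

      -- Here w = 1/(4m). Two shifts by p+1 give w^(2p+2), the trees of size p give M^p, so the
      -- pairs decay like w^p.
      pairSum-bound : ∀ {w} → M * w ≡ 1ℚ → 0ℚ ≤ w → ∀ p →
        T p * pairTotal {m} p n ≤ T n * (1ℚ + (N + N)) * (1ℚ + N) * (x * w * w) * (pow w p * c p)
      pairSum-bound {w} Mw 0≤w p = begin
        T p * (x * Σₚ)
          ≡⟨ combine ((T p * x * Σₚ) * ((M * (pow M p)) * (w * pow w p) + 1ℚ)) (sym Pw)
               (solve 5 (λ t x s P W → t :* (x :* s) :- t :* x :* (W :* W) :* (P :* (P :* s))
                 := t :* x :* s :* (P :* W :+ con 1ℚ) :* (con 1ℚ :- P :* W)) refl (T p) x Σₚ (pow M (suc p)) (pow w (suc p))) ⟩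
        T p * x * (pow w (suc p) * pow w (suc p)) * (pow M (suc p) * (pow M (suc p) * Σₚ))
          ≤⟨ *-monoˡ (0≤* (0≤* (0≤treeCount p) 0≤x) (0≤* (pow-nonNegative 0≤w (suc p)) (pow-nonNegative 0≤w (suc p)))) bound ⟩
        T p * x * (pow w (suc p) * pow w (suc p)) * (pow M n * d n)
          ≡⟨ cong (λ s → T p * x * (pow w (suc p) * pow w (suc p)) * (pow M n * ((1ℚ + (N + N)) * s))) (c-b n) ⟨
        x * (pow M p * c p) * x * (w * pow w p * (w * pow w p)) * (pow M n * ((1ℚ + (N + N)) * ((1ℚ + N) * c n)))
          ≡⟨ combine (x * x * c p * w * w * pow w p * (pow M n * ((1ℚ + (N + N)) * ((1ℚ + N) * c n)))) (pow-inverse {M} {w} Mw p)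
               (solve 9 (λ x P cp w W Q s r c →
                  x :* (P :* cp) :* x :* (w :* W :* (w :* W)) :* (Q :* (s :* (r :* c)))
                    :- x :* (Q :* c) :* s :* r :* (x :* w :* w) :* (W :* cp)
                  := x :* x :* cp :* w :* w :* W :* (Q :* (s :* (r :* c))) :* (P :* W :- con 1ℚ))
                refl x (pow M p) (c p) w (pow w p) (pow M n) (1ℚ + (N + N)) (1ℚ + N) (c n)) ⟩
        T n * (1ℚ + (N + N)) * (1ℚ + N) * (x * w * w) * (pow w p * c p) ∎
        where
        open ≤-Reasoning
        Σₚ = shift (suc p) (shift (suc p) (pairCount {m})) n
        Pw : pow M (suc p) * pow w (suc p) ≡ 1ℚ
        Pw = pow-inverse {M} {w} Mw (suc p)
        0≤d : 0ℚ ≤ d n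
        0≤d = ≤-trans 0≤1 (1≤d n)
        bound : pow M (suc p) * (pow M (suc p) * Σₚ) ≤ pow M n * d n
        bound = subst (λ s → pow M (suc p) * s ≤ pow M n * d n) (shift-* (suc p) (pow M (suc p)) _ n) $
          shift-bound 0≤M 0≤d (suc p) _ n λ i i≤n → shift-bound 0≤M 0≤d (suc p) (pairCount {m}) i λ j j≤i →
            *-monoˡ (pow-nonNegative 0≤M j) (d-mono (ℕ.≤-trans j≤i i≤n))

      -- A geometric series from P on. The number of pairs is quadratic in N, and N w^P ≤ 1, that is
      -- n ≤ (4m)^P, pays for one of the two factors N.
      pairTotal-tail : ∀ {w} → M * w ≡ 1ℚ → 0ℚ ≤ w → N * pow w P ≤ 1ℚ → 1ℚ ≤ N →
        diag (λ i _ → T (P ℕ.+ i) * pairTotal {m} (P ℕ.+ i) n) K ≤ T n * (N * c P)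
      pairTotal-tail {w} Mw 0≤w Nw 1≤N = begin
        diag (λ i _ → T (P ℕ.+ i) * pairTotal {m} (P ℕ.+ i) n) K
          ≤⟨ diag-mono K (λ i _ _ → ≤-trans (pairSum-bound Mw 0≤w (P ℕ.+ i)) (*-monoˡ 0≤A (term i))) ⟩
        diag (λ i _ → A * (pow w P * c P * pow w i)) K
          ≡⟨ trans (diag-* A _ K) (cong (A *_) (diag-* (pow w P * c P) _ K)) ⟩
        A * (pow w P * c P * diag (λ i _ → pow w i) K)
          ≤⟨ *-monoˡ 0≤A (*-monoˡ (0≤* 0≤W (0≤c P)) (geometric 0≤w (≤-trans w≤¼ (≤ᵇ⇒≤ _)) K)) ⟩
        T n * (1ℚ + (N + N)) * (1ℚ + N) * (x * w * w) * (pow w P * c P * 2ℚ)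
          ≡⟨ combine (½ * w * T n * (1ℚ + (N + N)) * (1ℚ + N) * (pow w P * c P)) Mw
               (solve 7 (λ t s r x w W c → t :* s :* r :* (x :* w :* w) :* (W :* c :* con 2ℚ)
                   :- t :* s :* r :* W :* c :* (con ½ :* w)
                 := con ½ :* w :* t :* s :* r :* (W :* c) :* (con 4ℚ :* x :* w :- con 1ℚ))
               refl (T n) (1ℚ + (N + N)) (1ℚ + N) x w (pow w P) (c P)) ⟩
        T n * (1ℚ + (N + N)) * (1ℚ + N) * pow w P * c P * (½ * w)
          ≤⟨ *-monoˡ (0≤* (0≤* (0≤* (0≤* (0≤treeCount n) 0≤s) 0≤r) 0≤W) (0≤c P)) (*-monoˡ 0≤½ w≤¼) ⟩
        T n * (1ℚ + (N + N)) * (1ℚ + N) * pow w P * c P * (½ * (½ * ½))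
          -- As 1 ≤ N, the two linear factors are at most 3N and 2N; with the factor 1/8 this gives
          -- 6/8 = ½ + ½ * ½ ≤ 1.
          ≤⟨ *-monoʳ (<⇒≤ (positive⁻¹ (½ * (½ * ½)))) (*-monoʳ (0≤c P) (*-monoʳ 0≤W (*-mono (0≤* (0≤treeCount n) (0≤* (0≤+ 0≤1 0≤2) 0≤N)) 0≤r
               (*-monoˡ (0≤treeCount n) s≤) r≤))) ⟩
        T n * ((1ℚ + 2ℚ) * N) * (2ℚ * N) * pow w P * c P * (½ * (½ * ½))
          ≡⟨ solve 4 (λ t n W c → t :* ((con 1ℚ :+ con 2ℚ) :* n) :* (con 2ℚ :* n) :* W :* c :* con (½ * (½ * ½))
               := t :* (n :* W :* (n :* c)) :* con (½ + ½ * ½)) refl (T n) N (pow w P) (c P) ⟩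
        T n * (N * pow w P * (N * c P)) * (½ + ½ * ½)
          ≤⟨ *-mono 0≤end (<⇒≤ (positive⁻¹ (½ + ½ * ½)))
               (*-monoˡ (0≤treeCount n) (*-monoʳ (0≤* 0≤N (0≤c P)) Nw)) (≤ᵇ⇒≤ {½ + ½ * ½} {1ℚ} _) ⟩
        T n * (1ℚ * (N * c P)) * 1ℚ
          ≡⟨ solve 2 (λ t e → t :* (con 1ℚ :* e) :* con 1ℚ := t :* e) refl (T n) (N * c P) ⟩
        T n * (N * c P) ∎
        where
        open ≤-Reasoning
        A = T n * (1ℚ + (N + N)) * (1ℚ + N) * (x * w * w)
        0≤N = 0≤fromℕ n
        0≤s : 0ℚ ≤ 1ℚ + (N + N)
        0≤s = 0≤+ 0≤1 (0≤+ 0≤N 0≤N)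
        0≤r : 0ℚ ≤ 1ℚ + N
        0≤r = 0≤+ 0≤1 0≤N
        0≤W = pow-nonNegative 0≤w P
        0≤A : 0ℚ ≤ A
        0≤A = 0≤* (0≤* (0≤* (0≤treeCount n) 0≤s) 0≤r) (0≤* (0≤* 0≤x 0≤w) 0≤w)
        0≤end : 0ℚ ≤ T n * (1ℚ * (N * c P))
        0≤end = 0≤* (0≤treeCount n) (0≤* 0≤1 (0≤* 0≤N (0≤c P)))
        s≤ : 1ℚ + (N + N) ≤ (1ℚ + 2ℚ) * N
        s≤ = subst (1ℚ + (N + N) ≤_) (solve 1 (λ n → n :+ (n :+ n) := con (1ℚ + 2ℚ) :* n) refl N) (+-monoˡ-≤ (N + N) 1≤N)
        r≤ : 1ℚ + N ≤ 2ℚ * N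
        r≤ = subst (1ℚ + N ≤_) (solve 1 (λ n → n :+ n := con 2ℚ :* n) refl N) (+-monoˡ-≤ N 1≤N)
        w≤¼ : w ≤ ½ * ½
        w≤¼ = begin
          w                     ≡⟨ solve 1 (λ w → w := con (½ * ½) :* (con 4ℚ :* w)) refl w ⟩
          ½ * ½ * (4ℚ * w)      ≤⟨ *-monoˡ (<⇒≤ (positive⁻¹ (½ * ½))) (*-monoʳ 0≤w 4≤M) ⟩
          ½ * ½ * (M * w)       ≡⟨ cong (½ * ½ *_) Mw ⟩
          ½ * ½ * 1ℚ            ≡⟨ refl ⟩
          ½ * ½                 ∎
        term : ∀ i → pow w (P ℕ.+ i) * c (P ℕ.+ i) ≤ pow w P * c P * pow w i
        term i = begin
          pow w (P ℕ.+ i) * c (P ℕ.+ i)   ≤⟨ *-monoˡ (pow-nonNegative 0≤w (P ℕ.+ i)) (c-antitone (ℕ.m≤m+n P i)) ⟩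
          pow w (P ℕ.+ i) * c P           ≡⟨ cong (_* c P) (pow-+ w P i) ⟩
          pow w P * pow w i * c P         ≡⟨ solve 3 (λ a b c → a :* b :* c := a :* c :* b) refl (pow w P) (pow w i) (c P) ⟩
          pow w P * c P * pow w i         ∎

      -- Only the factor K = n - P is obtained here; the missing P b P is absorbed in the error
      -- later.
      average-lower : 1ℚ ≤ N → N ≤ pow M P → fromℕ K * b P ≤ averageDagNodes m n + N * c P
      average-lower 1≤N N≤ = cancelˡ-≤ (0<treeCount n) $ begin
        T n * (fromℕ K * b P)
          ≤⟨ by-difference (½ * (x * pow M n) * (b P * c n + c n))
               (0≤* (0≤* 0≤½ (0≤* 0≤x (pow-nonNegative 0≤M n))) (0≤+ (0≤* (0≤b P) (0≤c n)) (0≤c n)))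
               (solve 5 (λ x p k b c → con ½ :* (x :* p) :* ((con 1ℚ :+ (k :+ k)) :* b :* c :+ c) :- x :* (p :* c) :* (k :* b)
                 := con ½ :* (x :* p) :* (b :* c :+ c)) refl x (pow M n) (fromℕ K) (b P) (c n)) ⟩
        ½ * (x * pow M n) * ((1ℚ + (fromℕ K + fromℕ K)) * b P * c n + c n)
          ≤⟨ *-monoˡ (0≤* 0≤½ (0≤* 0≤x (pow-nonNegative 0≤M n))) (+-monoˡ-≤ (c n) D-lower) ⟩
        ½ * (x * pow M n) * (D + c n)
          ≡⟨ occurrenceTotal-tail ⟨
        diag (λ i j → T (P ℕ.+ i) * occurrenceTotal {m} (P ℕ.+ i) n) K
          ≤⟨ diag-mono K (λ i _ _ → occurrences-≤-hits {m} n (P ℕ.+ i)) ⟩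
        diag (λ i _ → hits {m} n (P ℕ.+ i) + T (P ℕ.+ i) * pairTotal {m} (P ℕ.+ i) n) K
          ≡⟨ diag-+ _ _ K ⟩
        diag (λ i _ → hits {m} n (P ℕ.+ i)) K + diag (λ i _ → T (P ℕ.+ i) * pairTotal {m} (P ℕ.+ i) n) K
          ≤⟨ +-mono (diag-offset-≥ (λ p _ → hits {m} n p) P K (λ p _ → 0≤hits {m} n p)) (tail (inverse-positive M 0<M)) ⟩
        diag (λ p _ → hits {m} n p) n + T n * (N * c P)
          ≡⟨ cong (_+ T n * (N * c P)) (trans (sym (averageDagNodes-* m n)) (*-comm (averageDagNodes m n) (T n))) ⟩
        T n * averageDagNodes m n + T n * (N * c P)
          ≡⟨ *-distribˡ-+ (T n) (averageDagNodes m n) (N * c P) ⟨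
        T n * (averageDagNodes m n + N * c P) ∎
        where
        open ≤-Reasoning
        tail : ∃[ w ] M * w ≡ 1ℚ × 0ℚ < w →
          diag (λ i _ → T (P ℕ.+ i) * pairTotal {m} (P ℕ.+ i) n) K ≤ T n * (N * c P)
        tail (w , Mw , 0<w) = pairTotal-tail Mw (<⇒≤ 0<w)
          (≤-trans (*-monoʳ (pow-nonNegative (<⇒≤ 0<w) P) N≤) (≤-reflexive (pow-inverse {M} {w} Mw P))) 1≤N

    -- The ratio of consecutive counts is 4m(2y+1)/(2y+4). It is 2m at y = 1 and grows with y, but
    -- only m at y = 0, so the doubling starts at size 1.
    treeCount-doubles : ∀ p → T (suc p) + T (suc p) ≤ T (suc (suc p))
    treeCount-doubles p = cancelˡ-≤ {4ℚ + (y + y)} (<-≤-trans (positive⁻¹ 4ℚ) (≤+ 4ℚ (0≤2x (suc p)))) $ begin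
      (4ℚ + (y + y)) * (x * (Q * c₁) + x * (Q * c₁))
        ≤⟨ by-difference (x * (Q * c₁) * (4ℚ * fromℕ p))
             (0≤* (0≤* 0≤x (0≤* (pow-nonNegative 0≤M (suc p)) (0≤c (suc p)))) (0≤* 0≤4 (0≤fromℕ p)))
             (trans (cong (λ y → 4ℚ * x * Q * ((1ℚ + (y + y)) * c₁) - (4ℚ + (y + y)) * (x * (Q * c₁) + x * (Q * c₁))) (fromℕ-suc p))
               (solve 4 (λ x Q c y → con 4ℚ :* x :* Q :* ((con 1ℚ :+ ((con 1ℚ :+ y) :+ (con 1ℚ :+ y))) :* c)
                   :- (con 4ℚ :+ ((con 1ℚ :+ y) :+ (con 1ℚ :+ y))) :* (x :* (Q :* c) :+ x :* (Q :* c))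
                 := x :* (Q :* c) :* (con 4ℚ :* y)) refl x Q c₁ (fromℕ p))) ⟩
      4ℚ * x * Q * ((1ℚ + (y + y)) * c₁)
        ≤⟨ *-monoʳ (0≤* (0≤+ 0≤1 (0≤2x (suc p))) (0≤c (suc p))) (*-monoʳ (pow-nonNegative 0≤M (suc p))
             (subst (4ℚ * x ≤_) (*-comm M x) (*-monoʳ 0≤x 4≤M))) ⟩
      x * M * Q * ((1ℚ + (y + y)) * c₁)
        ≡⟨ cong (x * M * Q *_) (c-step (suc p)) ⟨
      x * M * Q * ((4ℚ + (y + y)) * c (suc (suc p)))
        ≡⟨ solve 5 (λ x M Q s c → x :* M :* Q :* (s :* c) := s :* (x :* (M :* Q :* c))) refl x M Q (4ℚ + (y + y)) (c (suc (suc p))) ⟩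
      (4ℚ + (y + y)) * T (suc (suc p)) ∎
      where
      open ≤-Reasoning
      y = fromℕ (suc p)
      Q = pow M (suc p)
      c₁ = c (suc p)

    -- Doubling makes the sum of all earlier counts at most the next one. The step from size 0 to
    -- size 1, where doubling may fail, is checked directly as m ≤ m².
    partialSum-treeCount : ∀ P → partialSum T P ≤ T P
    partialSum-treeCount zero          = 0≤treeCount 0
    partialSum-treeCount (suc zero)    = begin
      0ℚ + x * (1ℚ * 1ℚ)          ≡⟨ solve 1 (λ x → con 0ℚ :+ x :* (con 1ℚ :* con 1ℚ) := con (½ * ½) :* con 4ℚ :* x) refl x ⟩
      ½ * ½ * 4ℚ * x               ≤⟨ *-monoʳ 0≤x (*-monoˡ (<⇒≤ (positive⁻¹ (½ * ½))) 4≤M) ⟩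
      ½ * ½ * M * x                ≡⟨ solve 2 (λ M x → con (½ * ½) :* M :* x := x :* (M :* con 1ℚ :* con (c 1))) refl M x ⟩
      T 1                          ∎
      where open ≤-Reasoning
    partialSum-treeCount (suc (suc P)) = ≤-trans (+-monoˡ-≤ (T (suc P)) (partialSum-treeCount (suc P))) (treeCount-doubles P)

-- Choice of P and the resulting rational estimate with relative error E/P.

module Estimates where

  open import Data.Rational hiding (NonZero)
  open import Data.Rational.Properties
  open ℚ-Lemmas
  open DiagonalSums
  open CentralBinomials
  open ForestSums
  open Counting
  open Dags
  open AverageBounds

  logarithm : ∀ a n → 2 ℕ.≤ a → 1 ℕ.≤ n → ∃[ k ] (a ℕ.^ k ℕ.≤ n × n ℕ.< a ℕ.^ suc k)
  logarithm a (suc zero)    2≤a _ = 0 , ℕ.≤-refl , subst (2 ℕ.≤_) (sym (ℕ.*-identityʳ a)) 2≤a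
  logarithm a (suc (suc n)) 2≤a _ with logarithm a (suc n) 2≤a (s≤s z≤n)
  ... | k , lo , hi with ℕ.m≤n⇒m<n∨m≡n hi
  ...   | inj₁ hi′ = k , ℕ.m≤n⇒m≤1+n lo , hi′
  ...   | inj₂ eq  = suc k , ℕ.≤-reflexive (sym eq) , subst (ℕ._< a ℕ.^ suc (suc k)) (sym eq) grow
    where
    grow : a ℕ.^ suc k ℕ.< a ℕ.* a ℕ.^ suc k
    grow = ℕ.<-≤-trans (subst (a ℕ.^ suc k ℕ.<_) (cong (a ℕ.^ suc k ℕ.+_) (sym (ℕ.+-identityʳ _)))
      (ℕ.m<m+n (a ℕ.^ suc k) (ℕ.≤-trans (s≤s z≤n) (ℕ.≤-reflexive eq))))
      (ℕ.*-monoˡ-≤ (a ℕ.^ suc k) 2≤a)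

  -- Guarantees P = k + 1 ≤ n, so that n splits as P + K.
  exponent-bound : ∀ a k → 2 ℕ.≤ a → suc k ℕ.≤ a ℕ.^ k
  exponent-bound a zero    2≤a = ℕ.≤-refl
  exponent-bound a (suc k) 2≤a = begin
    suc (suc k)                 ≤⟨ s≤s (ℕ.m≤n+m (suc k) k) ⟩
    suc k ℕ.+ suc k             ≡⟨ cong (suc k ℕ.+_) (ℕ.+-identityʳ (suc k)) ⟨
    2 ℕ.* suc k                 ≤⟨ ℕ.*-mono-≤ 2≤a (exponent-bound a k 2≤a) ⟩
    a ℕ.* a ℕ.^ k               ∎
    where open ℕ.≤-Reasoning

  pow-fromℕ : ∀ a k → pow (fromℕ a) k ≡ fromℕ (a ℕ.^ k)
  pow-fromℕ a zero    = refl
  pow-fromℕ a (suc k) = trans (cong (fromℕ a *_) (pow-fromℕ a k)) (sym (fromℕ-* a (a ℕ.^ k)))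

  pow-mono : ∀ {x y} → 0ℚ ≤ x → x ≤ y → ∀ n → pow x n ≤ pow y n
  pow-mono 0≤x x≤y zero    = ≤-refl
  pow-mono 0≤x x≤y (suc n) = *-mono (≤-trans 0≤x x≤y) (pow-nonNegative 0≤x n) x≤y (pow-mono 0≤x x≤y n)

  -- Sharp at k = 0. It yields 2P(P+1) ≤ 4^P ≤ 4m n, by which the terms without a factor n are
  -- absorbed into n c P.
  quadratic-≤-pow : ∀ k → 2ℚ * ((1ℚ + fromℕ k) * (2ℚ + fromℕ k)) ≤ pow 4ℚ (suc k)
  quadratic-≤-pow zero    = ≤ᵇ⇒≤ _
  quadratic-≤-pow (suc k) = begin
    2ℚ * ((1ℚ + fromℕ (suc k)) * (2ℚ + fromℕ (suc k)))
      ≡⟨ cong (λ y → 2ℚ * ((1ℚ + y) * (2ℚ + y))) (fromℕ-suc k) ⟩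
    2ℚ * ((1ℚ + (1ℚ + y)) * (2ℚ + (1ℚ + y)))
      ≤⟨ by-difference (2ℚ * ((2ℚ + y) * (1ℚ + (y + (y + y)))))
           (0≤* 0≤2 (0≤* (0≤+ 0≤2 0≤y) (0≤+ 0≤1 (0≤+ 0≤y (0≤+ 0≤y 0≤y)))))
           (solve 1 (λ y → con 4ℚ :* (con 2ℚ :* ((con 1ℚ :+ y) :* (con 2ℚ :+ y)))
               :- con 2ℚ :* ((con 1ℚ :+ (con 1ℚ :+ y)) :* (con 2ℚ :+ (con 1ℚ :+ y)))
             := con 2ℚ :* ((con 2ℚ :+ y) :* (con 1ℚ :+ (y :+ (y :+ y))))) refl y) ⟩
    4ℚ * (2ℚ * ((1ℚ + y) * (2ℚ + y)))
      ≤⟨ *-monoˡ 0≤4 (quadratic-≤-pow k) ⟩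
    4ℚ * pow 4ℚ (suc k) ∎
    where
    open ≤-Reasoning
    y = fromℕ k
    0≤y = 0≤fromℕ k

  module _ (m : ℕ) .{{_ : NonZero m}} where

    private
      x M : ℚ
      x = fromℕ m
      M = 4ℚ * x

    -- The part 4m² comes from the trees of size below P, at most m (4m)^P c P ≤ 4m² n c P in
    -- number; the part 4m from the constant terms of the upper bound. The lower bound needs only 2m
    -- + 1.
    errorConstant : ℚ
    errorConstant = 4ℚ * x * x + 4ℚ * x

    module _ (k K : ℕ) where

      private
        P n : ℕ
        P = suc k
        n = P ℕ.+ K
        N p : ℚ
        N = fromℕ n
        p = fromℕ P

      module _ (lo : pow M k ≤ N) (hi : N ≤ pow M P) where

        private
          A = averageDagNodes m n
          E = errorConstant
          0≤N = 0≤fromℕ n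
          0≤Nc : 0ℚ ≤ N * c P
          0≤Nc = 0≤* 0≤N (0≤c P)

        1≤N : 1ℚ ≤ N
        1≤N = fromℕ-mono {1} {n} (s≤s z≤n)

        quadratic : 2ℚ * (p * (1ℚ + p)) ≤ M * N
        quadratic = begin
          2ℚ * (p * (1ℚ + p))
            ≡⟨ cong (λ p → 2ℚ * (p * (1ℚ + p))) (fromℕ-suc k) ⟩
          2ℚ * ((1ℚ + fromℕ k) * (1ℚ + (1ℚ + fromℕ k)))
            ≡⟨ solve 1 (λ y → con 2ℚ :* ((con 1ℚ :+ y) :* (con 1ℚ :+ (con 1ℚ :+ y)))
                 := con 2ℚ :* ((con 1ℚ :+ y) :* (con 2ℚ :+ y))) refl (fromℕ k) ⟩
          2ℚ * ((1ℚ + fromℕ k) * (2ℚ + fromℕ k))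
            ≤⟨ ≤-trans (quadratic-≤-pow k) (pow-mono 0≤4 (4≤M m) P) ⟩
          M * pow M k
            ≤⟨ *-monoˡ (0≤M m) lo ⟩
          M * N ∎
          where open ≤-Reasoning

        1≤MNc : 1ℚ ≤ M * N * c P
        1≤MNc = begin
          1ℚ                            ≤⟨ 1≤d k ⟩
          d k                           ≡⟨ d-b k ⟨
          (2ℚ + (fromℕ k + fromℕ k)) * b P
            ≡⟨ solve 2 (λ y b → (con 2ℚ :+ (y :+ y)) :* b := con 2ℚ :* (con 1ℚ :+ y) :* b) refl (fromℕ k) (b P) ⟩
          2ℚ * (1ℚ + fromℕ k) * b P     ≡⟨ cong₂ (λ s t → 2ℚ * s * t) (fromℕ-suc k) (c-b P) ⟨
          2ℚ * p * ((1ℚ + p) * c P)     ≡⟨ solve 3 (λ p q c → con 2ℚ :* p :* (q :* c) := con 2ℚ :* (p :* q) :* c) refl p (1ℚ + p) (c P) ⟩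
          2ℚ * (p * (1ℚ + p)) * c P     ≤⟨ *-monoʳ (0≤c P) quadratic ⟩
          M * N * c P                   ∎
          where open ≤-Reasoning

        average-≤ : A ≤ N * b P + E * (N * c P)
        average-≤ = begin
          A
            ≤⟨ average-upper m P K ⟩
          partialSum (treeCount {m}) P + ½ * ((1ℚ + (N + N)) * b P + 1ℚ)
            ≤⟨ +-mono (≤-trans (partialSum-treeCount m P) trees-≤) half-≤ ⟩
          4ℚ * x * x * (N * c P) + (N * b P + M * N * c P)
            ≡⟨ solve 4 (λ x N c b → con 4ℚ :* x :* x :* (N :* c) :+ (N :* b :+ con 4ℚ :* x :* N :* c)
                 := N :* b :+ (con 4ℚ :* x :* x :+ con 4ℚ :* x) :* (N :* c)) refl x N (c P) (b P) ⟩
          N * b P + E * (N * c P) ∎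
          where
          open ≤-Reasoning
          trees-≤ : treeCount {m} P ≤ 4ℚ * x * x * (N * c P)
          trees-≤ = begin
            x * (M * pow M k * c P)     ≤⟨ *-monoˡ (0≤x m) (*-monoʳ (0≤c P) (*-monoˡ (0≤M m) lo)) ⟩
            x * (M * N * c P)           ≡⟨ solve 3 (λ x N c → x :* (con 4ℚ :* x :* N :* c) := con 4ℚ :* x :* x :* (N :* c)) refl x N (c P) ⟩
            4ℚ * x * x * (N * c P)      ∎
          half-≤ : ½ * ((1ℚ + (N + N)) * b P + 1ℚ) ≤ N * b P + M * N * c P
          half-≤ = begin
            ½ * ((1ℚ + (N + N)) * b P + 1ℚ)   ≡⟨ solve 2 (λ N b → con ½ :* ((con 1ℚ :+ (N :+ N)) :* b :+ con 1ℚ)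
                                                   := N :* b :+ con ½ :* (b :+ con 1ℚ)) refl N (b P) ⟩
            N * b P + ½ * (b P + 1ℚ)          ≤⟨ +-monoʳ-≤ (N * b P) (*-monoˡ 0≤½ (+-monoˡ-≤ 1ℚ (b-antitone {0} {P} z≤n))) ⟩
            N * b P + ½ * (1ℚ + 1ℚ)           ≤⟨ +-monoʳ-≤ (N * b P) 1≤MNc ⟩
            N * b P + M * N * c P             ∎

        average-≥ : N * b P ≤ A + E * (N * c P)
        average-≥ = begin
          N * b P
            ≡⟨ cong (_* b P) (fromℕ-+ P K) ⟩
          (p + fromℕ K) * b P
            ≡⟨ *-distribʳ-+ (b P) p (fromℕ K) ⟩
          p * b P + fromℕ K * b P
            ≤⟨ +-mono pb≤ (average-lower m P K 1≤N hi) ⟩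
          2ℚ * x * (N * c P) + (A + N * c P)
            ≤⟨ by-difference ((4ℚ * x * x + x) * (N * c P) + (x - 1ℚ) * (N * c P))
                 (0≤+ (0≤* (0≤+ (0≤* (0≤* 0≤4 (0≤x m)) (0≤x m)) (0≤x m)) 0≤Nc)
                   (0≤* (subst (_≤ x - 1ℚ) (+-inverseʳ 1ℚ) (+-monoˡ-≤ (- 1ℚ) (1≤x m))) 0≤Nc))
                 (solve 3 (λ x a t → a :+ (con 4ℚ :* x :* x :+ con 4ℚ :* x) :* t :- (con 2ℚ :* x :* t :+ (a :+ t))
                   := (con 4ℚ :* x :* x :+ x) :* t :+ (x :- con 1ℚ) :* t) refl x A (N * c P)) ⟩
          A + E * (N * c P) ∎
          where
          open ≤-Reasoning
          pb≤ : p * b P ≤ 2ℚ * x * (N * c P)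
          pb≤ = begin
            p * b P                        ≡⟨ cong (p *_) (c-b P) ⟨
            p * ((1ℚ + p) * c P)           ≡⟨ solve 2 (λ p c → p :* ((con 1ℚ :+ p) :* c)
                                                := con ½ :* (con 2ℚ :* (p :* (con 1ℚ :+ p)) :* c)) refl p (c P) ⟩
            ½ * (2ℚ * (p * (1ℚ + p)) * c P) ≤⟨ *-monoˡ 0≤½ (*-monoʳ (0≤c P) quadratic) ⟩
            ½ * (M * N * c P)              ≡⟨ solve 3 (λ x N c → con ½ :* (con 4ℚ :* x :* N :* c) := con 2ℚ :* x :* (N :* c)) refl x N (c P) ⟩
            2ℚ * x * (N * c P)             ∎

        0≤E : 0ℚ ≤ E
        0≤E = 0≤+ (0≤* (0≤* 0≤4 (0≤x m)) (0≤x m)) (0≤* 0≤4 (0≤x m))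

        -- This is the gain of a factor 1/P: after multiplication by p, an error of E n c P is at
        -- most E times the main term n b P.
        pc≤b : p * c P ≤ b P
        pc≤b = ≤-trans (*-monoʳ (0≤c P) (subst (_≤ 1ℚ + p) (+-identityˡ p) (+-monoˡ-≤ p 0≤1))) (≤-reflexive (c-b P))

        estimate-≤ : p * A ≤ N * b P * (p + E)
        estimate-≤ = begin
          p * A                                 ≤⟨ *-monoˡ (0≤fromℕ P) average-≤ ⟩
          p * (N * b P + E * (N * c P))         ≡⟨ solve 5 (λ p N b E c → p :* (N :* b :+ E :* (N :* c))
                                                     := p :* (N :* b) :+ E :* N :* (p :* c)) refl p N (b P) E (c P) ⟩
          p * (N * b P) + E * N * (p * c P)     ≤⟨ +-monoʳ-≤ (p * (N * b P)) (*-monoˡ (0≤* 0≤E 0≤N) pc≤b) ⟩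
          p * (N * b P) + E * N * b P           ≡⟨ solve 4 (λ p N b E → p :* (N :* b) :+ E :* N :* b := N :* b :* (p :+ E)) refl p N (b P) E ⟩
          N * b P * (p + E)                     ∎
          where open ≤-Reasoning

        estimate-≥ : N * b P * (p - E) ≤ p * A
        estimate-≥ = begin
          N * b P * (p - E)                     ≡⟨ solve 4 (λ p N b E → N :* b :* (p :- E) := p :* (N :* b) :- E :* N :* b) refl p N (b P) E ⟩
          p * (N * b P) - E * N * b P           ≤⟨ +-monoˡ-≤ (- (E * N * b P)) (*-monoˡ (0≤fromℕ P) average-≥) ⟩
          p * (A + E * (N * c P)) - E * N * b P ≡⟨ solve 6 (λ p A N b E c → p :* (A :+ E :* (N :* c)) :- E :* N :* b
                                                     := p :* A :+ E :* N :* (p :* c) :- E :* N :* b) refl p A N (b P) E (c P) ⟩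
          p * A + E * N * (p * c P) - E * N * b P ≤⟨ +-monoˡ-≤ (- (E * N * b P)) (+-monoʳ-≤ (p * A) (*-monoˡ (0≤* 0≤E 0≤N) pc≤b)) ⟩
          p * A + E * N * b P - E * N * b P     ≡⟨ solve 2 (λ a e → a :+ e :- e := a) refl (p * A) (E * N * b P) ⟩
          p * A                                 ∎
          where open ≤-Reasoning

    Estimate : ℕ → Set
    Estimate n = Σ ℕ λ k → (4 ℕ.* m) ℕ.^ k ℕ.≤ n × n ℕ.≤ (4 ℕ.* m) ℕ.^ suc k
      × fromℕ (suc k) * averageDagNodes m n ≤ fromℕ n * b (suc k) * (fromℕ (suc k) + errorConstant)
      × fromℕ n * b (suc k) * (fromℕ (suc k) - errorConstant) ≤ fromℕ (suc k) * averageDagNodes m n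

    estimate : ∀ n → 1 ℕ.≤ n → Estimate n
    estimate n 1≤n = from (logarithm (4 ℕ.* m) n 2≤4m 1≤n)
      where
      2≤4m : 2 ℕ.≤ 4 ℕ.* m
      2≤4m = ℕ.≤-trans (s≤s (s≤s z≤n)) (ℕ.*-monoʳ-≤ 4 (ℕ.>-nonZero⁻¹ m))
      power : ∀ j → fromℕ ((4 ℕ.* m) ℕ.^ j) ≡ pow M j
      power j = trans (sym (pow-fromℕ (4 ℕ.* m) j)) (cong (λ y → pow y j) (fromℕ-* 4 m))
      from : ∃[ k ] ((4 ℕ.* m) ℕ.^ k ℕ.≤ n × n ℕ.< (4 ℕ.* m) ℕ.^ suc k) → Estimate n
      from (k , lo , hi) = k , lo , ℕ.<⇒≤ hi , subst Bounds sk+K≡n (estimate-≤ k K lo′ hi′ , estimate-≥ k K lo′ hi′)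
        where
        K = n ℕ.∸ suc k
        Bounds : ℕ → Set
        Bounds n = fromℕ (suc k) * averageDagNodes m n ≤ fromℕ n * b (suc k) * (fromℕ (suc k) + errorConstant)
          × fromℕ n * b (suc k) * (fromℕ (suc k) - errorConstant) ≤ fromℕ (suc k) * averageDagNodes m n
        sk+K≡n : suc k ℕ.+ K ≡ n
        sk+K≡n = ℕ.m+[n∸m]≡n (ℕ.≤-trans (exponent-bound (4 ℕ.* m) k 2≤4m) lo)
        lo′ : pow M k ≤ fromℕ (suc k ℕ.+ K)
        lo′ = subst₂ (λ a l → a ≤ fromℕ l) (power k) (sym sk+K≡n) (fromℕ-mono lo)
        hi′ : fromℕ (suc k ℕ.+ K) ≤ pow M (suc k)
        hi′ = subst₂ (λ a l → fromℕ l ≤ a) (power (suc k)) (sym sk+K≡n) (fromℕ-mono (ℕ.<⇒≤ hi))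

-- The Wallis product, from lattice squares in quarter discs.

module Wallis where

  open import Data.Rational hiding (NonZero)
  open import Data.Rational.Properties
  open ℚ-Lemmas
  open LnLemmas using (monotone)
  open DiscLemmas using (column-max; column-bound; sum-lower; sum-upper)
  open DiscAreaLemmas using (discArea-compare)
  open CauchyLemmas using (rescale)
  open OperationLemmas using (inverse-positive)
  open DiagonalSums
  open CentralBinomials
  open ForestSums
  open Counting
  open Dags
  open AverageBounds
  open Estimates

  vanishing : ∀ B → 0ℚ ≤ B → ∀ ε → 0ℚ < ε → ∃[ t ] ∀ j → t ℕ.≤ j → B * unit j ≤ ε
  vanishing B 0≤B ε 0<ε = from (inverse-positive (1ℚ + B) (<-≤-trans (positive⁻¹ 1ℚ) (≤+ 1ℚ 0≤B)))
    where
    from : ∃[ r ] (1ℚ + B) * r ≡ 1ℚ × 0ℚ < r → ∃[ t ] ∀ j → t ℕ.≤ j → B * unit j ≤ ε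
    from (r , inv , 0<r) = proj₁ arch , λ j t≤j → ≤-trans
      (*-monoʳ (0≤unit j) (subst (_≤ 1ℚ + B) (+-identityˡ B) (+-monoˡ-≤ B 0≤1)))
      (rescale (1ℚ + B) r ε (unit j) (0≤+ 0≤1 0≤B) inv (≤-trans (unit-antitone t≤j) (proj₂ arch)))
      where arch = archimedean (r * ε) (0<* {r} 0<r 0<ε)

  -- s n = b 0 + ⋯ + b (n-1) = 2n b n
  s : ℕ → ℚ
  s zero    = 0ℚ
  s (suc k) = d k

  s-step : ∀ k → s (suc k) ≡ s k + b k
  s-step zero    = refl
  s-step (suc k) = d-step k

  s-b : ∀ k → s k ≡ (fromℕ k + fromℕ k) * b k
  s-b k = combine 1ℚ (sym (s-step k))
    (solve 3 (λ x b s → s :- (x :+ x) :* b := con 1ℚ :* (s :+ b :- (con 1ℚ :+ (x :+ x)) :* b)) refl (fromℕ k) (b k) (s k))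

  0≤s : ∀ k → 0ℚ ≤ s k
  0≤s zero    = ≤-refl
  0≤s (suc k) = ≤-trans 0≤1 (1≤d k)

  increment : ℕ → ℚ
  increment k = (1ℚ + 4ℚ * fromℕ k) * (b k * b k)

  s²-step : ∀ k → s (suc k) * s (suc k) ≡ s k * s k + increment k
  s²-step k = combine (- (s k + (x + x) * b k)) (s-b k)
    (solve 3 (λ x b s → ((con 1ℚ :+ (x :+ x)) :* b) :* ((con 1ℚ :+ (x :+ x)) :* b) :- (s :* s :+ (con 1ℚ :+ con 4ℚ :* x) :* (b :* b))
      := :- (s :+ (x :+ x) :* b) :* (s :- (x :+ x) :* b)) refl x (b k) (s k))
    where x = fromℕ k

  -- After multiplication by (2k+2)² the difference of consecutive values is exactly b k².
  increment-mono : ∀ {i j} → i ℕ.≤ j → increment i ≤ increment j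
  increment-mono = monotone increment step
    where
    step : ∀ k → increment k ≤ increment (suc k)
    step k = cancelˡ-≤ (0<* {2ℚ + (x + x)} 0<r 0<r) $ by-difference (b k * b k) (0≤* (0≤b k) (0≤b k)) $
      combine₂ (4ℚ * (r * r * (b (suc k) * b (suc k))))
        ((1ℚ + 4ℚ * (1ℚ + x)) * (r * b (suc k) + (1ℚ + (x + x)) * b k)) (fromℕ-suc k) (b-step k)
        (solve 4 (λ x x′ b b′ →
          (con 2ℚ :+ (x :+ x)) :* (con 2ℚ :+ (x :+ x)) :* ((con 1ℚ :+ con 4ℚ :* x′) :* (b′ :* b′))
            :- (con 2ℚ :+ (x :+ x)) :* (con 2ℚ :+ (x :+ x)) :* ((con 1ℚ :+ con 4ℚ :* x) :* (b :* b)) :- b :* b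
          := con 4ℚ :* ((con 2ℚ :+ (x :+ x)) :* (con 2ℚ :+ (x :+ x)) :* (b′ :* b′)) :* (x′ :- (con 1ℚ :+ x))
          :+ (con 1ℚ :+ con 4ℚ :* (con 1ℚ :+ x)) :* ((con 2ℚ :+ (x :+ x)) :* b′ :+ (con 1ℚ :+ (x :+ x)) :* b)
               :* ((con 2ℚ :+ (x :+ x)) :* b′ :- (con 1ℚ :+ (x :+ x)) :* b))
          refl x (fromℕ (suc k)) (b k) (b (suc k)))
      where
      x = fromℕ k
      r = 2ℚ + (x + x)
      0<r : 0ℚ < r
      0<r = <-≤-trans (positive⁻¹ 2ℚ) (≤+ 2ℚ (0≤2x k))

  -- increment increases and majorant decreases to the common limit 4/π.
  majorant : ℕ → ℚ
  majorant k = (2ℚ + 4ℚ * fromℕ k) * (b k * b k)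

  majorant-antitone : ∀ {i j} → i ℕ.≤ j → majorant j ≤ majorant i
  majorant-antitone = antitone majorant λ k → step k
    where
    step : ∀ k → majorant (suc k) ≤ majorant k
    step k = cancelˡ-≤ (0<* {2ℚ + (x + x)} 0<r 0<r) $ by-difference ((2ℚ + 4ℚ * x) * (b k * b k))
      (0≤* (0≤+ 0≤2 (0≤* 0≤4 (0≤fromℕ k))) (0≤* (0≤b k) (0≤b k))) $
      combine₂ (- (4ℚ * (r * r * (b (suc k) * b (suc k)))))
        (- ((2ℚ + 4ℚ * (1ℚ + x)) * (r * b (suc k) + (1ℚ + (x + x)) * b k))) (fromℕ-suc k) (b-step k)
        (solve 4 (λ x x′ b b′ →
          (con 2ℚ :+ (x :+ x)) :* (con 2ℚ :+ (x :+ x)) :* ((con 2ℚ :+ con 4ℚ :* x) :* (b :* b))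
            :- (con 2ℚ :+ (x :+ x)) :* (con 2ℚ :+ (x :+ x)) :* ((con 2ℚ :+ con 4ℚ :* x′) :* (b′ :* b′))
            :- (con 2ℚ :+ con 4ℚ :* x) :* (b :* b)
          := (:- (con 4ℚ :* ((con 2ℚ :+ (x :+ x)) :* (con 2ℚ :+ (x :+ x)) :* (b′ :* b′)))) :* (x′ :- (con 1ℚ :+ x))
          :+ (:- ((con 2ℚ :+ con 4ℚ :* (con 1ℚ :+ x)) :* ((con 2ℚ :+ (x :+ x)) :* b′ :+ (con 1ℚ :+ (x :+ x)) :* b)))
               :* ((con 2ℚ :+ (x :+ x)) :* b′ :- (con 1ℚ :+ (x :+ x)) :* b))
          refl x (fromℕ (suc k)) (b k) (b (suc k)))
      where
      x = fromℕ k
      r = 2ℚ + (x + x)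
      0<r : 0ℚ < r
      0<r = <-≤-trans (positive⁻¹ 2ℚ) (≤+ 2ℚ (0≤2x k))

  increment≤majorant : ∀ i j → increment j ≤ majorant i
  increment≤majorant i j = by-order (ℕ.≤-total i j)
    where
    same : ∀ k → increment k ≤ majorant k
    same k = *-monoʳ (0≤* (0≤b k) (0≤b k)) (+-monoˡ-≤ (4ℚ * fromℕ k) {1ℚ} {2ℚ} (≤ᵇ⇒≤ _))
    by-order : i ℕ.≤ j ⊎ j ℕ.≤ i → increment j ≤ majorant i
    by-order (inj₁ i≤j) = ≤-trans (same j) (majorant-antitone i≤j)
    by-order (inj₂ j≤i) = ≤-trans (increment-mono j≤i) (same i)

  -- The increments of s² increase, so i steps starting at j gain at least as much as the first i
  -- steps. Geometrically, the point (s i, s j) lies in the disc of radius s (i+j).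
  s²-superadditive : ∀ i j → s i * s i + s j * s j ≤ s (i ℕ.+ j) * s (i ℕ.+ j)
  s²-superadditive zero    j = ≤-reflexive (+-identityˡ (s j * s j))
  s²-superadditive (suc i) j = begin
    s (suc i) * s (suc i) + s j * s j
      ≡⟨ trans (cong (_+ s j * s j) (s²-step i))
           (solve 3 (λ a e c → a :+ e :+ c := a :+ c :+ e) refl (s i * s i) (increment i) (s j * s j)) ⟩
    s i * s i + s j * s j + increment i
      ≤⟨ +-mono (s²-superadditive i j) (increment-mono (ℕ.m≤m+n i j)) ⟩
    s (i ℕ.+ j) * s (i ℕ.+ j) + increment (i ℕ.+ j)
      ≡⟨ s²-step (i ℕ.+ j) ⟨
    s (suc i ℕ.+ j) * s (suc i ℕ.+ j) ∎
    where open ≤-Reasoning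

  -- Each of the i steps from j+1 to i+j+1 gains at most `majorant i`, and i times this is at most s
  -- (i+1)². The extra step on the right provides the slack, since the increments do increase.
  s²-subadditive : ∀ i j → s (suc (i ℕ.+ j)) * s (suc (i ℕ.+ j)) ≤ s (suc i) * s (suc i) + s (suc j) * s (suc j)
  s²-subadditive i j = ≤-trans (steps i) (+-monoˡ-≤ (s (suc j) * s (suc j)) first)
    where
    open ≤-Reasoning
    steps : ∀ k → s (suc (k ℕ.+ j)) * s (suc (k ℕ.+ j)) ≤ fromℕ k * majorant i + s (suc j) * s (suc j)
    steps zero    = ≤-reflexive (solve 2 (λ m t → t := con 0ℚ :* m :+ t) refl (majorant i) (s (suc j) * s (suc j)))
    steps (suc k) = begin
      s (suc (suc k ℕ.+ j)) * s (suc (suc k ℕ.+ j))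
        ≡⟨ s²-step (suc (k ℕ.+ j)) ⟩
      s (suc (k ℕ.+ j)) * s (suc (k ℕ.+ j)) + increment (suc (k ℕ.+ j))
        ≤⟨ +-mono (steps k) (increment≤majorant i (suc (k ℕ.+ j))) ⟩
      fromℕ k * majorant i + s (suc j) * s (suc j) + majorant i
        ≡⟨ solve 3 (λ k m t → k :* m :+ t :+ m := (con 1ℚ :+ k) :* m :+ t) refl (fromℕ k) (majorant i) (s (suc j) * s (suc j)) ⟩
      (1ℚ + fromℕ k) * majorant i + s (suc j) * s (suc j)
        ≡⟨ cong (λ y → y * majorant i + s (suc j) * s (suc j)) (fromℕ-suc k) ⟨
      fromℕ (suc k) * majorant i + s (suc j) * s (suc j) ∎
    first : fromℕ i * majorant i ≤ s (suc i) * s (suc i)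
    first = by-difference ((1ℚ + (fromℕ i + fromℕ i)) * (b i * b i))
      (0≤* (0≤+ 0≤1 (0≤2x i)) (0≤* (0≤b i) (0≤b i)))
      (solve 2 (λ x b → ((con 1ℚ :+ (x :+ x)) :* b) :* ((con 1ℚ :+ (x :+ x)) :* b)
          :- x :* ((con 2ℚ :+ con 4ℚ :* x) :* (b :* b)) := (con 1ℚ :+ (x :+ x)) :* (b :* b)) refl (fromℕ i) (b i))

  -- On generating functions, (1-x)^(-1/2) times (1-x)^(-3/2) is (1-x)^(-2). With widths `b i` and
  -- heights s (j+1) = `d j` it is the area of a staircase.
  conv-b-d : ∀ n → conv b d n ≡ fromℕ (suc n)
  conv-b-d n = begin
    conv b d n
      ≡⟨ diag-cong n (λ i j _ → solve 3 (λ p q y → p :* ((con 1ℚ :+ (y :+ y)) :* q)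
           := p :* q :+ con 2ℚ :* (y :* q :* p)) refl (b i) (b j) (fromℕ j)) ⟩
    diag (λ i j → b i * b j + 2ℚ * (fromℕ j * b j * b i)) n
      ≡⟨ trans (diag-+ _ _ n) (cong (conv b b n +_) (diag-* 2ℚ _ n)) ⟩
    conv b b n + 2ℚ * diag (λ i j → fromℕ j * b j * b i) n
      ≡⟨ cong (λ t → conv b b n + 2ℚ * t) (diag-flip _ n) ⟩
    conv b b n + 2ℚ * conv (λ i → fromℕ i * b i) b n
      ≡⟨ cong (conv b b n +_) (conv-weighted b n) ⟩
    conv b b n + fromℕ n * conv b b n
      ≡⟨ cong (λ t → t + fromℕ n * t) (conv-b-b n) ⟩
    1ℚ + fromℕ n * 1ℚ
      ≡⟨ trans (cong (1ℚ +_) (*-identityʳ (fromℕ n))) (sym (fromℕ-suc n)) ⟩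
    fromℕ (suc n) ∎
    where open ≡-Reasoning

  fromℕ-cancel-≤ : ∀ {a b} → fromℕ a ≤ fromℕ b → a ℕ.≤ b
  fromℕ-cancel-≤ {a} {b} h with ℕ.≤-<-connex a b
  ... | inj₁ a≤b = a≤b
  ... | inj₂ b<a = ⊥-elim $ <-irrefl refl $ begin-strict
    fromℕ b        <⟨ subst (_< 1ℚ + fromℕ b) (+-identityˡ (fromℕ b)) (+-monoˡ-< (fromℕ b) (positive⁻¹ 1ℚ)) ⟩
    1ℚ + fromℕ b   ≡⟨ fromℕ-suc b ⟨
    fromℕ (suc b)  ≤⟨ fromℕ-mono b<a ⟩
    fromℕ a        ≤⟨ h ⟩
    fromℕ b        ∎
    where open ≤-Reasoning

  -- The disc area counts lattice squares, so the rectangle sides have to become integers: Q is a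
  -- common denominator of b 0, ..., b L, with numerators `β i`.
  CommonDenominator : ℕ → Set
  CommonDenominator L = Σ ℕ λ Q → Σ (ℕ → ℕ) λ β → 1 ℕ.≤ Q × ∀ i → i ℕ.≤ L → fromℕ (β i) ≡ b i * fromℕ Q

  integral : ∀ L → CommonDenominator L
  integral zero    = 1 , (λ _ → 1) , ℕ.≤-refl , λ { zero z≤n → refl }
  integral (suc L) = extend (integral L)
    where
    x = fromℕ L
    o e : ℕ
    o = suc (L ℕ.+ L)
    e = suc o
    odd : fromℕ o ≡ 1ℚ + (x + x)
    odd = trans (fromℕ-suc (L ℕ.+ L)) (cong (1ℚ +_) (fromℕ-+ L L))
    even : fromℕ e ≡ 2ℚ + (x + x)
    even = trans (fromℕ-suc o) (trans (cong (1ℚ +_) odd) (sym (+-assoc 1ℚ 1ℚ (x + x))))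
    extend : CommonDenominator L → CommonDenominator (suc L)
    extend (Q , β , 1≤Q , β≡) = e ℕ.* Q , (λ i → value i (i ℕ.≤? L)) , ℕ.*-mono-≤ {1} {e} (s≤s z≤n) 1≤Q ,
      λ i i≤ → value≡ i i≤ (i ℕ.≤? L)
      where
      value : ∀ i → Dec (i ℕ.≤ L) → ℕ
      value i (yes _) = e ℕ.* β i
      value i (no  _) = o ℕ.* β L
      old : ∀ i → i ℕ.≤ L → fromℕ (e ℕ.* β i) ≡ b i * fromℕ (e ℕ.* Q)
      old i i≤L = begin
        fromℕ (e ℕ.* β i)             ≡⟨ fromℕ-* e (β i) ⟩
        fromℕ e * fromℕ (β i)         ≡⟨ cong (fromℕ e *_) (β≡ i i≤L) ⟩
        fromℕ e * (b i * fromℕ Q)     ≡⟨ solve 3 (λ e b q → e :* (b :* q) := b :* (e :* q)) refl (fromℕ e) (b i) (fromℕ Q) ⟩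
        b i * (fromℕ e * fromℕ Q)     ≡⟨ cong (b i *_) (fromℕ-* e Q) ⟨
        b i * fromℕ (e ℕ.* Q)         ∎
        where open ≡-Reasoning
      new : fromℕ (o ℕ.* β L) ≡ b (suc L) * fromℕ (e ℕ.* Q)
      new = begin
        fromℕ (o ℕ.* β L)
          ≡⟨ fromℕ-* o (β L) ⟩
        fromℕ o * fromℕ (β L)
          ≡⟨ cong₂ _*_ odd (β≡ L ℕ.≤-refl) ⟩
        (1ℚ + (x + x)) * (b L * fromℕ Q)
          ≡⟨ combine (- fromℕ Q) (b-step L) (solve 4 (λ x b b′ q → (con 1ℚ :+ (x :+ x)) :* (b :* q) :- b′ :* ((con 2ℚ :+ (x :+ x)) :* q)
               := :- q :* ((con 2ℚ :+ (x :+ x)) :* b′ :- (con 1ℚ :+ (x :+ x)) :* b)) refl x (b L) (b (suc L)) (fromℕ Q)) ⟩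
        b (suc L) * ((2ℚ + (x + x)) * fromℕ Q)
          ≡⟨ cong (λ t → b (suc L) * (t * fromℕ Q)) even ⟨
        b (suc L) * (fromℕ e * fromℕ Q)
          ≡⟨ cong (b (suc L) *_) (fromℕ-* e Q) ⟨
        b (suc L) * fromℕ (e ℕ.* Q) ∎
        where open ≡-Reasoning
      value≡ : ∀ i → i ℕ.≤ suc L → (d : Dec (i ℕ.≤ L)) → fromℕ (value i d) ≡ b i * fromℕ (e ℕ.* Q)
      value≡ i i≤ (yes i≤L) = old i i≤L
      value≡ i i≤ (no  i≰L) = trans new (cong (λ i → b i * fromℕ (e ℕ.* Q)) (sym (ℕ.≤-antisym i≤ (ℕ.≰⇒> i≰L))))

  stepwise-mono : (f : ℕ → ℕ) → (∀ k → f k ℕ.≤ f (suc k)) → ∀ {i j} → i ℕ.≤ j → f i ℕ.≤ f j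
  stepwise-mono f step {i} {j} i≤j with ℕ.m≤n⇒m<n∨m≡n i≤j
  ... | inj₂ refl = ℕ.≤-refl
  stepwise-mono f step {i} {suc j} _ | inj₁ (s≤s i≤j) = ℕ.≤-trans (stepwise-mono f step i≤j) (step j)

  Σ-mono : ∀ f {i j} → i ℕ.≤ j → Σ[1… i ] f ℕ.≤ Σ[1… j ] f
  Σ-mono f = stepwise-mono (λ n → Σ[1… n ] f) λ n → ℕ.m≤m+n (Σ[1… n ] f) (f (suc n))

  ≤-from-squares : ∀ {u v w z} → u ℕ.* u ℕ.+ v ℕ.* v ℕ.≤ w ℕ.* w ℕ.+ z ℕ.* z → w ℕ.≤ u → v ℕ.≤ z
  ≤-from-squares {u} {v} {w} {z} h w≤u with ℕ.≤-<-connex v z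
  ... | inj₁ v≤z = v≤z
  ... | inj₂ z<v = ⊥-elim $ ℕ.<-irrefl refl $ ℕ.<-≤-trans
    (ℕ.+-mono-≤-< (ℕ.*-mono-≤ w≤u w≤u) (ℕ.*-mono-< z<v z<v)) h

  -- The rectangles [s i, s (i+1)] × [s j, s (j+1)] of Wästlund's proof of the Wallis
  -- formula, scaled by the common denominator Q and by t: the staircase of those with
  -- i + j < n has area n and is squeezed between quarter discs.
  module Staircase (L Q : ℕ) (β : ℕ → ℕ) (β≡ : ∀ i → i ℕ.≤ L → fromℕ (β i) ≡ b i * fromℕ Q) (1≤Q : 1 ℕ.≤ Q) (t : ℕ) where

    σ : ℕ → ℕ
    σ zero    = 0
    σ (suc i) = β i ℕ.* t ℕ.+ σ i

    scale : ℚ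
    scale = fromℕ Q * fromℕ t

    β-scale : ∀ i → i ℕ.≤ L → fromℕ (β i ℕ.* t) ≡ b i * scale
    β-scale i i≤L = trans (fromℕ-* (β i) t) $ trans (cong (_* fromℕ t) (β≡ i i≤L)) (*-assoc (b i) (fromℕ Q) (fromℕ t))

    σ-scale : ∀ i → i ℕ.≤ suc L → fromℕ (σ i) ≡ s i * scale
    σ-scale zero    _         = sym (*-zeroˡ scale)
    σ-scale (suc i) (s≤s i≤L) = begin
      fromℕ (β i ℕ.* t ℕ.+ σ i)        ≡⟨ fromℕ-+ (β i ℕ.* t) (σ i) ⟩
      fromℕ (β i ℕ.* t) + fromℕ (σ i)  ≡⟨ cong₂ _+_ (β-scale i i≤L) (σ-scale i (ℕ.m≤n⇒m≤1+n i≤L)) ⟩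
      b i * scale + s i * scale        ≡⟨ solve 3 (λ b s q → b :* q :+ s :* q := (s :+ b) :* q) refl (b i) (s i) scale ⟩
      (s i + b i) * scale              ≡⟨ cong (_* scale) (s-step i) ⟨
      s (suc i) * scale                ∎
      where open ≡-Reasoning

    σ²-scale : ∀ i → i ℕ.≤ suc L → fromℕ (σ i ℕ.* σ i) ≡ s i * s i * (scale * scale)
    σ²-scale i i≤ = trans (fromℕ-* (σ i) (σ i)) $ trans (cong (λ y → y * y) (σ-scale i i≤))
      (solve 2 (λ s q → s :* q :* (s :* q) := s :* s :* (q :* q)) refl (s i) scale)

    0≤scale : 0ℚ ≤ scale
    0≤scale = 0≤* (0≤fromℕ Q) (0≤fromℕ t)

    σ-mono : ∀ {i j} → i ℕ.≤ j → σ i ℕ.≤ σ j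
    σ-mono = stepwise-mono σ λ i → ℕ.m≤n+m (σ i) (β i ℕ.* t)

    σ²-superadditive : ∀ i j → i ℕ.+ j ℕ.≤ suc L → σ i ℕ.* σ i ℕ.+ σ j ℕ.* σ j ℕ.≤ σ (i ℕ.+ j) ℕ.* σ (i ℕ.+ j)
    σ²-superadditive i j h = fromℕ-cancel-≤ $ begin
      fromℕ (σ i ℕ.* σ i ℕ.+ σ j ℕ.* σ j)
        ≡⟨ trans (fromℕ-+ (σ i ℕ.* σ i) _) (cong₂ _+_ (σ²-scale i (ℕ.m+n≤o⇒m≤o i h)) (σ²-scale j (ℕ.m+n≤o⇒n≤o i h))) ⟩
      s i * s i * (scale * scale) + s j * s j * (scale * scale)
        ≡⟨ *-distribʳ-+ (scale * scale) (s i * s i) (s j * s j) ⟨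
      (s i * s i + s j * s j) * (scale * scale)
        ≤⟨ *-monoʳ (0≤* 0≤scale 0≤scale) (s²-superadditive i j) ⟩
      s (i ℕ.+ j) * s (i ℕ.+ j) * (scale * scale)
        ≡⟨ σ²-scale (i ℕ.+ j) h ⟨
      fromℕ (σ (i ℕ.+ j) ℕ.* σ (i ℕ.+ j)) ∎
      where open ≤-Reasoning

    σ²-subadditive : ∀ i j → i ℕ.+ j ℕ.≤ L →
      σ (i ℕ.+ j) ℕ.* σ (i ℕ.+ j) ℕ.≤ σ i ℕ.* σ i ℕ.+ σ (suc j) ℕ.* σ (suc j)
    σ²-subadditive zero    j h = ℕ.*-mono-≤ (σ-mono (ℕ.n≤1+n j)) (σ-mono (ℕ.n≤1+n j))
    σ²-subadditive (suc i) j h = fromℕ-cancel-≤ $ begin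
      fromℕ (σ (suc i ℕ.+ j) ℕ.* σ (suc i ℕ.+ j))
        ≡⟨ σ²-scale (suc i ℕ.+ j) (ℕ.m≤n⇒m≤1+n h) ⟩
      s (suc (i ℕ.+ j)) * s (suc (i ℕ.+ j)) * (scale * scale)
        ≤⟨ *-monoʳ (0≤* 0≤scale 0≤scale) (s²-subadditive i j) ⟩
      (s (suc i) * s (suc i) + s (suc j) * s (suc j)) * (scale * scale)
        ≡⟨ *-distribʳ-+ (scale * scale) (s (suc i) * s (suc i)) (s (suc j) * s (suc j)) ⟩
      s (suc i) * s (suc i) * (scale * scale) + s (suc j) * s (suc j) * (scale * scale)
        ≡⟨ cong₂ _+_ (σ²-scale (suc i) (ℕ.m≤n⇒m≤1+n (ℕ.m+n≤o⇒m≤o (suc i) h))) (σ²-scale (suc j) (s≤s (ℕ.m+n≤o⇒n≤o (suc i) h))) ⟨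
      fromℕ (σ (suc i) ℕ.* σ (suc i)) + fromℕ (σ (suc j) ℕ.* σ (suc j))
        ≡⟨ fromℕ-+ (σ (suc i) ℕ.* σ (suc i)) _ ⟨
      fromℕ (σ (suc i) ℕ.* σ (suc i) ℕ.+ σ (suc j) ℕ.* σ (suc j)) ∎
      where open ≤-Reasoning

    rectangle : ℕ → ℕ → ℚ
    rectangle i j = fromℕ (β i ℕ.* t ℕ.* σ (suc j))

    staircase-area : ∀ n → n ℕ.≤ L → diag rectangle n ≡ fromℕ (suc n) * (scale * scale)
    staircase-area n n≤L = begin
      diag rectangle n
        ≡⟨ diag-cong n (λ i j eq → trans (fromℕ-* (β i ℕ.* t) (σ (suc j))) $ trans
             (cong₂ _*_ (β-scale i (ℕ.≤-trans (ℕ.m+n≤o⇒m≤o i (ℕ.≤-reflexive eq)) n≤L))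
               (σ-scale (suc j) (s≤s (ℕ.≤-trans (ℕ.m+n≤o⇒n≤o i (ℕ.≤-reflexive eq)) n≤L))))
             (solve 3 (λ b d q → b :* q :* (d :* q) := q :* q :* (b :* d)) refl (b i) (d j) scale)) ⟩
      diag (λ i j → scale * scale * (b i * d j)) n
        ≡⟨ trans (diag-* (scale * scale) _ n) (cong (scale * scale *_) (conv-b-d n)) ⟩
      scale * scale * fromℕ (suc n)
        ≡⟨ *-comm (scale * scale) (fromℕ (suc n)) ⟩
      fromℕ (suc n) * (scale * scale) ∎
      where open ≡-Reasoning

    -- The columns between σ a and σ (a+1) have height at most σ (l+1) where a + l = r, so they fit
    -- into one rectangle; the recursion continues with the next block.
    covered-≤ : ∀ r f → (∀ i j → i ℕ.+ j ≡ r → ∀ k → f (k ℕ.+ σ i) ℕ.≤ σ (suc j)) → ∀ a l → a ℕ.+ l ≡ r →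
      fromℕ (Σ[1… σ (suc (a ℕ.+ l)) ] f) ≤ fromℕ (Σ[1… σ a ] f) + diag (λ i j → rectangle (a ℕ.+ i) j) l
    covered-≤ r f h a zero    eq = begin
      fromℕ (Σ[1… σ (suc (a ℕ.+ 0)) ] f)
        ≡⟨ cong (λ n → fromℕ (Σ[1… σ (suc n) ] f)) (ℕ.+-identityʳ a) ⟩
      fromℕ (Σ[1… σ (suc a) ] f)
        ≤⟨ fromℕ-mono (sum-upper f (σ a) (σ 1) (β a ℕ.* t) (h a 0 eq)) ⟩
      fromℕ (Σ[1… σ a ] f ℕ.+ β a ℕ.* t ℕ.* σ 1)
        ≡⟨ fromℕ-+ (Σ[1… σ a ] f) (β a ℕ.* t ℕ.* σ 1) ⟩
      fromℕ (Σ[1… σ a ] f) + rectangle a 0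
        ≡⟨ cong (λ i → fromℕ (Σ[1… σ a ] f) + rectangle i 0) (ℕ.+-identityʳ a) ⟨
      fromℕ (Σ[1… σ a ] f) + rectangle (a ℕ.+ 0) 0 ∎
      where open ≤-Reasoning
    covered-≤ r f h a (suc l) eq = begin
      fromℕ (Σ[1… σ (suc (a ℕ.+ suc l)) ] f)
        ≡⟨ cong (λ n → fromℕ (Σ[1… σ (suc n) ] f)) (ℕ.+-suc a l) ⟩
      fromℕ (Σ[1… σ (suc (suc a ℕ.+ l)) ] f)
        ≤⟨ covered-≤ r f h (suc a) l (trans (sym (ℕ.+-suc a l)) eq) ⟩
      fromℕ (Σ[1… σ (suc a) ] f) + diag (λ i j → rectangle (suc a ℕ.+ i) j) l
        ≤⟨ +-monoˡ-≤ (diag (λ i j → rectangle (suc a ℕ.+ i) j) l)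
             (≤-trans (fromℕ-mono (sum-upper f (σ a) (σ (suc (suc l))) (β a ℕ.* t) (h a (suc l) eq)))
               (≤-reflexive (fromℕ-+ (Σ[1… σ a ] f) (β a ℕ.* t ℕ.* σ (suc (suc l)))))) ⟩
      fromℕ (Σ[1… σ a ] f) + rectangle a (suc l) + diag (λ i j → rectangle (suc a ℕ.+ i) j) l
        ≡⟨ trans (+-assoc (fromℕ (Σ[1… σ a ] f)) _ _) (cong (fromℕ (Σ[1… σ a ] f) +_) (cong₂ _+_
             (cong (λ i → rectangle i (suc l)) (sym (ℕ.+-identityʳ a)))
             (diag-cong l λ i j _ → cong (λ i → rectangle i j) (sym (ℕ.+-suc a i))))) ⟩
      fromℕ (Σ[1… σ a ] f) + diag (λ i j → rectangle (a ℕ.+ i) j) (suc l) ∎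
      where open ≤-Reasoning

    covered-≥ : ∀ r f → (∀ i j → i ℕ.+ j ≡ r → ∀ k → k ℕ.≤ β i ℕ.* t → σ (suc j) ℕ.≤ f (k ℕ.+ σ i)) → ∀ a l → a ℕ.+ l ≡ r →
      fromℕ (Σ[1… σ a ] f) + diag (λ i j → rectangle (a ℕ.+ i) j) l ≤ fromℕ (Σ[1… σ (suc (a ℕ.+ l)) ] f)
    covered-≥ r f h a zero    eq = begin
      fromℕ (Σ[1… σ a ] f) + rectangle (a ℕ.+ 0) 0
        ≡⟨ cong (λ i → fromℕ (Σ[1… σ a ] f) + rectangle i 0) (ℕ.+-identityʳ a) ⟩
      fromℕ (Σ[1… σ a ] f) + rectangle a 0
        ≡⟨ fromℕ-+ (Σ[1… σ a ] f) (β a ℕ.* t ℕ.* σ 1) ⟨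
      fromℕ (Σ[1… σ a ] f ℕ.+ β a ℕ.* t ℕ.* σ 1)
        ≤⟨ fromℕ-mono (sum-lower f (σ a) (σ 1) (β a ℕ.* t) (h a 0 eq)) ⟩
      fromℕ (Σ[1… σ (suc a) ] f)
        ≡⟨ cong (λ n → fromℕ (Σ[1… σ (suc n) ] f)) (ℕ.+-identityʳ a) ⟨
      fromℕ (Σ[1… σ (suc (a ℕ.+ 0)) ] f) ∎
      where open ≤-Reasoning
    covered-≥ r f h a (suc l) eq = begin
      fromℕ (Σ[1… σ a ] f) + diag (λ i j → rectangle (a ℕ.+ i) j) (suc l)
        ≡⟨ trans (+-assoc (fromℕ (Σ[1… σ a ] f)) _ _) (cong (fromℕ (Σ[1… σ a ] f) +_) (cong₂ _+_
             (cong (λ i → rectangle i (suc l)) (sym (ℕ.+-identityʳ a)))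
             (diag-cong l λ i j _ → cong (λ i → rectangle i j) (sym (ℕ.+-suc a i))))) ⟨
      fromℕ (Σ[1… σ a ] f) + rectangle a (suc l) + diag (λ i j → rectangle (suc a ℕ.+ i) j) l
        ≤⟨ +-monoˡ-≤ (diag (λ i j → rectangle (suc a ℕ.+ i) j) l)
             (≤-trans (≤-reflexive (sym (fromℕ-+ (Σ[1… σ a ] f) (β a ℕ.* t ℕ.* σ (suc (suc l))))))
               (fromℕ-mono (sum-lower f (σ a) (σ (suc (suc l))) (β a ℕ.* t) (h a (suc l) eq)))) ⟩
      fromℕ (Σ[1… σ (suc a) ] f) + diag (λ i j → rectangle (suc a ℕ.+ i) j) l
        ≤⟨ covered-≥ r f h (suc a) l (trans (sym (ℕ.+-suc a l)) eq) ⟩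
      fromℕ (Σ[1… σ (suc (suc a ℕ.+ l)) ] f)
        ≡⟨ cong (λ n → fromℕ (Σ[1… σ (suc n) ] f)) (ℕ.+-suc a l) ⟨
      fromℕ (Σ[1… σ (suc (a ℕ.+ suc l)) ] f) ∎
      where open ≤-Reasoning

    -- By subadditivity the outer corners (σ i, σ (j+1)) with i + j = n are not inside the disc of
    -- radius σ n, so the staircase of area n + 1 covers the quarter disc.
    quarterDisc-≤ : ∀ n → n ℕ.≤ L → fromℕ (quarterDisc (σ n)) ≤ fromℕ (suc n) * (scale * scale)
    quarterDisc-≤ n n≤L = begin
      fromℕ (Σ[1… σ n ] f)           ≤⟨ fromℕ-mono (Σ-mono f (σ-mono (ℕ.n≤1+n n))) ⟩
      fromℕ (Σ[1… σ (suc n) ] f)     ≤⟨ covered-≤ n f height 0 n refl ⟩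
      0ℚ + diag rectangle n          ≡⟨ trans (+-identityˡ _) (staircase-area n n≤L) ⟩
      fromℕ (suc n) * (scale * scale) ∎
      where
      open ≤-Reasoning
      f = column (σ n)
      height : ∀ i j → i ℕ.+ j ≡ n → ∀ k → f (k ℕ.+ σ i) ℕ.≤ σ (suc j)
      height i j refl k = column-bound (σ n) (k ℕ.+ σ i) (σ (suc j)) λ v _ inside →
        ≤-from-squares {k ℕ.+ σ i} {v} {σ i} (ℕ.≤-trans inside (σ²-subadditive i j n≤L)) (ℕ.m≤n+m (σ i) k)

    -- By superadditivity the corners (σ (i+1), σ (j+1)) with i + j = n - 1 lie in the disc of
    -- radius σ (n+1), so it contains the staircase of area n.
    quarterDisc-≥ : ∀ n → n ℕ.≤ L → fromℕ n * (scale * scale) ≤ fromℕ (quarterDisc (σ (suc n)))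
    quarterDisc-≥ zero    _   = ≤-trans (≤-reflexive (*-zeroˡ (scale * scale))) (0≤fromℕ (quarterDisc (σ 1)))
    quarterDisc-≥ (suc n) n<L = begin
      fromℕ (suc n) * (scale * scale) ≡⟨ trans (+-identityˡ _) (staircase-area n (ℕ.<⇒≤ n<L)) ⟨
      0ℚ + diag rectangle n          ≤⟨ covered-≥ n f height 0 n refl ⟩
      fromℕ (Σ[1… σ (suc n) ] f)     ≤⟨ fromℕ-mono (Σ-mono f (σ-mono (ℕ.n≤1+n (suc n)))) ⟩
      fromℕ (quarterDisc (σ (suc (suc n)))) ∎
      where
      open ≤-Reasoning
      f = column (σ (suc (suc n)))
      height : ∀ i j → i ℕ.+ j ≡ n → ∀ k → k ℕ.≤ β i ℕ.* t → σ (suc j) ℕ.≤ f (k ℕ.+ σ i)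
      height i j refl k k≤ = column-max (σ (suc (suc n))) (k ℕ.+ σ i) (σ-mono (s≤s (ℕ.m≤n⇒m≤1+n (ℕ.m≤n+m j i)))) $
        ℕ.≤-trans (ℕ.+-monoˡ-≤ (σ (suc j) ℕ.* σ (suc j)) (ℕ.*-mono-≤ below below)) $
        subst (λ l → σ (suc i) ℕ.* σ (suc i) ℕ.+ σ (suc j) ℕ.* σ (suc j) ℕ.≤ σ l ℕ.* σ l) (cong suc (ℕ.+-suc i j)) $
        σ²-superadditive (suc i) (suc j) (s≤s (subst (ℕ._≤ L) (sym (ℕ.+-suc i j)) n<L))
        where
        below : k ℕ.+ σ i ℕ.≤ σ (suc i)
        below = ℕ.+-monoˡ-≤ (σ i) k≤

  discArea-* : ∀ k → discArea k * (fromℕ (suc k) * fromℕ (suc k)) ≡ 4ℚ * fromℕ (quarterDisc (suc k))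
  discArea-* k = trans (cong (discArea k *_) (sym (fromℕ-* (suc k) (suc k)))) $
    trans (quotient-* (4 ℕ.* quarterDisc (suc k)) (suc k ℕ.* suc k)) (fromℕ-* 4 (quarterDisc (suc k)))

  module _ (k : ℕ) where

    private
      P : ℕ
      P = suc k
      p V : ℚ
      p = fromℕ P
      V = p * b P * (p * b P)

    0≤V : 0ℚ ≤ V
    0≤V = 0≤* (0≤* (0≤fromℕ P) (0≤b P)) (0≤* (0≤fromℕ P) (0≤b P))

    -- Hence a quarter disc of radius s P has area π V.
    s²-V : s P * s P ≡ 4ℚ * V
    s²-V = trans (cong (λ y → y * y) (s-b P))
      (solve 2 (λ p b → (p :+ p) :* b :* ((p :+ p) :* b) := con 4ℚ :* (p :* b :* (p :* b))) refl p (b P))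

    -- There are arbitrarily fine meshes for which the bounds on V π hold exactly.
    Mesh : ℕ → Set
    Mesh t = Σ ℕ λ j → t ℕ.≤ j × discArea j * V ≤ 1ℚ + p × p - 1ℚ ≤ discArea j * V

    mesh-from : CommonDenominator P → ∀ t → Mesh t
    mesh-from (Q , β , 1≤Q , β≡) t = j , ℕ.≤-pred (subst (suc t ℕ.≤_) (sym suc-j) t<r) , upper , lower
      where
      open ≤-Reasoning
      -- The scaling parameter makes the integer radius at least t + 1, which is the required
      -- fineness of the mesh.
      open Staircase P Q β β≡ 1≤Q (suc t)
      r j : ℕ
      r = σ P
      j = ℕ.pred r
      r-scale : fromℕ r ≡ s P * scale
      r-scale = σ-scale P (ℕ.n≤1+n P)
      0<scale : 0ℚ < scale
      0<scale = 0<* {fromℕ Q} (<-≤-trans (positive⁻¹ 1ℚ) (fromℕ-mono 1≤Q)) (<-≤-trans (positive⁻¹ 1ℚ) (fromℕ-mono {1} {suc t} (s≤s z≤n)))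
      t<r : suc t ℕ.≤ r
      t<r = fromℕ-cancel-≤ $ begin
        fromℕ (suc t)              ≡⟨ *-identityˡ (fromℕ (suc t)) ⟨
        1ℚ * fromℕ (suc t)         ≤⟨ *-monoʳ (0≤fromℕ (suc t)) (fromℕ-mono 1≤Q) ⟩
        scale                      ≡⟨ *-identityˡ scale ⟨
        1ℚ * scale                 ≤⟨ *-monoʳ 0≤scale (1≤d k) ⟩
        s P * scale                ≡⟨ r-scale ⟨
        fromℕ r                    ∎
      suc-j : suc j ≡ r
      suc-j = ℕ.suc-pred r {{ℕ.>-nonZero (ℕ.≤-trans (s≤s z≤n) t<r)}}
      0<4scale² : 0ℚ < 4ℚ * (scale * scale)
      0<4scale² = 0<* {4ℚ} (positive⁻¹ 4ℚ) (0<* {scale} 0<scale 0<scale)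
      area : 4ℚ * fromℕ (quarterDisc r) ≡ discArea j * V * (4ℚ * (scale * scale))
      area = trans (cong (λ l → 4ℚ * fromℕ (quarterDisc l)) (sym suc-j)) $ trans (sym (discArea-* j)) $
        trans (cong (λ y → discArea j * (y * y)) (trans (cong fromℕ suc-j) r-scale)) $
        trans (solve 3 (λ a s q → a :* (s :* q :* (s :* q)) := a :* (s :* s) :* (q :* q)) refl (discArea j) (s P) scale) $
        trans (cong (λ y → discArea j * y * (scale * scale)) s²-V)
          (solve 3 (λ a v q → a :* (con 4ℚ :* v) :* q := a :* v :* (con 4ℚ :* q)) refl (discArea j) V (scale * scale))
      upper : discArea j * V ≤ 1ℚ + p
      upper = cancelʳ-≤ 0<4scale² $ begin
        discArea j * V * (4ℚ * (scale * scale))   ≡⟨ area ⟨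
        4ℚ * fromℕ (quarterDisc r)                ≤⟨ *-monoˡ 0≤4 (quarterDisc-≤ P ℕ.≤-refl) ⟩
        4ℚ * (fromℕ (suc P) * (scale * scale))    ≡⟨ solve 2 (λ a q → con 4ℚ :* (a :* q) := a :* (con 4ℚ :* q)) refl (fromℕ (suc P)) (scale * scale) ⟩
        fromℕ (suc P) * (4ℚ * (scale * scale))    ≡⟨ cong (_* (4ℚ * (scale * scale))) (fromℕ-suc P) ⟩
        (1ℚ + p) * (4ℚ * (scale * scale))         ∎
      lower : p - 1ℚ ≤ discArea j * V
      lower = cancelʳ-≤ 0<4scale² $ begin
        (p - 1ℚ) * (4ℚ * (scale * scale))         ≡⟨ combine (4ℚ * (scale * scale)) (fromℕ-suc k)
                                                       (solve 3 (λ p y q → (p :- con 1ℚ) :* (con 4ℚ :* q) :- con 4ℚ :* (y :* q)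
                                                         := con 4ℚ :* q :* (p :- (con 1ℚ :+ y))) refl p (fromℕ k) (scale * scale)) ⟩
        4ℚ * (fromℕ k * (scale * scale))          ≤⟨ *-monoˡ 0≤4 (quarterDisc-≥ k (ℕ.n≤1+n k)) ⟩
        4ℚ * fromℕ (quarterDisc r)                ≡⟨ area ⟩
        discArea j * V * (4ℚ * (scale * scale))   ∎

    mesh : ∀ t → Mesh t
    mesh = mesh-from (integral P)

    -- The bound is exact on a mesh j as fine as desired; the comparison of two meshes costs
    -- 8/(j+1), which is made small by choosing j.
    wallis-≤ : ∀ ε → 0ℚ < ε → ∀ i → discArea i * V ≤ (1ℚ + p) + ε
    wallis-≤ ε 0<ε i = begin
      discArea i * V                           ≤⟨ *-monoʳ 0≤V (discArea-compare i j) ⟩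
      (discArea j + fromℕ 8 * unit j) * V      ≡⟨ *-distribʳ-+ V (discArea j) (fromℕ 8 * unit j) ⟩
      discArea j * V + fromℕ 8 * unit j * V    ≤⟨ +-mono (proj₁ (proj₂ (proj₂ (mesh t)))) small ⟩
      (1ℚ + p) + ε                             ∎
      where
      open ≤-Reasoning
      small-unit = vanishing (fromℕ 8 * V) (0≤* (0≤fromℕ 8) 0≤V) ε 0<ε
      t = proj₁ small-unit
      j = proj₁ (mesh t)
      small : fromℕ 8 * unit j * V ≤ ε
      small = ≤-trans (≤-reflexive (solve 3 (λ a u v → a :* u :* v := a :* v :* u) refl (fromℕ 8) (unit j) V))
        (proj₂ small-unit j (proj₁ (proj₂ (mesh t))))

    -- In this direction the comparison error belongs to the mesh i, so one exact mesh of any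
    -- fineness is enough.
    wallis-≥ : ∀ i → p - 1ℚ ≤ (discArea i + fromℕ 8 * unit i) * V
    wallis-≥ i = ≤-trans (proj₂ (proj₂ (proj₂ (mesh 0)))) (*-monoʳ 0≤V (discArea-compare (proj₁ (mesh 0)) i))

-- Comparison of ln n with multiples of ln 4m.

module Logarithm where

  open import Data.Rational hiding (NonZero)
  open import Data.Rational.Properties
  open ℚ-Lemmas
  open LnLemmas using (harmonic-mono; lnSum-increasing; lnSum-decreasing)
  open CentralBinomials

  lnSum-mono : ∀ {n n′} i → n ℕ.≤ n′ → lnSum n i ≤ lnSum n′ i
  lnSum-mono i n≤n′ = +-monoˡ-≤ (- harmonic (suc i)) (harmonic-mono (ℕ.*-monoˡ-≤ (suc i) n≤n′))

  -- Refining the mesh turns ln (a n) = ln a + ln n into an identity of Riemann sums.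
  lnSum-* : ∀ a n i j → suc j ≡ n ℕ.* suc i → lnSum (a ℕ.* n) i ≡ lnSum a j + lnSum n i
  lnSum-* a n i j eq = begin
    harmonic (a ℕ.* n ℕ.* suc i) - h
      ≡⟨ cong (λ l → harmonic l - h) (trans (ℕ.*-assoc a n (suc i)) (cong (a ℕ.*_) (sym eq))) ⟩
    harmonic (a ℕ.* suc j) - h
      ≡⟨ solve 3 (λ u v h → u :- h := u :- v :+ (v :- h)) refl (harmonic (a ℕ.* suc j)) (harmonic (suc j)) h ⟩
    harmonic (a ℕ.* suc j) - harmonic (suc j) + (harmonic (suc j) - h)
      ≡⟨ cong (λ l → lnSum a j + (harmonic l - h)) eq ⟩
    lnSum a j + lnSum n i ∎
    where
    open ≡-Reasoning
    h = harmonic (suc i)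

  module _ (a : ℕ) where

    private
      M : ℕ
      M = suc a

    M^k≥1 : ∀ k → 1 ℕ.≤ M ℕ.^ k
    M^k≥1 k = ℕ.m^n>0 M k

    refined : ℕ → ℕ → ℕ
    refined k i = ℕ.pred (M ℕ.^ k ℕ.* suc i)

    suc-refined : ∀ k i → suc (refined k i) ≡ M ℕ.^ k ℕ.* suc i
    suc-refined k i = ℕ.suc-pred (M ℕ.^ k ℕ.* suc i) {{ℕ.>-nonZero (ℕ.*-mono-≤ (M^k≥1 k) (s≤s (z≤n {i})))}}

    refined-≥ : ∀ k i → i ℕ.≤ refined k i
    refined-≥ k i = ℕ.≤-pred $ subst (suc i ℕ.≤_) (sym (suc-refined k i)) $
      ℕ.≤-trans (ℕ.≤-reflexive (sym (ℕ.*-identityˡ (suc i)))) (ℕ.*-monoˡ-≤ (suc i) (M^k≥1 k))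

    lnSum-1 : ∀ i → lnSum 1 i ≡ 0ℚ
    lnSum-1 i = trans (cong (λ l → harmonic l - harmonic (suc i)) (ℕ.*-identityˡ (suc i))) (+-inverseʳ (harmonic (suc i)))

    -- Each factor M contributes a Riemann sum of ln M on a refined mesh, and right sums grow under
    -- refinement.
    lnSum-^-≥ : ∀ k i → fromℕ k * lnSum M i ≤ lnSum (M ℕ.^ k) i
    lnSum-^-≥ zero    i = ≤-reflexive (trans (*-zeroˡ (lnSum M i)) (sym (lnSum-1 i)))
    lnSum-^-≥ (suc k) i = begin
      fromℕ (suc k) * lnSum M i           ≡⟨ cong (_* lnSum M i) (fromℕ-suc k) ⟩
      (1ℚ + fromℕ k) * lnSum M i          ≡⟨ solve 2 (λ y l → (con 1ℚ :+ y) :* l := l :+ y :* l) refl (fromℕ k) (lnSum M i) ⟩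
      lnSum M i + fromℕ k * lnSum M i     ≤⟨ +-mono (lnSum-increasing a (refined-≥ k i)) (lnSum-^-≥ k i) ⟩
      lnSum M (refined k i) + lnSum (M ℕ.^ k) i ≡⟨ lnSum-* M (M ℕ.^ k) i (refined k i) (suc-refined k i) ⟨
      lnSum (M ℕ.^ suc k) i               ∎
      where open ≤-Reasoning

    -- As in the lower bound, but using that the sum plus its mesh width decreases under refinement.
    lnSum-^-≤ : ∀ k i → lnSum (M ℕ.^ k) i ≤ fromℕ k * (lnSum M i + unit i)
    lnSum-^-≤ zero    i = ≤-reflexive (trans (lnSum-1 i) (sym (*-zeroˡ (lnSum M i + unit i))))
    lnSum-^-≤ (suc k) i = begin
      lnSum (M ℕ.^ suc k) i               ≡⟨ lnSum-* M (M ℕ.^ k) i (refined k i) (suc-refined k i) ⟩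
      lnSum M (refined k i) + lnSum (M ℕ.^ k) i ≤⟨ +-mono refined≤ (lnSum-^-≤ k i) ⟩
      y + fromℕ k * y                     ≡⟨ solve 2 (λ x y → y :+ x :* y := (con 1ℚ :+ x) :* y) refl (fromℕ k) y ⟩
      (1ℚ + fromℕ k) * y                  ≡⟨ cong (_* y) (fromℕ-suc k) ⟨
      fromℕ (suc k) * y                   ∎
      where
      open ≤-Reasoning
      y = lnSum M i + unit i
      refined≤ : lnSum M (refined k i) ≤ y
      refined≤ = ≤-trans (≤+ (lnSum M (refined k i)) (0≤unit (refined k i))) (lnSum-decreasing a (refined-≥ k i))

  ln-≥ : ∀ M .{{_ : NonZero M}} k {n} i → M ℕ.^ k ℕ.≤ n → fromℕ k * lnSum M i ≤ lnSum n i
  ln-≥ (suc a) k i h = ≤-trans (lnSum-^-≥ a k i) (lnSum-mono i h)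

  ln-≤ : ∀ M .{{_ : NonZero M}} k {n} i → n ℕ.≤ M ℕ.^ k → lnSum n i ≤ fromℕ k * (lnSum M i + unit i)
  ln-≤ (suc a) k i h = ≤-trans (lnSum-mono i h) (lnSum-^-≤ a k i)

-- Order and arithmetic of Cauchy reals.

open import Defs
open ℝ using (seq)
open ℚ-Lemmas
open CauchyLemmas using (eventually-bounded)
open OperationLemmas using (recip-inverse; recip-antitone; inverse-positive)
open SqrtLemmas using (rationalSqrt-lower; rationalSqrt-upper)
open DiagonalSums using (combine; combine₂; diag-nonNegative)
open CentralBinomials using (b; 0≤b; fromℕ-suc)
open Dags using (averageDagNodes-*; treeCount; 0≤hits)
open AverageBounds using (0≤1; by-difference; cancelʳ-≤; 0<treeCount; 0≤4; 0≤x)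
open Estimates using (estimate; errorConstant; Estimate)
open Wallis using (wallis-≤; wallis-≥; vanishing; 0≤V)
open Logarithm using (ln-≤; ln-≥)

both : ∀ M {N i} → M ℕ.+ N ℕ.≤ i → M ℕ.≤ i × N ℕ.≤ i
both M h = ℕ.m+n≤o⇒m≤o M h , ℕ.m+n≤o⇒n≤o M h

infix  4 _⊑_ _≈_

-- Copies of _≤_ and _≃_ that do not unfold, so that their arguments can be inferred.
record _⊑_ (x y : ℝ) : Set where
  constructor wrap
  field unwrap : x ≤ y

record _≈_ (x y : ℝ) : Set where
  constructor _,_
  field
    below : x ⊑ y
    above : y ⊑ x

open _⊑_ public
open _≈_ public

eventually : ∀ {x y} N → (∀ i → N ℕ.≤ i → seq x i ℚ.≤ seq y i) → x ⊑ y
eventually {y = y} N h = wrap λ ε 0<ε → N , λ i N≤i → ℚ.≤-trans (h i N≤i) (≤+ (seq y i) (ℚ.<⇒≤ 0<ε))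

pointwise : ∀ {x y} → (∀ i → seq x i ≡ seq y i) → x ⊑ y
pointwise h = eventually 0 λ i _ → ℚ.≤-reflexive (h i)

⊑-trans : ∀ {x y z} → x ⊑ y → y ⊑ z → x ⊑ z
⊑-trans {x} {y} {z} (wrap x≤y) (wrap y≤z) = wrap λ ε 0<ε →
  from ε (x≤y (ℚ.½ ℚ.* ε) (0<½* 0<ε)) (y≤z (ℚ.½ ℚ.* ε) (0<½* 0<ε))
  where
  from : ∀ ε → (∃[ N ] ∀ i → N ℕ.≤ i → seq x i ℚ.≤ seq y i ℚ.+ ℚ.½ ℚ.* ε) →
    (∃[ N ] ∀ i → N ℕ.≤ i → seq y i ℚ.≤ seq z i ℚ.+ ℚ.½ ℚ.* ε) → ∃[ N ] ∀ i → N ℕ.≤ i → seq x i ℚ.≤ seq z i ℚ.+ ε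
  from ε (M , p) (N , q) = M ℕ.+ N , λ i h → ℚ.≤-trans (p i (proj₁ (both M h))) $
    ℚ.≤-trans (ℚ.+-monoˡ-≤ η (q i (proj₂ (both M h)))) $
    ℚ.≤-reflexive (trans (ℚ.+-assoc (seq z i) η η) (cong (seq z i ℚ.+_) (halves ε)))
    where η = ℚ.½ ℚ.* ε

module ⊑-Reasoning where

  infix  1 begin_
  infixr 2 _⊑⟨_⟩_
  infix  3 _∎

  begin_ : ∀ {x y} → x ⊑ y → x ⊑ y
  begin p = p

  _⊑⟨_⟩_ : ∀ x {y z} → x ⊑ y → y ⊑ z → x ⊑ z
  x ⊑⟨ p ⟩ q = ⊑-trans p q

  _∎ : ∀ x → x ⊑ x
  x ∎ = pointwise λ _ → refl

≈⇒≃ : ∀ {x y} → x ≈ y → x ≃ y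
≈⇒≃ (wrap x≤y , wrap y≤x) ε 0<ε with x≤y ε 0<ε | y≤x ε 0<ε
... | M , p | N , q = M ℕ.+ N , λ i h → ∣∣-intro (p i (proj₁ (both M h))) (q i (proj₂ (both M h)))

eventually-≈ : ∀ {x y} N → (∀ i → N ℕ.≤ i → seq x i ≡ seq y i) → x ≈ y
eventually-≈ N h = eventually N (λ i N≤i → ℚ.≤-reflexive (h i N≤i))
  , eventually N (λ i N≤i → ℚ.≤-reflexive (sym (h i N≤i)))

pointwise-≈ : ∀ {x y} → (∀ i → seq x i ≡ seq y i) → x ≈ y
pointwise-≈ h = eventually-≈ 0 λ i _ → h i

≈-sym : ∀ {x y} → x ≈ y → y ≈ x
≈-sym (p , q) = q , p

≈-trans : ∀ {x y z} → x ≈ y → y ≈ z → x ≈ z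
≈-trans (p , q) (p′ , q′) = ⊑-trans p p′ , ⊑-trans q′ q

record NonNegative (x : ℝ) : Set where
  constructor _,_
  field
    onset : ℕ
    0≤seq : ∀ i → onset ℕ.≤ i → 0ℚ ℚ.≤ seq x i

open NonNegative public

positive⇒nonNegative : ∀ {x} → Positive x → NonNegative x
positive⇒nonNegative (mkPositive δ 0<δ N δ≤) = N , λ i N≤i → ℚ.≤-trans (ℚ.<⇒≤ 0<δ) (δ≤ i N≤i)

fromℚ-nonNegative : ∀ {q} → 0ℚ ℚ.≤ q → NonNegative (fromℚ q)
fromℚ-nonNegative 0≤q = 0 , λ _ _ → 0≤q

fromℚ-positive : ∀ {q} → 0ℚ ℚ.< q → Positive (fromℚ q)
fromℚ-positive {q} 0<q = mkPositive q 0<q 0 λ _ _ → ℚ.≤-refl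

*-nonNegative : ∀ {x y} → NonNegative x → NonNegative y → NonNegative (x * y)
*-nonNegative (M , p) (N , q) = M ℕ.+ N , λ i h → 0≤* (p i (proj₁ (both M h))) (q i (proj₂ (both M h)))

*-positive : ∀ {x y} → Positive x → Positive y → Positive (x * y)
*-positive (mkPositive δ 0<δ M δ≤) (mkPositive η 0<η N η≤) =
  mkPositive (δ ℚ.* η) (0<* {δ} 0<δ 0<η) (M ℕ.+ N) λ i h →
    *-mono (ℚ.≤-trans (ℚ.<⇒≤ 0<δ) (δ≤ i (proj₁ (both M h)))) (ℚ.<⇒≤ 0<η) (δ≤ i (proj₁ (both M h))) (η≤ i (proj₂ (both M h)))

⁻¹-positive : ∀ {x} (x>0 : Positive x) → Positive ((x ⁻¹) {{x>0}})
⁻¹-positive {x} (mkPositive δ 0<δ M δ≤) = from (eventually-bounded x)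
  where
  from : (∃[ B ] 0ℚ ℚ.< B × ∃[ N ] ∀ i → N ℕ.≤ i → ℚ.∣ seq x i ∣ ℚ.≤ B) → Positive ((x ⁻¹) {{mkPositive δ 0<δ M δ≤}})
  from (B , 0<B , N , ≤B) = mkPositive (recip B) (0<recip 0<B) (M ℕ.+ N) λ i h →
    recip-antitone (ℚ.<-≤-trans 0<δ (δ≤ i (proj₁ (both M h))))
      (ℚ.≤-trans (p≤∣p∣ (seq x i)) (≤B i (proj₂ (both M h))))
    where
    0<recip : ∀ {q} → 0ℚ ℚ.< q → 0ℚ ℚ.< recip q
    0<recip {q} 0<q = ℚ.≰⇒> λ r≤0 → ℚ.<-irrefl refl $ ℚ.<-≤-trans (ℚ.positive⁻¹ 1ℚ) $
      subst₂ ℚ._≤_ (recip-inverse 0<q) (ℚ.*-zeroʳ q) (*-monoˡ (ℚ.<⇒≤ 0<q) r≤0)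

⁻¹-inverse : ∀ {x} (x>0 : Positive x) → ∃[ N ] ∀ i → N ℕ.≤ i → seq x i ℚ.* recip (seq x i) ≡ 1ℚ
⁻¹-inverse (mkPositive δ 0<δ N δ≤) = N , λ i N≤i → recip-inverse (ℚ.<-≤-trans 0<δ (δ≤ i N≤i))

-- The factor z is eventually bounded by some B, so the tolerance ε/B is requested of the
-- hypothesis.
scaled : ∀ {x y} z → NonNegative z → x ⊑ y → z * x ⊑ z * y
scaled {x} {y} z (L , 0≤z) (wrap x≤y) = wrap λ ε 0<ε → scaled-ε ε 0<ε
  where
  module _ (ε : ℚ) (0<ε : 0ℚ ℚ.< ε) where
    Goal : Set
    Goal = ∃[ N ] ∀ i → N ℕ.≤ i → seq z i ℚ.* seq x i ℚ.≤ seq z i ℚ.* seq y i ℚ.+ ε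
    from : (∃[ B ] 0ℚ ℚ.< B × ∃[ N ] ∀ i → N ℕ.≤ i → ℚ.∣ seq z i ∣ ℚ.≤ B) → Goal
    from (B , 0<B , M , ≤B) = from′ (inverse-positive B 0<B)
      where
      from′ : ∃[ r ] B ℚ.* r ≡ 1ℚ × 0ℚ ℚ.< r → Goal
      from′ (r , Br , 0<r) = from″ (x≤y (r ℚ.* ε) (0<* {r} 0<r 0<ε))
        where
        from″ : (∃[ N ] ∀ i → N ℕ.≤ i → seq x i ℚ.≤ seq y i ℚ.+ r ℚ.* ε) → Goal
        from″ (N , p) = L ℕ.+ (M ℕ.+ N) , λ i h →
          let L≤i , MN≤i = both L h
              M≤i , N≤i  = both M MN≤i
          in begin
          seq z i ℚ.* seq x i
            ≤⟨ *-monoˡ (0≤z i L≤i) (p i N≤i) ⟩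
          seq z i ℚ.* (seq y i ℚ.+ r ℚ.* ε)
            ≡⟨ ℚ.*-distribˡ-+ (seq z i) (seq y i) (r ℚ.* ε) ⟩
          seq z i ℚ.* seq y i ℚ.+ seq z i ℚ.* (r ℚ.* ε)
            ≤⟨ ℚ.+-monoʳ-≤ (seq z i ℚ.* seq y i)
                 (*-monoʳ (ℚ.<⇒≤ (0<* {r} 0<r 0<ε)) (ℚ.≤-trans (p≤∣p∣ (seq z i)) (≤B i M≤i))) ⟩
          seq z i ℚ.* seq y i ℚ.+ B ℚ.* (r ℚ.* ε)
            ≡⟨ cong (seq z i ℚ.* seq y i ℚ.+_)
                 (trans (sym (ℚ.*-assoc B r ε)) (trans (cong (ℚ._* ε) Br) (ℚ.*-identityˡ ε))) ⟩
          seq z i ℚ.* seq y i ℚ.+ ε ∎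
          where open ℚ.≤-Reasoning
    scaled-ε : Goal
    scaled-ε = from (eventually-bounded z)

*-congʳ : ∀ {x y} z → NonNegative z → x ≈ y → z * x ≈ z * y
*-congʳ z z≥0 (p , q) = scaled z z≥0 p , scaled z z≥0 q

*-cancelˡ : ∀ {x y} z → Positive z → z * x ⊑ z * y → x ⊑ y
*-cancelˡ {x} {y} z z>0 zx≤zy = begin
  x              ⊑⟨ above (undo x) ⟩
  w * (z * x)    ⊑⟨ scaled w (positive⇒nonNegative (⁻¹-positive z>0)) zx≤zy ⟩
  w * (z * y)    ⊑⟨ below (undo y) ⟩
  y              ∎
  where
  open ⊑-Reasoning
  w = (z ⁻¹) {{z>0}}
  undo : ∀ u → w * (z * u) ≈ u
  undo u = eventually-≈ (proj₁ (⁻¹-inverse z>0)) λ i h →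
    combine (seq u i) (proj₂ (⁻¹-inverse z>0) i h)
      (solve 3 (λ w z u → w :* (z :* u) :- u := u :* (z :* w :- con 1ℚ)) refl (recip (seq z i)) (seq z i) (seq u i))

-- Squares are compared up to ε², since y² + ε² ≤ (y + ε)² for nonnegative y.
square-cancel : ∀ {x y} → NonNegative y → x * x ⊑ y * y → x ⊑ y
square-cancel {x} {y} (M , 0≤y) (wrap xx≤yy) = wrap λ ε 0<ε → from ε 0<ε (xx≤yy (ε ℚ.* ε) (0<* {ε} 0<ε 0<ε))
  where
  from : ∀ ε → 0ℚ ℚ.< ε → (∃[ N ] ∀ i → N ℕ.≤ i → seq x i ℚ.* seq x i ℚ.≤ seq y i ℚ.* seq y i ℚ.+ ε ℚ.* ε) →
    ∃[ N ] ∀ i → N ℕ.≤ i → seq x i ℚ.≤ seq y i ℚ.+ ε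
  from ε 0<ε (N , p) = M ℕ.+ N , λ i h →
    let 0≤yᵢ = 0≤y i (proj₁ (both M h))
        0≤yε = 0≤* 0≤yᵢ (ℚ.<⇒≤ 0<ε)
    in sq-cancel (0≤+ 0≤yᵢ (ℚ.<⇒≤ 0<ε)) $ ℚ.≤-trans (p i (proj₂ (both M h))) $
      by-difference (seq y i ℚ.* ε ℚ.+ seq y i ℚ.* ε) (0≤+ 0≤yε 0≤yε)
        (solve 2 (λ y e → (y :+ e) :* (y :+ e) :- (y :* y :+ e :* e) := y :* e :+ y :* e) refl (seq y i) ε)

square-limit : ∀ {x} y → Positive x → (∀ i → seq y i ≡ 0ℚ ⊎ seq y i ℚ.* seq y i ℚ.≤ seq x i) →
  (∀ i → seq x i ℚ.≤ (seq y i ℚ.+ unit i) ℚ.* (seq y i ℚ.+ unit i)) → y * y ≈ x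
square-limit {x} y (mkPositive δ 0<δ M δ≤) lower upper = eventually M (λ i M≤i → y²≤x i M≤i (lower i)) , wrap x≤y²
  where
  y²≤x : ∀ i → M ℕ.≤ i → seq y i ≡ 0ℚ ⊎ seq y i ℚ.* seq y i ℚ.≤ seq x i → seq y i ℚ.* seq y i ℚ.≤ seq x i
  -- The default value 0 of the rational root is harmless, because x is eventually positive.
  y²≤x i M≤i (inj₁ eq) = ℚ.≤-trans (ℚ.≤-reflexive (cong (λ t → t ℚ.* t) eq)) (ℚ.≤-trans (ℚ.<⇒≤ 0<δ) (δ≤ i M≤i))
  y²≤x i M≤i (inj₂ h)  = h
  x≤y² : x ≤ y * y
  x≤y² ε 0<ε = from (eventually-bounded y)
    where
    Goal : Set
    Goal = ∃[ N ] ∀ i → N ℕ.≤ i → seq x i ℚ.≤ seq y i ℚ.* seq y i ℚ.+ ε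
    from : (∃[ B ] 0ℚ ℚ.< B × ∃[ N ] ∀ i → N ℕ.≤ i → ℚ.∣ seq y i ∣ ℚ.≤ B) → Goal
    from (B , 0<B , L , ≤B) = from′ (vanishing C 0≤C ε 0<ε)
      where
      C : ℚ
      C = B ℚ.+ B ℚ.+ 1ℚ
      0≤C : 0ℚ ℚ.≤ C
      0≤C = 0≤+ (0≤+ (ℚ.<⇒≤ 0<B) (ℚ.<⇒≤ 0<B)) 0≤1
      from′ : (∃[ N ] ∀ i → N ℕ.≤ i → C ℚ.* unit i ℚ.≤ ε) → Goal
      from′ (N , p) = L ℕ.+ N , λ i h →
        let y≤B = ℚ.≤-trans (p≤∣p∣ (seq y i)) (≤B i (proj₁ (both L h))) in begin
        seq x i
          ≤⟨ upper i ⟩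
        (seq y i ℚ.+ unit i) ℚ.* (seq y i ℚ.+ unit i)
          ≡⟨ solve 2 (λ s u → (s :+ u) :* (s :+ u) := s :* s :+ (s :+ s :+ u) :* u) refl (seq y i) (unit i) ⟩
        seq y i ℚ.* seq y i ℚ.+ (seq y i ℚ.+ seq y i ℚ.+ unit i) ℚ.* unit i
          ≤⟨ ℚ.+-monoʳ-≤ (seq y i ℚ.* seq y i) (*-monoʳ (0≤unit i) (+-mono (+-mono y≤B y≤B) (unit-antitone {0} {i} ℕ.z≤n))) ⟩
        seq y i ℚ.* seq y i ℚ.+ C ℚ.* unit i
          ≤⟨ ℚ.+-monoʳ-≤ (seq y i ℚ.* seq y i) (p i (proj₂ (both L h))) ⟩
        seq y i ℚ.* seq y i ℚ.+ ε ∎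
        where open ℚ.≤-Reasoning

√-square : ∀ {x} → Positive x → √ x * √ x ≈ x
√-square {x} x>0 = square-limit (√ x) x>0
  (λ i → rationalSqrt-lower i (seq x i)) (λ i → rationalSqrt-upper i (seq x i))

open ⊑-Reasoning

rational : ∀ {q r x} → q ℚ.≤ r → NonNegative x → fromℚ q * x ⊑ fromℚ r * x
rational q≤r (N , 0≤x) = eventually N λ i N≤i → *-monoʳ (0≤x i N≤i) q≤r

-- The ratio of average and main term, estimated through its square.

module Quotient (ℓ λₘ ϖ k s : ℝ) (ℓ>0 : Positive ℓ) (λ>0 : Positive λₘ) (ϖ>0 : Positive ϖ) (k>0 : Positive k) (s>0 : Positive s)
  (k² : k * k ≈ (λₘ / ϖ) {{ϖ>0}}) (s² : s * s ≈ ℓ)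
  (A N : ℚ) (0≤A : 0ℚ ℚ.≤ A) (0<N : 0ℚ ℚ.< N) where

  x z ε : ℝ
  x = k * (fromℚ N / s) {{s>0}}

  x>0 : Positive x
  x>0 = *-positive k>0 (*-positive (fromℚ-positive 0<N) (⁻¹-positive s>0))

  z = fromℚ A * (x ⁻¹) {{x>0}}
  ε = z + - fromℚ 1ℚ

  z≥0 : NonNegative z
  z≥0 = *-nonNegative (fromℚ-nonNegative 0≤A) (positive⇒nonNegative (⁻¹-positive x>0))

  product : fromℚ A ≈ x * (fromℚ 1ℚ + ε)
  product = eventually-≈ (proj₁ (⁻¹-inverse x>0)) λ i h →
    combine (ℚ.- A) (proj₂ (⁻¹-inverse x>0) i h)
      (solve 3 (λ a x w → a :- x :* (con 1ℚ :+ (a :* w :+ :- con 1ℚ)) := :- a :* (x :* w :- con 1ℚ)) refl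
        A (seq x i) (recip (seq x i)))

  R : ℝ
  R = fromℚ (N ℚ.* N) * (z * z)

  R≥0 : NonNegative R
  R≥0 = *-nonNegative (fromℚ-nonNegative (0≤* (ℚ.<⇒≤ 0<N) (ℚ.<⇒≤ 0<N))) (*-nonNegative z≥0 z≥0)

  -- N k z = A √ℓ holds exactly, as x = N k / √ℓ and z = A / x.
  linear : ∃[ M ] ∀ i → M ℕ.≤ i → N ℚ.* seq k i ℚ.* seq z i ≡ A ℚ.* seq s i
  linear = M₁ ℕ.+ M₂ , λ i h → let h₁ , h₂ = both M₁ h in
    combine₂ (A ℚ.* seq s i) (ℚ.- (A ℚ.* N ℚ.* seq k i ℚ.* recip (seq x i)))
      (proj₂ (⁻¹-inverse x>0) i h₁)
      (proj₂ (⁻¹-inverse s>0) i h₂)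
      (solve 6 (λ n k a w s r → n :* k :* (a :* w) :- a :* s
        := a :* s :* (k :* (n :* r) :* w :- con 1ℚ) :+ :- (a :* n :* k :* w) :* (s :* r :- con 1ℚ)) refl
        N (seq k i) A (recip (seq x i)) (seq s i) (recip (seq s i)))
    where
    M₁ = proj₁ (⁻¹-inverse x>0)
    M₂ = proj₁ (⁻¹-inverse s>0)

  λ-k² : λₘ ≈ ϖ * (k * k)
  λ-k² = ≈-trans
    (eventually-≈ (proj₁ (⁻¹-inverse ϖ>0)) λ i h →
      combine (ℚ.- seq λₘ i) (proj₂ (⁻¹-inverse ϖ>0) i h)
        (solve 3 (λ l p w → l :- p :* (l :* w) := :- l :* (p :* w :- con 1ℚ)) refl (seq λₘ i) (seq ϖ i) (recip (seq ϖ i))))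
    (*-congʳ ϖ (positive⇒nonNegative ϖ>0)
      (≈-sym k²))

  ϖA² : ℝ
  ϖA² = ϖ * fromℚ (A ℚ.* A)

  ϖA²≥0 : NonNegative ϖA²
  ϖA²≥0 = *-nonNegative (positive⇒nonNegative ϖ>0) (fromℚ-nonNegative (0≤* 0≤A 0≤A))

  -- The square of `linear`, with k² and s² replaced by their values: both square roots are gone,
  -- and only rationals, ϖ, λ and ℓ remain.
  square-relation : R * λₘ ≈ ϖA² * ℓ
  square-relation = ≈-trans
    (*-congʳ R R≥0 λ-k²) $
    ≈-trans
      (eventually-≈ (proj₁ linear) λ i h →
        combine (seq ϖ i ℚ.* (N ℚ.* seq k i ℚ.* seq z i ℚ.+ A ℚ.* seq s i)) (proj₂ linear i h)
          (solve 6 (λ n z p k a s → n :* n :* (z :* z) :* (p :* (k :* k)) :- p :* (a :* a) :* (s :* s)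
            := p :* (n :* k :* z :+ a :* s) :* (n :* k :* z :- a :* s)) refl
            N (seq z i) (seq ϖ i) (seq k i) A (seq s i)))
      (*-congʳ ϖA² ϖA²≥0 s²)

  module Bounds (b p E : ℚ) (1≤p : 1ℚ ℚ.≤ p) (0≤b : 0ℚ ℚ.≤ b) (0≤E : 0ℚ ℚ.≤ E)
    (A≤ : p ℚ.* A ℚ.≤ N ℚ.* b ℚ.* (p ℚ.+ E)) (A≥ : N ℚ.* b ℚ.* (p ℚ.- E) ℚ.≤ p ℚ.* A)
    (ϖ≤ : ϖ * fromℚ (p ℚ.* b ℚ.* (p ℚ.* b)) ⊑ fromℚ (1ℚ ℚ.+ p))
    (ϖ≥ : fromℚ (p ℚ.- 1ℚ) ⊑ ϖ * fromℚ (p ℚ.* b ℚ.* (p ℚ.* b)))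
    (ℓ≤ : ℓ ⊑ fromℚ p * λₘ) (ℓ≥ : fromℚ (p ℚ.- 1ℚ) * λₘ ⊑ ℓ) where

    private
      V p² e : ℚ
      V = p ℚ.* b ℚ.* (p ℚ.* b)
      p² = p ℚ.* p
      -- Chosen so that (p+E)(1+p) ≤ p(p+e) and p(p-e) ≤ (p-E)(p-1); the 1 comes from π and the
      -- logarithm, the E from the estimate of A.
      e = 1ℚ ℚ.+ (E ℚ.+ E)
      0≤p : 0ℚ ℚ.≤ p
      0≤p = ℚ.≤-trans 0≤1 1≤p
      0<p : 0ℚ ℚ.< p
      0<p = ℚ.<-≤-trans (ℚ.positive⁻¹ 1ℚ) 1≤p
      0≤N : 0ℚ ℚ.≤ N
      0≤N = ℚ.<⇒≤ 0<N
      0≤p-1 : 0ℚ ℚ.≤ p ℚ.- 1ℚ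
      0≤p-1 = subst (ℚ._≤ p ℚ.- 1ℚ) (ℚ.+-inverseʳ 1ℚ) (ℚ.+-monoˡ-≤ (ℚ.- 1ℚ) 1≤p)
      ϖ≥0 = positive⇒nonNegative ϖ>0
      ℓ≥0 = positive⇒nonNegative ℓ>0
      λ≥0 = positive⇒nonNegative λ>0
      ϖℓ≥0 : NonNegative (ϖ * ℓ)
      ϖℓ≥0 = *-nonNegative ϖ≥0 ℓ≥0
      N²λ : ℝ
      N²λ = fromℚ (N ℚ.* N) * λₘ
      N²λ>0 : Positive N²λ
      N²λ>0 = *-positive (fromℚ-positive (0<* {N} 0<N 0<N)) λ>0
      p²z : ℝ
      p²z = fromℚ p² * z

      scaled-square-relation : N²λ * (p²z * p²z) ≈ fromℚ (p² ℚ.* p² ℚ.* (A ℚ.* A)) * (ϖ * ℓ)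
      scaled-square-relation = ≈-trans
        (pointwise-≈ λ i →
          solve 4 (λ n l p z → n :* n :* l :* (p :* z :* (p :* z)) := p :* p :* (n :* n :* (z :* z) :* l)) refl
            N (seq λₘ i) p² (seq z i)) $
        ≈-trans
          (*-congʳ (fromℚ (p² ℚ.* p²)) (fromℚ-nonNegative (0≤* (0≤* 0≤p 0≤p) (0≤* 0≤p 0≤p))) square-relation)
          (pointwise-≈ λ i →
            solve 4 (λ p w a l → p :* p :* (w :* (a :* a) :* l) := p :* p :* (a :* a) :* (w :* l)) refl
              p² (seq ϖ i) A (seq ℓ i))
        where S = fromℚ (p² ℚ.* p² ℚ.* (A ℚ.* A)) * (ϖ * ℓ)

    z-upper : fromℚ p * z ⊑ fromℚ (p ℚ.+ e)
    z-upper = *-cancelˡ (fromℚ p) (fromℚ-positive 0<p) $ begin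
      fromℚ p * (fromℚ p * z)
        ⊑⟨ pointwise (λ i → sym (ℚ.*-assoc p p (seq z i))) ⟩
      p²z
        ⊑⟨ square-cancel (fromℚ-nonNegative 0≤u)
             (*-cancelˡ N²λ N²λ>0 squares) ⟩
      fromℚ u
        ⊑⟨ eventually 0 (λ _ _ → by-difference (E ℚ.* (p ℚ.- 1ℚ)) (0≤* 0≤E 0≤p-1)
             (solve 2 (λ p E → p :* (p :+ (con 1ℚ :+ (E :+ E))) :- (p :+ E) :* (con 1ℚ :+ p) := E :* (p :- con 1ℚ)) refl p E)) ⟩
      fromℚ p * fromℚ (p ℚ.+ e) ∎
      where
      u v : ℚ
      u = (p ℚ.+ E) ℚ.* (1ℚ ℚ.+ p)
      v = N ℚ.* N ℚ.* ((p ℚ.+ E) ℚ.* (p ℚ.+ E))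
      0≤pE : 0ℚ ℚ.≤ p ℚ.+ E
      0≤pE = 0≤+ 0≤p 0≤E
      0≤u : 0ℚ ℚ.≤ u
      0≤u = 0≤* 0≤pE (0≤+ 0≤1 0≤p)
      0≤v : 0ℚ ℚ.≤ v
      0≤v = 0≤* (0≤* 0≤N 0≤N) (0≤* 0≤pE 0≤pE)
      A²≤ : p² ℚ.* p² ℚ.* (A ℚ.* A) ℚ.≤ v ℚ.* V
      A²≤ = ℚ.≤-trans (ℚ.≤-reflexive (solve 2 (λ p a → p :* p :* (p :* p) :* (a :* a) := p :* p :* (p :* a :* (p :* a))) refl p A)) $
        ℚ.≤-trans (*-monoˡ (0≤* 0≤p 0≤p) (*-mono (0≤* (0≤* 0≤N 0≤b) 0≤pE) (0≤* 0≤p 0≤A) A≤ A≤))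
        (ℚ.≤-reflexive (solve 4 (λ p n b q → p :* p :* (n :* b :* q :* (n :* b :* q)) := n :* n :* (q :* q) :* (p :* b :* (p :* b))) refl
          p N b (p ℚ.+ E)))
      squares : N²λ * (p²z * p²z) ⊑ N²λ * (fromℚ u * fromℚ u)
      squares = begin
        N²λ * (p²z * p²z)
          ⊑⟨ below scaled-square-relation ⟩
        fromℚ (p² ℚ.* p² ℚ.* (A ℚ.* A)) * (ϖ * ℓ)
          ⊑⟨ rational A²≤ ϖℓ≥0 ⟩
        fromℚ (v ℚ.* V) * (ϖ * ℓ)
          ⊑⟨ pointwise (λ i → solve 4 (λ v V w l → v :* V :* (w :* l) := v :* l :* (w :* V)) refl v V (seq ϖ i) (seq ℓ i)) ⟩
        fromℚ v * ℓ * (ϖ * fromℚ V)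
          ⊑⟨ scaled (fromℚ v * ℓ) (*-nonNegative (fromℚ-nonNegative 0≤v) ℓ≥0) ϖ≤ ⟩
        fromℚ v * ℓ * fromℚ (1ℚ ℚ.+ p)
          ⊑⟨ pointwise (λ i → solve 3 (λ v l q → v :* l :* q := v :* q :* l) refl v (seq ℓ i) (1ℚ ℚ.+ p)) ⟩
        fromℚ (v ℚ.* (1ℚ ℚ.+ p)) * ℓ
          ⊑⟨ scaled (fromℚ (v ℚ.* (1ℚ ℚ.+ p))) (fromℚ-nonNegative (0≤* 0≤v (0≤+ 0≤1 0≤p))) ℓ≤ ⟩
        fromℚ (v ℚ.* (1ℚ ℚ.+ p)) * (fromℚ p * λₘ)
          ⊑⟨ pointwise (λ i → sym (ℚ.*-assoc (v ℚ.* (1ℚ ℚ.+ p)) p (seq λₘ i))) ⟩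
        fromℚ (v ℚ.* (1ℚ ℚ.+ p) ℚ.* p) * λₘ
          -- The factor p from ℓ is enlarged to 1 + p, matching the one from ϖ, so that the bound
          -- becomes a perfect square.
          ⊑⟨ rational (*-monoˡ (0≤* 0≤v (0≤+ 0≤1 0≤p)) (subst (ℚ._≤ 1ℚ ℚ.+ p) (ℚ.+-identityˡ p) (ℚ.+-monoˡ-≤ p 0≤1))) λ≥0 ⟩
        fromℚ (v ℚ.* (1ℚ ℚ.+ p) ℚ.* (1ℚ ℚ.+ p)) * λₘ
          ⊑⟨ pointwise (λ i → solve 4 (λ n q s l → n :* n :* (q :* q) :* s :* s :* l := n :* n :* l :* (q :* s :* (q :* s))) refl
               N (p ℚ.+ E) (1ℚ ℚ.+ p) (seq λₘ i)) ⟩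
        N²λ * (fromℚ u * fromℚ u) ∎

    z-lower : fromℚ (p ℚ.- e) ⊑ fromℚ p * z
    z-lower = by-sign (ℚ.≤-total 0ℚ (p ℚ.- E))
      where
      q u v : ℚ
      q = p ℚ.- E
      u = q ℚ.* (p ℚ.- 1ℚ)
      v = N ℚ.* N ℚ.* (q ℚ.* q)
      pz≥0 : NonNegative (fromℚ p * z)
      pz≥0 = *-nonNegative (fromℚ-nonNegative 0≤p) z≥0
      by-sign : 0ℚ ℚ.≤ q ⊎ q ℚ.≤ 0ℚ → fromℚ (p ℚ.- e) ⊑ fromℚ p * z
      -- For p ≤ E the estimate of A cannot be squared, but then p - e is negative and the claim is
      -- trivial.
      by-sign (inj₂ q≤0) = eventually (onset pz≥0) λ i h → ℚ.≤-trans
        (ℚ.≤-trans (by-difference (1ℚ ℚ.+ E) (0≤+ 0≤1 0≤E)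
          (solve 2 (λ p E → p :- E :- (p :- (con 1ℚ :+ (E :+ E))) := con 1ℚ :+ E) refl p E)) q≤0)
        (0≤seq pz≥0 i h)
      by-sign (inj₁ 0≤q) = *-cancelˡ (fromℚ p) (fromℚ-positive 0<p) $ begin
        fromℚ p * fromℚ (p ℚ.- e)
          ⊑⟨ eventually 0 (λ _ _ → by-difference (E ℚ.+ E ℚ.* p) (0≤+ 0≤E (0≤* 0≤E 0≤p))
               (solve 2 (λ p E → (p :- E) :* (p :- con 1ℚ) :- p :* (p :- (con 1ℚ :+ (E :+ E))) := E :+ E :* p) refl p E)) ⟩
        fromℚ u
          ⊑⟨ square-cancel (*-nonNegative (fromℚ-nonNegative (0≤* 0≤p 0≤p)) z≥0)
               (*-cancelˡ N²λ N²λ>0 squares) ⟩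
        p²z
          ⊑⟨ pointwise (λ i → ℚ.*-assoc p p (seq z i)) ⟩
        fromℚ p * (fromℚ p * z) ∎
        where
        0≤v : 0ℚ ℚ.≤ v
        0≤v = 0≤* (0≤* 0≤N 0≤N) (0≤* 0≤q 0≤q)
        A²≥ : v ℚ.* V ℚ.≤ p² ℚ.* p² ℚ.* (A ℚ.* A)
        A²≥ = ℚ.≤-trans (ℚ.≤-reflexive (solve 4 (λ p n b q → n :* n :* (q :* q) :* (p :* b :* (p :* b))
            := p :* p :* (n :* b :* q :* (n :* b :* q))) refl p N b q)) $
          ℚ.≤-trans (*-monoˡ (0≤* 0≤p 0≤p) (*-mono (0≤* 0≤p 0≤A) (0≤* (0≤* 0≤N 0≤b) 0≤q) A≥ A≥))
          (ℚ.≤-reflexive (solve 2 (λ p a → p :* p :* (p :* a :* (p :* a)) := p :* p :* (p :* p) :* (a :* a)) refl p A))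
        squares : N²λ * (fromℚ u * fromℚ u) ⊑ N²λ * (p²z * p²z)
        squares = begin
          N²λ * (fromℚ u * fromℚ u)
            ⊑⟨ pointwise (λ i → solve 4 (λ n q s l → n :* n :* l :* (q :* s :* (q :* s)) := n :* n :* (q :* q) :* s :* (s :* l)) refl
                 N q (p ℚ.- 1ℚ) (seq λₘ i)) ⟩
          fromℚ (v ℚ.* (p ℚ.- 1ℚ)) * (fromℚ (p ℚ.- 1ℚ) * λₘ)
            ⊑⟨ scaled (fromℚ (v ℚ.* (p ℚ.- 1ℚ))) (fromℚ-nonNegative (0≤* 0≤v 0≤p-1)) ℓ≥ ⟩
          fromℚ (v ℚ.* (p ℚ.- 1ℚ)) * ℓ
            ⊑⟨ pointwise (λ i → solve 3 (λ v l q → v :* q :* l := v :* l :* q) refl v (seq ℓ i) (p ℚ.- 1ℚ)) ⟩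
          fromℚ v * ℓ * fromℚ (p ℚ.- 1ℚ)
            ⊑⟨ scaled (fromℚ v * ℓ) (*-nonNegative (fromℚ-nonNegative 0≤v) ℓ≥0) ϖ≥ ⟩
          fromℚ v * ℓ * (ϖ * fromℚ V)
            ⊑⟨ pointwise (λ i → solve 4 (λ v V w l → v :* l :* (w :* V) := v :* V :* (w :* l)) refl v V (seq ϖ i) (seq ℓ i)) ⟩
          fromℚ (v ℚ.* V) * (ϖ * ℓ)
            ⊑⟨ rational A²≥ ϖℓ≥0 ⟩
          fromℚ (p² ℚ.* p² ℚ.* (A ℚ.* A)) * (ϖ * ℓ)
            ⊑⟨ above scaled-square-relation ⟩
          N²λ * (p²z * p²z) ∎

    error-≤ : fromℚ p * ∣ ε ∣ ⊑ fromℚ e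
    error-≤ = wrap λ δ 0<δ → from δ (unwrap z-upper δ 0<δ) (unwrap z-lower δ 0<δ)
      where
      from : ∀ δ → (∃[ M ] ∀ i → M ℕ.≤ i → p ℚ.* seq z i ℚ.≤ p ℚ.+ e ℚ.+ δ) →
        (∃[ M ] ∀ i → M ℕ.≤ i → p ℚ.- e ℚ.≤ p ℚ.* seq z i ℚ.+ δ) →
        ∃[ M ] ∀ i → M ℕ.≤ i → p ℚ.* ℚ.∣ seq ε i ∣ ℚ.≤ e ℚ.+ δ
      from δ (M , up) (M′ , lo) = M ℕ.+ M′ , λ i h → ℚ.≤-trans (ℚ.≤-reflexive (absolute i)) $
        ∣∣-intro (ℚ.≤-trans (up i (proj₁ (both M h))) (ℚ.≤-reflexive (ℚ.+-assoc p e δ)))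
          (ℚ.≤-trans (ℚ.≤-reflexive (solve 2 (λ p e → p := p :- e :+ e) refl p e))
            (ℚ.≤-trans (ℚ.+-monoˡ-≤ e (lo i (proj₂ (both M h))))
              (ℚ.≤-reflexive (solve 3 (λ s d e → s :+ d :+ e := s :+ (e :+ d)) refl (p ℚ.* seq z i) δ e))))
        where
        absolute : ∀ i → p ℚ.* ℚ.∣ seq ε i ∣ ≡ ℚ.∣ p ℚ.* seq z i ℚ.- p ∣
        absolute i = trans (cong (ℚ._* ℚ.∣ seq ε i ∣) (sym (ℚ.0≤p⇒∣p∣≡p 0≤p))) $
          trans (sym (ℚ.∣p*q∣≡∣p∣*∣q∣ p (seq ε i))) $
          cong ℚ.∣_∣ (solve 2 (λ p z → p :* (z :+ :- con 1ℚ) := p :* z :- p) refl p (seq z i))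

    -- Since ℓ ≤ p λ, the bound e on p times the error gives the bound e λ on ℓ times the error.
    -- This is how 1/P turns into 1/ln n.
    relative-error : ∣ ε ∣ ⊑ (fromℚ e * λₘ) * ∣ fromℚ 1ℚ * (ℓ ⁻¹) {{ℓ>0}} ∣
    relative-error = *-cancelˡ ℓ ℓ>0 scaled-error
      where
      C w : ℝ
      C = fromℚ e * λₘ
      w = fromℚ 1ℚ * (ℓ ⁻¹) {{ℓ>0}}
      ℓ⁻¹≥0 = positive⇒nonNegative (⁻¹-positive ℓ>0)
      M₁ = proj₁ (⁻¹-inverse ℓ>0)
      M₂ = onset ℓ⁻¹≥0
      undo : ∀ i → M₁ ℕ.≤ i → M₂ ℕ.≤ i → seq λₘ i ℚ.* e ≡ seq ℓ i ℚ.* (e ℚ.* seq λₘ i ℚ.* ℚ.∣ 1ℚ ℚ.* recip (seq ℓ i) ∣)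
      undo i h₁ h₂ = trans (combine (ℚ.- (e ℚ.* seq λₘ i)) (proj₂ (⁻¹-inverse ℓ>0) i h₁)
        (solve 4 (λ l e k w → l :* e :- k :* (e :* l :* w) := :- (e :* l) :* (k :* w :- con 1ℚ)) refl
          (seq λₘ i) e (seq ℓ i) (recip (seq ℓ i))))
        (cong (λ t → seq ℓ i ℚ.* (e ℚ.* seq λₘ i ℚ.* t))
          (sym (trans (cong ℚ.∣_∣ (ℚ.*-identityˡ (recip (seq ℓ i)))) (ℚ.0≤p⇒∣p∣≡p (0≤seq ℓ⁻¹≥0 i h₂)))))
      scaled-error : ℓ * ∣ ε ∣ ⊑ ℓ * (C * ∣ w ∣)
      scaled-error = begin
        ℓ * ∣ ε ∣
          ⊑⟨ pointwise (λ i → ℚ.*-comm (seq ℓ i) ℚ.∣ seq ε i ∣) ⟩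
        ∣ ε ∣ * ℓ
          ⊑⟨ scaled ∣ ε ∣ (0 , λ i _ → ℚ.0≤∣p∣ (seq ε i)) ℓ≤ ⟩
        ∣ ε ∣ * (fromℚ p * λₘ)
          ⊑⟨ pointwise (λ i → solve 3 (λ a p l → a :* (p :* l) := l :* (p :* a)) refl ℚ.∣ seq ε i ∣ p (seq λₘ i)) ⟩
        λₘ * (fromℚ p * ∣ ε ∣)
          ⊑⟨ scaled λₘ λ≥0 error-≤ ⟩
        λₘ * fromℚ e
          ⊑⟨ eventually (M₁ ℕ.+ M₂) (λ i h → ℚ.≤-reflexive (undo i (proj₁ (both M₁ h)) (proj₂ (both M₁ h)))) ⟩
        ℓ * (C * ∣ w ∣) ∎

-- Specialisation to ln n, ln 4m, π and κ.

averageDagNodes-nonNegative : ∀ m .{{_ : NonZero m}} n → 0ℚ ℚ.≤ averageDagNodes m n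
averageDagNodes-nonNegative m n = cancelʳ-≤ (0<treeCount m n) $
  subst₂ ℚ._≤_ (sym (ℚ.*-zeroˡ (treeCount {m} n))) (sym (averageDagNodes-* m n)) $
  diag-nonNegative n λ p _ → 0≤hits {m} n p

4*-nonTrivial : ∀ m .{{_ : NonZero m}} → NonTrivial (4 ℕ.* m)
4*-nonTrivial m = ℕ.n>1⇒nonTrivial (ℕ.≤-trans (ℕ.s≤s (ℕ.s≤s ℕ.z≤n)) (ℕ.*-monoʳ-≤ 4 (ℕ.>-nonZero⁻¹ m)))

module _ (m : ℕ) .{{_ : NonZero m}} where

  private
    ln4m : ℝ
    ln4m = ln (4 ℕ.* m) {{ℕ.m*n≢0 4 m}}

    ln4m>0 : Positive ln4m
    ln4m>0 = ln-positive {4 ℕ.* m} {{4*-nonTrivial m}}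

    ln4m/π>0 : Positive (ln4m / π)
    ln4m/π>0 = *-positive ln4m>0 (⁻¹-positive π-positive)

    κ>0 : Positive (κ m)
    κ>0 = √-positive {{ln4m/π>0}}

    κ² : κ m * κ m ≈ ln4m / π
    κ² = √-square ln4m/π>0

    E : ℚ
    E = errorConstant m

    0≤E : 0ℚ ℚ.≤ E
    0≤E = 0≤+ (0≤* (0≤* 0≤4 (0≤x m)) (0≤x m)) (0≤* 0≤4 (0≤x m))

  module _ (n : ℕ) .{{n>1 : NonTrivial n}} where

    1≤n : 1 ℕ.≤ n
    1≤n = ℕ.<⇒≤ (ℕ.nonTrivial⇒n>1 n)

    open Quotient (ln n) ln4m π (κ m) (√ (ln n)) ln-positive ln4m>0 π-positive κ>0 √-positive κ² (√-square ln-positive)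
      (averageDagNodes m n) (fromℕ n)
      (averageDagNodes-nonNegative m n) (ℚ.<-≤-trans (ℚ.positive⁻¹ 1ℚ) (fromℕ-mono 1≤n)) public

    bound : Estimate m n → ∣ ε ∣ ⊑ (fromℚ (1ℚ ℚ.+ (E ℚ.+ E)) * ln4m) * ∣ fromℚ 1ℚ / ln n ∣
    bound (k , lo , hi , A≤ , A≥) = Bounds.relative-error (b (suc k)) p E 1≤p (0≤b (suc k)) 0≤E A≤ A≥ π≤ π≥ ln≤ ln≥
      where
      p V : ℚ
      p = fromℕ (suc k)
      V = p ℚ.* b (suc k) ℚ.* (p ℚ.* b (suc k))
      1≤p : 1ℚ ℚ.≤ p
      1≤p = fromℕ-mono {1} {suc k} (ℕ.s≤s ℕ.z≤n)
      p-1 : p ℚ.- 1ℚ ≡ fromℕ k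
      p-1 = trans (cong (ℚ._- 1ℚ) (fromℕ-suc k)) (solve 1 (λ y → con 1ℚ :+ y :- con 1ℚ := y) refl (fromℕ k))
      π≤ : π * fromℚ V ⊑ fromℚ (1ℚ ℚ.+ p)
      π≤ = wrap λ δ 0<δ → 0 , λ i _ → wallis-≤ k δ 0<δ i
      π≥ : fromℚ (p ℚ.- 1ℚ) ⊑ π * fromℚ V
      π≥ = wrap λ δ 0<δ → from δ (vanishing (fromℕ 8 ℚ.* V) (0≤* (0≤fromℕ 8) (0≤V k)) δ 0<δ)
        where
        from : ∀ δ → (∃[ M ] ∀ i → M ℕ.≤ i → fromℕ 8 ℚ.* V ℚ.* unit i ℚ.≤ δ) →
          ∃[ M ] ∀ i → M ℕ.≤ i → p ℚ.- 1ℚ ℚ.≤ discArea i ℚ.* V ℚ.+ δ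
        from δ (M , h) = M , λ i M≤i → ℚ.≤-trans (wallis-≥ k i) $ ℚ.≤-trans
          (ℚ.≤-reflexive (solve 4 (λ d a u v → (d :+ a :* u) :* v := d :* v :+ a :* v :* u) refl (discArea i) (fromℕ 8) (unit i) V))
          (ℚ.+-monoʳ-≤ (discArea i ℚ.* V) (h i M≤i))
      ln≤ : ln n ⊑ fromℚ p * ln4m
      ln≤ = wrap λ δ 0<δ → from δ (vanishing p (0≤fromℕ (suc k)) δ 0<δ)
        where
        from : ∀ δ → (∃[ M ] ∀ i → M ℕ.≤ i → p ℚ.* unit i ℚ.≤ δ) →
          ∃[ M ] ∀ i → M ℕ.≤ i → lnSum n i ℚ.≤ p ℚ.* lnSum (4 ℕ.* m) i ℚ.+ δ
        from δ (M , h) = M , λ i M≤i → ℚ.≤-trans (ln-≤ (4 ℕ.* m) {{ℕ.m*n≢0 4 m}} (suc k) i hi) $ ℚ.≤-trans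
          (ℚ.≤-reflexive (ℚ.*-distribˡ-+ p (lnSum (4 ℕ.* m) i) (unit i)))
          (ℚ.+-monoʳ-≤ (p ℚ.* lnSum (4 ℕ.* m) i) (h i M≤i))
      ln≥ : fromℚ (p ℚ.- 1ℚ) * ln4m ⊑ ln n
      ln≥ = eventually 0 λ i _ → subst (λ q → q ℚ.* lnSum (4 ℕ.* m) i ℚ.≤ lnSum n i) (sym p-1)
        (ln-≥ (4 ℕ.* m) {{ℕ.m*n≢0 4 m}} k i lo)

  relativeError : (n : ℕ) .{{_ : NonTrivial n}} → ℝ
  relativeError n = ε n

  relativeErrorConstant : ℝ
  relativeErrorConstant = fromℚ (1ℚ ℚ.+ (E ℚ.+ E)) * ln4m

  relativeError-≤ : (n : ℕ) .{{_ : NonTrivial n}} →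
    ∣ relativeError n ∣ ⊑ relativeErrorConstant * ∣ fromℚ 1ℚ / ln n ∣
  relativeError-≤ n = bound n (estimate m n (1≤n n))

  averageDagNodes-≈ : (n : ℕ) .{{_ : NonTrivial n}} →
    fromℚ (averageDagNodes m n) ≈ κ m * (fromℚ (fromℕ n) / √ (ln n)) * (fromℚ 1ℚ + relativeError n)
  averageDagNodes-≈ n = product n

theorem9 : (m : ℕ) .{{_ : NonZero m}} →
    Σ ((n : ℕ) .{{_ : NonTrivial n}} → ℝ) λ ε →
    (ε =O (λ n → fromℚ 1ℚ / ln n)) ×
    ((n : ℕ) .{{_ : NonTrivial n}} →
    fromℚ (averageDagNodes m n) ≃ κ m * (fromℚ (fromℕ n) / √ (ln n)) * (fromℚ 1ℚ + ε n))
theorem9 m {{m≥1}} = relativeError m {{m≥1}}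
  -- The bound holds for every n ≥ 2, so the threshold is 0.
  , (relativeErrorConstant m {{m≥1}} , 0 , λ n {{n>1}} _ → unwrap (relativeError-≤ m {{m≥1}} n {{n>1}}))
  , λ n {{n>1}} → ≈⇒≃ (averageDagNodes-≈ m {{m≥1}} n {{n>1}})
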